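{- With framed arithmetic divisors $(L,\xi,\tau)$ ($L$ torsion-free rank 1, $\xi:L\to\widehat{\mathbf{Z}}$ generating $\operatorname{Hom}(L,\widehat{\mathbf{Z}})$ as a $\widehat{\mathbf{Z}}$-module, $\tau:L\to\mathbf{R}$ a homomorphism) and isomorphisms $\phi:L\xrightarrow{\sim}L'$ with $\xi'\circ\phi=\xi$, $\tau'\circ\phi=\tau$, define the tensor product $(L_1,\xi_1,\tau_1)\otimes(L_2,\xi_2,\tau_2)=(L_1\otimes_\mathbf{Z}L_2,\xi,\tau)$ by $\xi(x\otimes y)=\xi_1(x)\xi_2(y)$ (product in $\widehat{\mathbf{Z}}$) and $\tau(x\otimes y)=\tau_1(x)\tau_2(y)$. Let $\operatorname{Pic}_{Fr}(\overline{\operatorname{Spec}\mathbf{Z}})$ be the set of isomorphism classes. For $a=(a_f,a_\infty)\in\mathbb{A}$ (adeles of $\mathbf{Q}$) let $D_a=(L_a,\xi_a,\tau_a)$ with $L_a=\{q\in\mathbf{Q}\mid qa_f\in\widehat{\mathbf{Z}}\}$, $\xi_a(x)=xa_f$, $\tau_a(x)=xa_\infty$. Then the bijection $Y_\mathbf{Q}=\mathbf{Q}^\times\backslash\mathbb{A}\to\operatorname{Pic}_{Fr}(\overline{\operatorname{Spec}\mathbf{Z}})$, $[a]\mapsto[D_a]$, is an isomorphism of monoids: for $a,b\in\mathbb{A}$, $D_{ab}\cong D_a\otimes D_b$. -}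

module Defs where

open import Algebra.Bundles
open import Algebra.Structures
import Algebra.Construct.DirectProduct as DirectProduct
import Algebra.Definitions.RawMonoid as RawMonoidDefs
import Algebra.Properties.AbelianGroup as AbelianGroupProperties
import Algebra.Properties.Ring as RingProperties
open import Algebra.Morphism.Bundles using (GroupHomomorphism)
open import Algebra.Morphism.Structures
open import Data.Integer.Base as ℤ using (ℤ; +_; -[1+_]; 0ℤ; 1ℤ)
open import Data.Integer.Divisibility.Signed as ℤ∣ using (divides)
import Data.Integer.Properties as ℤ
open import Data.Integer.Solver using () renaming (module +-*-Solver to ℤ-Solver)
open import Data.Nat.Base as ℕ using (ℕ)
import Data.Nat.Divisibility as ℕ∣
import Data.Nat.Properties as ℕ
open import Data.Product.Base using (Σ; ∃-syntax; _×_; _,_; proj₁; proj₂)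
open import Data.Rational.Base as ℚ using (ℚ; 0ℚ; 1ℚ; ↥_; ↧_)
import Data.Rational.Properties as ℚ
open import Data.Rational.Solver using () renaming (module +-*-Solver to ℚ-Solver)
open import Data.Rational.Unnormalised.Base as ℚᵘ using (mkℚᵘ; *≡*)
import Data.Rational.Unnormalised.Properties as ℚᵘ
open import Level using (0ℓ; suc; _⊔_)
open import Relation.Binary.Core using (Rel)
open import Relation.Binary.Structures using (IsEquivalence)
open import Relation.Binary.PropositionalEquality as ≡ using (_≡_; _≢_; refl)

infix 4 _≡_mod_

-- Relations below are records rather than synonyms so that their sides can be
-- inferred from a proof.
record _≡_mod_ (i j : ℤ) (n : ℕ) : Set where
  constructor mkmod
  field divides-difference : + n ℤ∣.∣ i ℤ.- j

open _≡_mod_ public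

module _ {n : ℕ} where

  open ℤ-Solver

  mod-combination : ∀ a b {i j k l u v} → a ℤ.* (i ℤ.- j) ℤ.+ b ℤ.* (k ℤ.- l) ≡ u ℤ.- v →
                    i ≡ j mod n → k ≡ l mod n → u ≡ v mod n
  mod-combination a b eq (mkmod p) (mkmod q) = mkmod (≡.subst (+ n ℤ∣.∣_) eq
    (ℤ∣.∣m∣n⇒∣m+n (ℤ∣.∣n⇒∣m*n a p) (ℤ∣.∣n⇒∣m*n b q)))

  mod-reflexive : ∀ {i j} → i ≡ j → i ≡ j mod n
  mod-reflexive {i} refl = mkmod (divides 0ℤ (ℤ.+-inverseʳ i))

  mod-sym : ∀ {i j} → i ≡ j mod n → j ≡ i mod n
  mod-sym {i} {j} p = mod-combination (ℤ.- 1ℤ) 0ℤ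
    (solve 2 (λ i j → con (ℤ.- 1ℤ) :* (i :- j) :+ con 0ℤ :* (i :- j) := j :- i) refl i j) p p

  mod-trans : ∀ {i j k} → i ≡ j mod n → j ≡ k mod n → i ≡ k mod n
  mod-trans {i} {j} {k} = mod-combination 1ℤ 1ℤ
    (solve 3 (λ i j k → con 1ℤ :* (i :- j) :+ con 1ℤ :* (j :- k) := i :- k) refl i j k)

  mod-+ : ∀ {i j k l} → i ≡ j mod n → k ≡ l mod n → i ℤ.+ k ≡ j ℤ.+ l mod n
  mod-+ {i} {j} {k} {l} = mod-combination 1ℤ 1ℤ
    (solve 4 (λ i j k l → con 1ℤ :* (i :- j) :+ con 1ℤ :* (k :- l) := (i :+ k) :- (j :+ l))
      refl i j k l)

  mod-* : ∀ {i j k l} → i ≡ j mod n → k ≡ l mod n → i ℤ.* k ≡ j ℤ.* l mod n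
  mod-* {i} {j} {k} {l} = mod-combination k j
    (solve 4 (λ i j k l → k :* (i :- j) :+ j :* (k :- l) := i :* k :- j :* l) refl i j k l)

  mod-neg : ∀ {i j} → i ≡ j mod n → ℤ.- i ≡ ℤ.- j mod n
  mod-neg {i} {j} p = mod-combination (ℤ.- 1ℤ) 0ℤ
    (solve 2 (λ i j → con (ℤ.- 1ℤ) :* (i :- j) :+ con 0ℤ :* (i :- j) := (:- i) :- (:- j))
      refl i j) p p

-- Ẑ = lim ℤ/nℤ over n ≥ 1 ordered by divisibility.  A class in ℤ/nℤ is given
-- by an integer representative, and equality is congruence in every ℤ/nℤ.
record Ẑ : Set where
  no-eta-equality
  constructor mkẐ
  field
    res      : ∀ n .{{_ : ℕ.NonZero n}} → ℤ
    coherent : ∀ {m n} .{{_ : ℕ.NonZero m}} .{{_ : ℕ.NonZero n}} →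
               m ℕ∣.∣ n → res n ≡ res m mod m

open Ẑ public

infix 4 _≈ᶻ_

record _≈ᶻ_ (x y : Ẑ) : Set where
  constructor mk≈
  field cong-mod : ∀ n .{{_ : ℕ.NonZero n}} → res x n ≡ res y n mod n

open _≈ᶻ_ public

pointwise : ∀ {x y} → (∀ n .{{_ : ℕ.NonZero n}} → res x n ≡ res y n) → x ≈ᶻ y
pointwise eq = mk≈ λ n → mod-reflexive (eq n)

infixl 6 _+ᶻ_
infixl 7 _*ᶻ_

_+ᶻ_ _*ᶻ_ : Ẑ → Ẑ → Ẑ
x +ᶻ y = mkẐ (λ n → res x n ℤ.+ res y n) (λ d → mod-+ (coherent x d) (coherent y d))
x *ᶻ y = mkẐ (λ n → res x n ℤ.* res y n) (λ d → mod-* (coherent x d) (coherent y d))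

-ᶻ_ : Ẑ → Ẑ
-ᶻ x = mkẐ (λ n → ℤ.- res x n) (λ d → mod-neg (coherent x d))

ι : ℤ → Ẑ
ι k = mkẐ (λ _ → k) (λ _ → mod-reflexive refl)

Ẑ-commutativeRing : CommutativeRing 0ℓ 0ℓ
Ẑ-commutativeRing = record
  { Carrier = Ẑ
  ; _≈_     = _≈ᶻ_
  ; _+_     = _+ᶻ_
  ; _*_     = _*ᶻ_
  ; -_      = -ᶻ_
  ; 0#      = ι 0ℤ
  ; 1#      = ι 1ℤ
  ; isCommutativeRing = record
    { isRing = record
      { +-isAbelianGroup = record
        { isGroup = record
          { isMonoid = record
            { isSemigroup = record
              { isMagma = record
                { isEquivalence = record
                  { refl  = pointwise λ _ → refl
                  ; sym   = λ p → mk≈ λ n → mod-sym (cong-mod p n)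
                  ; trans = λ p q → mk≈ λ n → mod-trans (cong-mod p n) (cong-mod q n)
                  }
                ; ∙-cong = λ p q → mk≈ λ n → mod-+ (cong-mod p n) (cong-mod q n)
                }
              ; assoc = λ x y z → pointwise λ n → ℤ.+-assoc (res x n) (res y n) (res z n)
              }
            ; identity = (λ x → pointwise λ n → ℤ.+-identityˡ (res x n))
                       , (λ x → pointwise λ n → ℤ.+-identityʳ (res x n))
            }
          ; inverse = (λ x → pointwise λ n → ℤ.+-inverseˡ (res x n))
                    , (λ x → pointwise λ n → ℤ.+-inverseʳ (res x n))
          ; ⁻¹-cong = λ p → mk≈ λ n → mod-neg (cong-mod p n)
          }
        ; comm = λ x y → pointwise λ n → ℤ.+-comm (res x n) (res y n)
        }
      ; *-cong     = λ p q → mk≈ λ n → mod-* (cong-mod p n) (cong-mod q n)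
      ; *-assoc    = λ x y z → pointwise λ n → ℤ.*-assoc (res x n) (res y n) (res z n)
      ; *-identity = (λ x → pointwise λ n → ℤ.*-identityˡ (res x n))
                   , (λ x → pointwise λ n → ℤ.*-identityʳ (res x n))
      ; distrib    = (λ x y z → pointwise λ n → ℤ.*-distribˡ-+ (res x n) (res y n) (res z n))
                   , (λ x y z → pointwise λ n → ℤ.*-distribʳ-+ (res x n) (res y n) (res z n))
      }
    ; *-comm = λ x y → pointwise λ n → ℤ.*-comm (res x n) (res y n)
    }
  }

module Ẑᴿ = CommutativeRing Ẑ-commutativeRing

ι-cancel : ∀ d .{{_ : ℤ.NonZero d}} {x y} → ι d *ᶻ x ≈ᶻ ι d *ᶻ y → x ≈ᶻ y
ι-cancel d {x} {y} p = mk≈ congruent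
  where
  cancel : ∀ n {i j} → d ℤ.* i ≡ d ℤ.* j mod (ℤ.∣ d ∣ ℕ.* n) → i ≡ j mod n
  cancel n {i} {j} (mkmod q) = mkmod (ℤ∣.*-cancelˡ-∣ d
    (≡.subst (d ℤ.* + n ℤ∣.∣_)
      (solve 3 (λ d i j → d :* i :- d :* j := d :* (i :- j)) refl d i j)
      (ℤ∣.∣-trans (ℤ∣.∣-trans (ℤ∣.*-monoˡ-∣ (+ n) (ℤ∣.m∣∣m∣ {d}))
                  (ℤ∣.∣-reflexive (≡.sym (ℤ.pos-* ℤ.∣ d ∣ n)))) q)))
    where open ℤ-Solver

  congruent : ∀ n .{{_ : ℕ.NonZero n}} → res x n ≡ res y n mod n
  congruent n = mod-trans (mod-sym (coherent x n∣dn))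
               (mod-trans (cancel n (cong-mod p (ℤ.∣ d ∣ ℕ.* n))) (coherent y n∣dn))
    where
    instance
      dn≢0 : ℕ.NonZero (ℤ.∣ d ∣ ℕ.* n)
      dn≢0 = ℕ.m*n≢0 ℤ.∣ d ∣ n
    n∣dn : n ℕ∣.∣ ℤ.∣ d ∣ ℕ.* n
    n∣dn = ℕ∣.n∣m*n ℤ.∣ d ∣

-- 𝔸_f = Ẑ ⊗ ℚ, the localisation of Ẑ at the nonzero integers.
-- Fractions are compared by cross-multiplication, which suffices because Ẑ is
-- torsion-free (ι-cancel).
infix 8 _÷_

record 𝔸ᶠ : Set where
  no-eta-equality
  pattern
  constructor _÷_
  field
    num       : Ẑ
    den       : ℤ
    {{den≢0}} : ℤ.NonZero den

infix 4 _≈ᶠ_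

record _≈ᶠ_ (a b : 𝔸ᶠ) : Set where
  constructor mk≈
  open 𝔸ᶠ
  field cross : ι (den b) *ᶻ num a ≈ᶻ ι (den a) *ᶻ num b

module _ where

  open ℤ-Solver

  infixl 6 _+ᶠ_
  infixl 7 _*ᶠ_

  _+ᶠ_ _*ᶠ_ : 𝔸ᶠ → 𝔸ᶠ → 𝔸ᶠ
  (x ÷ d) +ᶠ (y ÷ e) = ((ι e *ᶻ x +ᶻ ι d *ᶻ y) ÷ (d ℤ.* e)) {{ℤ.i*j≢0 d e}}
  (x ÷ d) *ᶠ (y ÷ e) = ((x *ᶻ y) ÷ (d ℤ.* e)) {{ℤ.i*j≢0 d e}}

  -ᶠ_ : 𝔸ᶠ → 𝔸ᶠ
  -ᶠ (x ÷ d) = (-ᶻ x) ÷ d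

  0ᶠ 1ᶠ : 𝔸ᶠ
  0ᶠ = ι 0ℤ ÷ 1ℤ
  1ᶠ = ι 1ℤ ÷ 1ℤ

  -- The inclusion Ẑ ⊆ 𝔸_f and the diagonal embedding ℚ → 𝔸_f.
  integral : Ẑ → 𝔸ᶠ
  integral x = x ÷ 1ℤ

  fromℚᶠ : ℚ → 𝔸ᶠ
  fromℚᶠ q = ι (↥ q) ÷ (↧ q)

  ≈ᶠ-isEquivalence : IsEquivalence _≈ᶠ_
  ≈ᶠ-isEquivalence = record
    { refl  = mk≈ Ẑᴿ.refl
    ; sym   = λ { (mk≈ p) → mk≈ (Ẑᴿ.sym p) }
    ; trans = λ { {x ÷ d} {y ÷ e} {z ÷ f} (mk≈ p) (mk≈ q) → mk≈ (ι-cancel e (mk≈ λ n →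
        mod-combination f d
          (solve 6 (λ x d y e z f → f :* (e :* x :- d :* y) :+ d :* (f :* y :- e :* z) :=
                                    e :* (f :* x) :- e :* (d :* z))
            refl (res x n) d (res y n) e (res z n) f)
          (cong-mod p n) (cong-mod q n))) }
    }

  𝔸ᶠ-commutativeRing : CommutativeRing 0ℓ 0ℓ
  𝔸ᶠ-commutativeRing = record
    { Carrier = 𝔸ᶠ
    ; _≈_     = _≈ᶠ_
    ; _+_     = _+ᶠ_
    ; _*_     = _*ᶠ_
    ; -_      = -ᶠ_
    ; 0#      = 0ᶠ
    ; 1#      = 1ᶠ
    ; isCommutativeRing = record
      { isRing = record
        { +-isAbelianGroup = record
          { isGroup = record
            { isMonoid = record
              { isSemigroup = record
                { isMagma = record { isEquivalence = ≈ᶠ-isEquivalence ; ∙-cong = +ᶠ-cong }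
                ; assoc = λ { (x ÷ d) (y ÷ e) (z ÷ f) → mk≈ (pointwise λ n →
                    solve 6 (λ x d y e z f →
                      (d :* (e :* f)) :* (f :* (e :* x :+ d :* y) :+ (d :* e) :* z) :=
                      ((d :* e) :* f) :* ((e :* f) :* x :+ d :* (f :* y :+ e :* z)))
                      refl (res x n) d (res y n) e (res z n) f) }
                }
              ; identity =
                  (λ { (x ÷ d) → mk≈ (pointwise λ n →
                    solve 2 (λ x d → d :* (d :* con 0ℤ :+ con 1ℤ :* x) := (con 1ℤ :* d) :* x)
                      refl (res x n) d) })
                , (λ { (x ÷ d) → mk≈ (pointwise λ n →
                    solve 2 (λ x d → d :* (con 1ℤ :* x :+ d :* con 0ℤ) := (d :* con 1ℤ) :* x)
                      refl (res x n) d) })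
              }
            ; inverse =
                (λ { (x ÷ d) → mk≈ (pointwise λ n →
                  solve 2 (λ x d → con 1ℤ :* (d :* (:- x) :+ d :* x) := (d :* d) :* con 0ℤ)
                    refl (res x n) d) })
              , (λ { (x ÷ d) → mk≈ (pointwise λ n →
                  solve 2 (λ x d → con 1ℤ :* (d :* x :+ d :* (:- x)) := (d :* d) :* con 0ℤ)
                    refl (res x n) d) })
            ; ⁻¹-cong = -ᶠ-cong
            }
          ; comm = λ { (x ÷ d) (y ÷ e) → mk≈ (pointwise λ n →
              solve 4 (λ x d y e → (e :* d) :* (e :* x :+ d :* y) :=
                                   (d :* e) :* (d :* y :+ e :* x))
                refl (res x n) d (res y n) e) }
          }
        ; *-cong  = *ᶠ-cong
        ; *-assoc = λ { (x ÷ d) (y ÷ e) (z ÷ f) → mk≈ (pointwise λ n →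
            solve 6 (λ x d y e z f → (d :* (e :* f)) :* ((x :* y) :* z) :=
                                     ((d :* e) :* f) :* (x :* (y :* z)))
              refl (res x n) d (res y n) e (res z n) f) }
        ; *-identity =
            (λ { (x ÷ d) → mk≈ (pointwise λ n →
              solve 2 (λ x d → d :* (con 1ℤ :* x) := (con 1ℤ :* d) :* x) refl (res x n) d) })
          , (λ { (x ÷ d) → mk≈ (pointwise λ n →
              solve 2 (λ x d → d :* (x :* con 1ℤ) := (d :* con 1ℤ) :* x) refl (res x n) d) })
        ; distrib =
            (λ { (x ÷ d) (y ÷ e) (z ÷ f) → mk≈ (pointwise λ n →
              solve 6 (λ x d y e z f →
                ((d :* e) :* (d :* f)) :* (x :* (f :* y :+ e :* z)) :=
                (d :* (e :* f)) :* ((d :* f) :* (x :* y) :+ (d :* e) :* (x :* z)))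
                refl (res x n) d (res y n) e (res z n) f) })
          , (λ { (x ÷ d) (y ÷ e) (z ÷ f) → mk≈ (pointwise λ n →
              solve 6 (λ x d y e z f →
                ((e :* d) :* (f :* d)) :* ((f :* y :+ e :* z) :* x) :=
                ((e :* f) :* d) :* ((f :* d) :* (y :* x) :+ (e :* d) :* (z :* x)))
                refl (res x n) d (res y n) e (res z n) f) })
        }
      ; *-comm = λ { (x ÷ d) (y ÷ e) → mk≈ (pointwise λ n →
          solve 4 (λ x d y e → (e :* d) :* (x :* y) := (d :* e) :* (y :* x))
            refl (res x n) d (res y n) e) }
      }
    }
    where
    +ᶠ-cong : ∀ {a a′ b b′} → a ≈ᶠ a′ → b ≈ᶠ b′ → a +ᶠ b ≈ᶠ a′ +ᶠ b′
    +ᶠ-cong {x ÷ d} {x′ ÷ d′} {y ÷ e} {y′ ÷ e′} (mk≈ p) (mk≈ q) = mk≈ (mk≈ λ n →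
      mod-combination (e ℤ.* e′) (d ℤ.* d′)
        (solve 8 (λ x d x′ d′ y e y′ e′ →
            (e :* e′) :* (d′ :* x :- d :* x′) :+ (d :* d′) :* (e′ :* y :- e :* y′) :=
            (d′ :* e′) :* (e :* x :+ d :* y) :- (d :* e) :* (e′ :* x′ :+ d′ :* y′))
          refl (res x n) d (res x′ n) d′ (res y n) e (res y′ n) e′)
        (cong-mod p n) (cong-mod q n))

    *ᶠ-cong : ∀ {a a′ b b′} → a ≈ᶠ a′ → b ≈ᶠ b′ → a *ᶠ b ≈ᶠ a′ *ᶠ b′
    *ᶠ-cong {x ÷ d} {x′ ÷ d′} {y ÷ e} {y′ ÷ e′} (mk≈ p) (mk≈ q) = mk≈ (mk≈ λ n →
      mod-combination (e′ ℤ.* res y n) (d ℤ.* res x′ n)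
        (solve 8 (λ x d x′ d′ y e y′ e′ →
            (e′ :* y) :* (d′ :* x :- d :* x′) :+ (d :* x′) :* (e′ :* y :- e :* y′) :=
            (d′ :* e′) :* (x :* y) :- (d :* e) :* (x′ :* y′))
          refl (res x n) d (res x′ n) d′ (res y n) e (res y′ n) e′)
        (cong-mod p n) (cong-mod q n))

    -ᶠ-cong : ∀ {a a′} → a ≈ᶠ a′ → -ᶠ a ≈ᶠ -ᶠ a′
    -ᶠ-cong {x ÷ d} {x′ ÷ d′} (mk≈ p) = mk≈ (mk≈ λ n →
      mod-combination (ℤ.- 1ℤ) 0ℤ
        (solve 4 (λ x d x′ d′ →
            con (ℤ.- 1ℤ) :* (d′ :* x :- d :* x′) :+ con 0ℤ :* (d′ :* x :- d :* x′) :=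
            d′ :* (:- x) :- d :* (:- x′))
          refl (res x n) d (res x′ n) d′)
        (cong-mod p n) (cong-mod p n))

module 𝔸ᶠᴿ = CommutativeRing 𝔸ᶠ-commutativeRing

-- s m n → 0 as m and n tend to infinity.
record Null (s : ℕ → ℕ → ℚ) : Set where
  constructor mknull
  field small : ∀ ε → 0ℚ ℚ.< ε → ∃[ N ] (∀ m n → N ℕ.≤ m → N ℕ.≤ n → ℚ.∣ s m n ∣ ℚ.< ε)

open Null public

record ℝ : Set where
  no-eta-equality
  constructor mkℝ
  field
    seq    : ℕ → ℚ
    cauchy : Null (λ m n → seq m ℚ.- seq n)

open ℝ public

infix 4 _≈ʳ_

-- For Cauchy sequences this is equivalent to seq x n - seq y n → 0.
record _≈ʳ_ (x y : ℝ) : Set where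
  constructor mk≈
  field close : Null (λ m n → seq x m ℚ.- seq y n)

module _ where

  open ℚ-Solver

  Bounded : (ℕ → ℕ → ℚ) → Set
  Bounded s = ∃[ B ] ℚ.Positive B × ∃[ N ] (∀ m n → N ℕ.≤ m → N ℕ.≤ n → ℚ.∣ s m n ∣ ℚ.≤ B)

  bounded-const : ∀ c → Bounded (λ _ _ → c)
  bounded-const c =
    ℚ.∣ c ∣ ℚ.+ 1ℚ , ℚ.nonNeg+pos⇒pos ℚ.∣ c ∣ {{ℚ.∣-∣-nonNeg c}} 1ℚ
    , 0 , λ _ _ _ _ → ℚ.≤-trans (ℚ.≤-reflexive (≡.sym (ℚ.+-identityʳ ℚ.∣ c ∣)))
                                (ℚ.+-monoʳ-≤ ℚ.∣ c ∣ (ℚ.nonNegative⁻¹ 1ℚ))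

  bounded-seq : ∀ x → ∃[ B ] ℚ.Positive B × ∃[ N ] (∀ n → N ℕ.≤ n → ℚ.∣ seq x n ∣ ℚ.≤ B)
  bounded-seq x = 1ℚ ℚ.+ ℚ.∣ seq x N ∣
                , ℚ.pos+nonNeg⇒pos 1ℚ ℚ.∣ seq x N ∣ {{ℚ.∣-∣-nonNeg (seq x N)}}
                , N , bound
    where
    open ℚ.≤-Reasoning
    close-1 = small (cauchy x) 1ℚ (ℚ.positive⁻¹ 1ℚ)
    N = proj₁ close-1
    bound : ∀ n → N ℕ.≤ n → ℚ.∣ seq x n ∣ ℚ.≤ 1ℚ ℚ.+ ℚ.∣ seq x N ∣
    bound n N≤n = begin
      ℚ.∣ seq x n ∣
        ≡⟨ ≡.cong ℚ.∣_∣ (solve 2 (λ a b → a := (a :- b) :+ b) refl (seq x n) (seq x N)) ⟩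
      ℚ.∣ (seq x n ℚ.- seq x N) ℚ.+ seq x N ∣
        ≤⟨ ℚ.∣p+q∣≤∣p∣+∣q∣ (seq x n ℚ.- seq x N) (seq x N) ⟩
      ℚ.∣ seq x n ℚ.- seq x N ∣ ℚ.+ ℚ.∣ seq x N ∣
        ≤⟨ ℚ.+-monoˡ-≤ ℚ.∣ seq x N ∣ (ℚ.<⇒≤ (proj₂ close-1 n N N≤n ℕ.≤-refl)) ⟩
      1ℚ ℚ.+ ℚ.∣ seq x N ∣ ∎

  bounded₁ : ∀ x → Bounded (λ m _ → seq x m)
  bounded₁ x = let (B , B>0 , N , p) = bounded-seq x in B , B>0 , N , λ m _ N≤m _ → p m N≤m

  bounded₂ : ∀ x → Bounded (λ _ n → seq x n)
  bounded₂ x = let (B , B>0 , N , p) = bounded-seq x in B , B>0 , N , λ _ n _ N≤n → p n N≤n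

  null-combination : ∀ {a b s t u} → Bounded a → Bounded b →
    (∀ m n → a m n ℚ.* s m n ℚ.+ b m n ℚ.* t m n ≡ u m n) →
    Null s → Null t → Null u
  null-combination {a} {b} {s} {t} {u}
    (A , A>0 , K , a≤A) (B , B>0 , L , b≤B) eq null-s null-t = mknull eventually
    where
    eventually : ∀ ε → 0ℚ ℚ.< ε →
                 ∃[ N ] (∀ m n → N ℕ.≤ m → N ℕ.≤ n → ℚ.∣ u m n ∣ ℚ.< ε)
    eventually ε 0<ε = N , λ m n N≤m N≤n → let open ℚ.≤-Reasoning in begin-strict
        ℚ.∣ u m n ∣
          ≡⟨ ≡.cong ℚ.∣_∣ (eq m n) ⟨
        ℚ.∣ a m n ℚ.* s m n ℚ.+ b m n ℚ.* t m n ∣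
          ≤⟨ ℚ.∣p+q∣≤∣p∣+∣q∣ (a m n ℚ.* s m n) (b m n ℚ.* t m n) ⟩
        ℚ.∣ a m n ℚ.* s m n ∣ ℚ.+ ℚ.∣ b m n ℚ.* t m n ∣
          <⟨ ℚ.+-mono-<
               (product {A} {a m n} {s m n} A>0
                 (a≤A m n (ℕ.≤-trans (ℕ.m≤m⊔n K L) (ℕ.≤-trans KL≤N N≤m))
                          (ℕ.≤-trans (ℕ.m≤m⊔n K L) (ℕ.≤-trans KL≤N N≤n)))
                 (proj₂ S m n (ℕ.≤-trans (ℕ.m≤m⊔n (proj₁ S) (proj₁ T)) (ℕ.≤-trans ST≤N N≤m))
                              (ℕ.≤-trans (ℕ.m≤m⊔n (proj₁ S) (proj₁ T)) (ℕ.≤-trans ST≤N N≤n))))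
               (product {B} {b m n} {t m n} B>0
                 (b≤B m n (ℕ.≤-trans (ℕ.m≤n⊔m K L) (ℕ.≤-trans KL≤N N≤m))
                          (ℕ.≤-trans (ℕ.m≤n⊔m K L) (ℕ.≤-trans KL≤N N≤n)))
                 (proj₂ T m n (ℕ.≤-trans (ℕ.m≤n⊔m (proj₁ S) (proj₁ T)) (ℕ.≤-trans ST≤N N≤m))
                              (ℕ.≤-trans (ℕ.m≤n⊔m (proj₁ S) (proj₁ T)) (ℕ.≤-trans ST≤N N≤n)))) ⟩
        A ℚ.* δ ℚ.+ B ℚ.* δ
          ≡⟨ solve 4 (λ A B ε c → A :* (ε :* c) :+ B :* (ε :* c) := ε :* (c :* (A :+ B)))
               refl A B ε (ℚ.1/ (A ℚ.+ B)) ⟩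
        ε ℚ.* (ℚ.1/ (A ℚ.+ B) ℚ.* (A ℚ.+ B))
          ≡⟨ ≡.cong (ε ℚ.*_) (ℚ.*-inverseˡ (A ℚ.+ B)) ⟩
        ε ℚ.* 1ℚ
          ≡⟨ ℚ.*-identityʳ ε ⟩
        ε ∎
      where
      instance
        _ = A>0
        _ = B>0
        A+B>0 : ℚ.Positive (A ℚ.+ B)
        A+B>0 = ℚ.pos+pos⇒pos A B
        A+B≢0 : ℚ.NonZero (A ℚ.+ B)
        A+B≢0 = ℚ.pos⇒nonZero (A ℚ.+ B)
      δ = ε ℚ.* ℚ.1/ (A ℚ.+ B)
      0<δ : 0ℚ ℚ.< δ
      0<δ = ℚ.positive⁻¹ δ {{ℚ.pos*pos⇒pos ε {{ℚ.positive 0<ε}} (ℚ.1/ (A ℚ.+ B))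
                                {{ℚ.1/pos⇒pos (A ℚ.+ B)}}}}
      S = small null-s δ 0<δ
      T = small null-t δ 0<δ
      N = (K ℕ.⊔ L) ℕ.⊔ (proj₁ S ℕ.⊔ proj₁ T)
      KL≤N = ℕ.m≤m⊔n (K ℕ.⊔ L) (proj₁ S ℕ.⊔ proj₁ T)
      ST≤N = ℕ.m≤n⊔m (K ℕ.⊔ L) (proj₁ S ℕ.⊔ proj₁ T)
      product : ∀ {C c r} → ℚ.Positive C → ℚ.∣ c ∣ ℚ.≤ C → ℚ.∣ r ∣ ℚ.< δ →
                ℚ.∣ c ℚ.* r ∣ ℚ.< C ℚ.* δ
      product {C} {c} {r} C>0 c≤C r<δ = begin-strict
        ℚ.∣ c ℚ.* r ∣          ≡⟨ ℚ.∣p*q∣≡∣p∣*∣q∣ c r ⟩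
        ℚ.∣ c ∣ ℚ.* ℚ.∣ r ∣    ≤⟨ ℚ.*-monoʳ-≤-nonNeg ℚ.∣ r ∣ {{ℚ.∣-∣-nonNeg r}} c≤C ⟩
        C ℚ.* ℚ.∣ r ∣          <⟨ ℚ.*-monoʳ-<-pos C {{C>0}} r<δ ⟩
        C ℚ.* δ                ∎
        where open ℚ.≤-Reasoning

  ≈ʳ-sym : ∀ {x y} → x ≈ʳ y → y ≈ʳ x
  ≈ʳ-sym {x} {y} (mk≈ p) = mk≈ (null-combination (bounded-const (ℚ.- 1ℚ)) (bounded-const 0ℚ)
    (λ m n → solve 2 (λ a b → con (ℚ.- 1ℚ) :* (a :- b) :+ con 0ℚ :* (a :- b) := b :- a)
               refl (seq x n) (seq y m))
    swapped swapped)
    where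
    swapped : Null (λ m n → seq x n ℚ.- seq y m)
    swapped = mknull λ ε 0<ε → let (N , h) = small p ε 0<ε in
      N , λ m n N≤m N≤n → h n m N≤n N≤m

  ≈ʳ-trans : ∀ {x y z} → x ≈ʳ y → y ≈ʳ z → x ≈ʳ z
  ≈ʳ-trans {x} {y} {z} (mk≈ p) (mk≈ q) = mk≈ (null-combination (bounded-const 1ℚ) (bounded-const 1ℚ)
    (λ m n → solve 3 (λ a b c → con 1ℚ :* (a :- b) :+ con 1ℚ :* (b :- c) := a :- c)
               refl (seq x m) (seq y m) (seq z n))
    diag q)
    where
    diag : Null (λ m _ → seq x m ℚ.- seq y m)
    diag = mknull λ ε 0<ε → let (N , h) = small p ε 0<ε in
      N , λ m _ N≤m _ → h m m N≤m N≤m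

  null-+ : ∀ (x y u v : ℝ) → x ≈ʳ y → u ≈ʳ v →
           Null (λ m n → (seq x m ℚ.+ seq u m) ℚ.- (seq y n ℚ.+ seq v n))
  null-+ x y u v (mk≈ p) (mk≈ q) = null-combination (bounded-const 1ℚ) (bounded-const 1ℚ)
    (λ m n → solve 4 (λ a b c d → con 1ℚ :* (a :- b) :+ con 1ℚ :* (c :- d) :=
                                  (a :+ c) :- (b :+ d))
               refl (seq x m) (seq y n) (seq u m) (seq v n))
    p q

  null-* : ∀ (x y u v : ℝ) → x ≈ʳ y → u ≈ʳ v →
           Null (λ m n → (seq x m ℚ.* seq u m) ℚ.- (seq y n ℚ.* seq v n))
  null-* x y u v (mk≈ p) (mk≈ q) = null-combination (bounded₁ u) (bounded₂ y)
    (λ m n → solve 4 (λ a b c d → c :* (a :- b) :+ b :* (c :- d) := a :* c :- b :* d)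
               refl (seq x m) (seq y n) (seq u m) (seq v n))
    p q

  null-neg : ∀ (x y : ℝ) → x ≈ʳ y → Null (λ m n → (ℚ.- seq x m) ℚ.- (ℚ.- seq y n))
  null-neg x y (mk≈ p) = null-combination (bounded-const (ℚ.- 1ℚ)) (bounded-const 0ℚ)
    (λ m n → solve 2 (λ a b → con (ℚ.- 1ℚ) :* (a :- b) :+ con 0ℚ :* (a :- b) :=
                              (:- a) :- (:- b))
               refl (seq x m) (seq y n))
    p p

≈ʳ-refl : ∀ {x} → x ≈ʳ x
≈ʳ-refl {x} = mk≈ (cauchy x)

termwise : ∀ {x y} → (∀ n → seq x n ≡ seq y n) → x ≈ʳ y
termwise {x} {y} eq = mk≈ (mknull λ ε 0<ε → let (N , h) = small (cauchy x) ε 0<ε in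
  N , λ m n N≤m N≤n → ≡.subst (λ q → ℚ.∣ seq x m ℚ.- q ∣ ℚ.< ε) (eq n) (h m n N≤m N≤n))

infixl 6 _+ʳ_
infixl 7 _*ʳ_

_+ʳ_ _*ʳ_ : ℝ → ℝ → ℝ
x +ʳ y = mkℝ (λ n → seq x n ℚ.+ seq y n) (null-+ x x y y ≈ʳ-refl ≈ʳ-refl)
x *ʳ y = mkℝ (λ n → seq x n ℚ.* seq y n) (null-* x x y y ≈ʳ-refl ≈ʳ-refl)

-ʳ_ : ℝ → ℝ
-ʳ x = mkℝ (λ n → ℚ.- seq x n) (null-neg x x ≈ʳ-refl)

fromℚʳ : ℚ → ℝ
fromℚʳ q = mkℝ (λ _ → q) (mknull λ ε 0<ε → 0 , λ _ _ _ _ →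
  ≡.subst (λ r → ℚ.∣ r ∣ ℚ.< ε) (≡.sym (ℚ.+-inverseʳ q)) 0<ε)

ℝ-commutativeRing : CommutativeRing 0ℓ 0ℓ
ℝ-commutativeRing = record
  { Carrier = ℝ
  ; _≈_     = _≈ʳ_
  ; _+_     = _+ʳ_
  ; _*_     = _*ʳ_
  ; -_      = -ʳ_
  ; 0#      = fromℚʳ 0ℚ
  ; 1#      = fromℚʳ 1ℚ
  ; isCommutativeRing = record
    { isRing = record
      { +-isAbelianGroup = record
        { isGroup = record
          { isMonoid = record
            { isSemigroup = record
              { isMagma = record
                { isEquivalence = record { refl = ≈ʳ-refl ; sym = ≈ʳ-sym ; trans = ≈ʳ-trans }
                ; ∙-cong = λ {x} {y} {u} {v} p q → mk≈ (null-+ x y u v p q)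
                }
              ; assoc = λ x y z → termwise λ n → ℚ.+-assoc (seq x n) (seq y n) (seq z n)
              }
            ; identity = (λ x → termwise λ n → ℚ.+-identityˡ (seq x n))
                       , (λ x → termwise λ n → ℚ.+-identityʳ (seq x n))
            }
          ; inverse = (λ x → termwise λ n → ℚ.+-inverseˡ (seq x n))
                    , (λ x → termwise λ n → ℚ.+-inverseʳ (seq x n))
          ; ⁻¹-cong = λ {x} {y} p → mk≈ (null-neg x y p)
          }
        ; comm = λ x y → termwise λ n → ℚ.+-comm (seq x n) (seq y n)
        }
      ; *-cong     = λ {x} {y} {u} {v} p q → mk≈ (null-* x y u v p q)
      ; *-assoc    = λ x y z → termwise λ n → ℚ.*-assoc (seq x n) (seq y n) (seq z n)
      ; *-identity = (λ x → termwise λ n → ℚ.*-identityˡ (seq x n))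
                   , (λ x → termwise λ n → ℚ.*-identityʳ (seq x n))
      ; distrib    = (λ x y z → termwise λ n → ℚ.*-distribˡ-+ (seq x n) (seq y n) (seq z n))
                   , (λ x y z → termwise λ n → ℚ.*-distribʳ-+ (seq x n) (seq y n) (seq z n))
      }
    ; *-comm = λ x y → termwise λ n → ℚ.*-comm (seq x n) (seq y n)
    }
  }

module ℝᴿ = CommutativeRing ℝ-commutativeRing

𝔸-commutativeRing : CommutativeRing 0ℓ 0ℓ
𝔸-commutativeRing = DirectProduct.commutativeRing 𝔸ᶠ-commutativeRing ℝ-commutativeRing

module 𝔸ᴿ = CommutativeRing 𝔸-commutativeRing

𝔸 : Set
𝔸 = 𝔸ᴿ.Carrier

SatisfiesCommutativeMonoidLaws : ∀ {c ℓ} → RawMonoid c ℓ → Set (c ⊔ ℓ)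
SatisfiesCommutativeMonoidLaws M = IsCommutativeMonoid _≈_ _∙_ ε
  where open RawMonoid M

diagonal : ℚ → 𝔸
diagonal q = fromℚᶠ q , fromℚʳ q

-- ℚ^× ∖ 𝔸, with the multiplication induced from 𝔸.
Yℚ : RawMonoid 0ℓ 0ℓ
Yℚ = record
  { Carrier = 𝔸
  ; _≈_     = λ a b → ∃[ q ] q ≢ 0ℚ × diagonal q 𝔸ᴿ.* a 𝔸ᴿ.≈ b
  ; _∙_     = 𝔸ᴿ._*_
  ; ε       = 𝔸ᴿ.1#
  }

Ab : Set₁
Ab = AbelianGroup 0ℓ 0ℓ

∣_∣ : Ab → Set
∣ A ∣ = AbelianGroup.Carrier A

Hom : Ab → Ab → Set
Hom A B = GroupHomomorphism (AbelianGroup.rawGroup A) (AbelianGroup.rawGroup B)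

open GroupHomomorphism public using (⟦_⟧)

additive : ∀ (A B : Ab) (f : ∣ A ∣ → ∣ B ∣) →
           (∀ {x y} → AbelianGroup._≈_ A x y → AbelianGroup._≈_ B (f x) (f y)) →
           (∀ x y → AbelianGroup._≈_ B (f (AbelianGroup._∙_ A x y))
                                       (AbelianGroup._∙_ B (f x) (f y))) →
           Hom A B
additive A B f f-cong f-homo = record
  { ⟦_⟧ = f
  ; isGroupHomomorphism = record
    { isMonoidHomomorphism = record
      { isMagmaHomomorphism = record
        { isRelHomomorphism = record { cong = f-cong }
        ; homo              = f-homo
        }
      ; ε-homo = f-ε
      }
    ; ⁻¹-homo = λ x → inverseˡ-unique (f (x A.⁻¹)) (f x)
        (B.trans (B.sym (f-homo (x A.⁻¹) x)) (B.trans (f-cong (A.inverseˡ x)) f-ε))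
    }
  }
  where
  module A = AbelianGroup A
  module B = AbelianGroup B
  open AbelianGroupProperties B
  f-ε : f A.ε B.≈ B.ε
  f-ε = identityˡ-unique (f A.ε) (f A.ε)
    (B.trans (B.sym (f-homo A.ε A.ε)) (f-cong (A.identityˡ A.ε)))

module _ (A : Ab) where

  open AbelianGroup A
  open RawMonoidDefs rawMonoid using () renaming (_×_ to _×ℕ_)

  infixr 8 _·_

  _·_ : ℤ → Carrier → Carrier
  (+ n)    · x = n ×ℕ x
  -[1+ n ] · x = (ℕ.suc n ×ℕ x) ⁻¹

  TorsionFree : Set
  TorsionFree = ∀ n x → n ≢ 0ℤ → n · x ≈ ε → x ≈ ε

  -- Some {x} is a maximal ℤ-linearly independent subset.
  RankOne : Set
  RankOne = ∃[ x ] (∀ n → n · x ≈ ε → n ≡ 0ℤ) ×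
                   (∀ y → ∃[ n ] ∃[ m ] n ≢ 0ℤ × n · y ≈ m · x)

module _ (A B : Ab) where

  private
    module A = AbelianGroup A
    module B = AbelianGroup B

  infix  8 _⊗_
  infixl 6 _⊕_
  infix  4 _∼_

  -- A ⊗_ℤ B by generators and relations: formal ℤ-combinations of pure tensors
  -- modulo the abelian group laws and bilinearity.
  data Tensor : Set where
    _⊗_ : A.Carrier → B.Carrier → Tensor
    _⊕_ : Tensor → Tensor → Tensor
    𝟘   : Tensor
    ⊖_  : Tensor → Tensor

  data _∼_ : Rel Tensor 0ℓ where
    ∼-refl      : ∀ {s} → s ∼ s
    ∼-sym       : ∀ {s t} → s ∼ t → t ∼ s
    ∼-trans     : ∀ {s t u} → s ∼ t → t ∼ u → s ∼ u
    ⊗-cong      : ∀ {x x′ y y′} → x A.≈ x′ → y B.≈ y′ → x ⊗ y ∼ x′ ⊗ y′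
    ⊕-cong      : ∀ {s s′ t t′} → s ∼ s′ → t ∼ t′ → s ⊕ t ∼ s′ ⊕ t′
    ⊖-cong      : ∀ {s s′} → s ∼ s′ → ⊖ s ∼ ⊖ s′
    ⊕-assoc     : ∀ s t u → (s ⊕ t) ⊕ u ∼ s ⊕ (t ⊕ u)
    ⊕-comm      : ∀ s t → s ⊕ t ∼ t ⊕ s
    ⊕-identityˡ : ∀ s → 𝟘 ⊕ s ∼ s
    ⊖-inverseˡ  : ∀ s → ⊖ s ⊕ s ∼ 𝟘
    ⊗-distribˡ  : ∀ x y y′ → x ⊗ (y B.∙ y′) ∼ x ⊗ y ⊕ x ⊗ y′
    ⊗-distribʳ  : ∀ x x′ y → (x A.∙ x′) ⊗ y ∼ x ⊗ y ⊕ x′ ⊗ y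

  tensorProduct : Ab
  tensorProduct = record
    { Carrier = Tensor
    ; _≈_     = _∼_
    ; _∙_     = _⊕_
    ; ε       = 𝟘
    ; _⁻¹     = ⊖_
    ; isAbelianGroup = record
      { isGroup = record
        { isMonoid = record
          { isSemigroup = record
            { isMagma = record
              { isEquivalence = record { refl = ∼-refl ; sym = ∼-sym ; trans = ∼-trans }
              ; ∙-cong        = ⊕-cong
              }
            ; assoc = ⊕-assoc
            }
          ; identity = ⊕-identityˡ
                     , (λ s → ∼-trans (⊕-comm s 𝟘) (⊕-identityˡ s))
          }
        ; inverse  = ⊖-inverseˡ
                   , (λ s → ∼-trans (⊕-comm s (⊖ s)) (⊖-inverseˡ s))
        ; ⁻¹-cong  = ⊖-cong
        }
      ; comm = ⊕-comm
      }
    }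

-- The homomorphism A ⊗ B → R with x ⊗ y ↦ f x * g y.
module _ {A B : Ab} (R : CommutativeRing 0ℓ 0ℓ)
         (f : Hom A (CommutativeRing.+-abelianGroup R))
         (g : Hom B (CommutativeRing.+-abelianGroup R)) where

  private
    module R = CommutativeRing R
    module f = GroupHomomorphism f
    module g = GroupHomomorphism g

    evaluate : Tensor A B → R.Carrier
    evaluate (x ⊗ y) = f.⟦ x ⟧ R.* g.⟦ y ⟧
    evaluate (s ⊕ t) = evaluate s R.+ evaluate t
    evaluate 𝟘       = R.0#
    evaluate (⊖ s)   = R.- evaluate s

    evaluate-cong : ∀ {s t} → _∼_ A B s t → evaluate s R.≈ evaluate t
    evaluate-cong ∼-refl              = R.refl
    evaluate-cong (∼-sym p)           = R.sym (evaluate-cong p)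
    evaluate-cong (∼-trans p q)       = R.trans (evaluate-cong p) (evaluate-cong q)
    evaluate-cong (⊗-cong p q)        = R.*-cong (f.⟦⟧-cong p) (g.⟦⟧-cong q)
    evaluate-cong (⊕-cong p q)        = R.+-cong (evaluate-cong p) (evaluate-cong q)
    evaluate-cong (⊖-cong p)          = R.-‿cong (evaluate-cong p)
    evaluate-cong (⊕-assoc s t u)     = R.+-assoc (evaluate s) (evaluate t) (evaluate u)
    evaluate-cong (⊕-comm s t)        = R.+-comm (evaluate s) (evaluate t)
    evaluate-cong (⊕-identityˡ s)     = R.+-identityˡ (evaluate s)
    evaluate-cong (⊖-inverseˡ s)      = R.-‿inverseˡ (evaluate s)
    evaluate-cong (⊗-distribˡ x y y′) =
      R.trans (R.*-congˡ (g.homo y y′)) (R.distribˡ f.⟦ x ⟧ g.⟦ y ⟧ g.⟦ y′ ⟧)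
    evaluate-cong (⊗-distribʳ x x′ y) =
      R.trans (R.*-congʳ (f.homo x x′)) (R.distribʳ g.⟦ y ⟧ f.⟦ x ⟧ f.⟦ x′ ⟧)

  pairing : Hom (tensorProduct A B) R.+-abelianGroup
  pairing = additive (tensorProduct A B) R.+-abelianGroup evaluate evaluate-cong
                     (λ _ _ → R.refl)

Ẑ⁺ ℝ⁺ : Ab
Ẑ⁺ = Ẑᴿ.+-abelianGroup
ℝ⁺ = ℝᴿ.+-abelianGroup

-- The data (L, ξ, τ); the conditions on L and ξ are IsFramed.
record Triple : Set₁ where
  no-eta-equality
  field
    L : Ab
    ξ : Hom L Ẑ⁺
    τ : Hom L ℝ⁺

-- Every h : L → Ẑ is c ξ for some c ∈ Ẑ.
Generates : (L : Ab) → Hom L Ẑ⁺ → Set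
Generates L ξ = ∀ (h : Hom L Ẑ⁺) → ∃[ c ] (∀ x → ⟦ h ⟧ x ≈ᶻ c *ᶻ ⟦ ξ ⟧ x)

record IsFramed (X : Triple) : Set where
  open Triple X
  field
    torsionFree : TorsionFree L
    rankOne     : RankOne L
    generates   : Generates L ξ

FramedDivisor : Set₁
FramedDivisor = Σ Triple IsFramed

infix 4 _≅_

record _≅_ (X Y : Triple) : Set where
  private
    module X = Triple X
    module Y = Triple Y
  field
    φ             : ∣ X.L ∣ → ∣ Y.L ∣
    isIsomorphism : GroupMorphisms.IsGroupIsomorphism
                      (AbelianGroup.rawGroup X.L) (AbelianGroup.rawGroup Y.L) φ
    ξ-compatible  : ∀ x → ⟦ Y.ξ ⟧ (φ x) ≈ᶻ ⟦ X.ξ ⟧ x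
    τ-compatible  : ∀ x → ⟦ Y.τ ⟧ (φ x) ≈ʳ ⟦ X.τ ⟧ x

infixr 7 _⊗ᵀ_

_⊗ᵀ_ : Triple → Triple → Triple
X ⊗ᵀ Y = record
  { L = tensorProduct X.L Y.L
  ; ξ = pairing Ẑ-commutativeRing X.ξ Y.ξ
  ; τ = pairing ℝ-commutativeRing X.τ Y.τ
  }
  where
  module X = Triple X
  module Y = Triple Y

-- (ℤ, ℤ ⊆ Ẑ, ℤ ⊆ ℝ), the unit for the tensor product.
𝟙 : Triple
𝟙 = record
  { L = ℤ.+-0-abelianGroup
  ; ξ = additive ℤ.+-0-abelianGroup Ẑ⁺ ι
          (λ { refl → Ẑᴿ.refl }) (λ i j → pointwise λ _ → refl)
  ; τ = additive ℤ.+-0-abelianGroup ℝ⁺ (λ i → fromℚʳ (i ℚ./ 1))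
          (λ { refl → ≈ʳ-refl }) (λ i j → termwise λ _ → /1-homo-+ i j)
  }
  where
  /1-homo-+ : ∀ i j → (i ℤ.+ j) ℚ./ 1 ≡ (i ℚ./ 1) ℚ.+ (j ℚ./ 1)
  /1-homo-+ i j = ℚ.toℚᵘ-injective (begin
    ℚ.toℚᵘ ((i ℤ.+ j) ℚ./ 1)               ≈⟨ ℚ.toℚᵘ-fromℚᵘ (mkℚᵘ (i ℤ.+ j) 0) ⟩
    mkℚᵘ (i ℤ.+ j) 0                       ≈⟨ *≡* (solve 2 (λ i j →
                                                (i :+ j) :* con 1ℤ :=
                                                (i :* con 1ℤ :+ j :* con 1ℤ) :* con 1ℤ)
                                                refl i j) ⟩
    mkℚᵘ i 0 ℚᵘ.+ mkℚᵘ j 0                 ≈⟨ ℚᵘ.+-cong (ℚ.toℚᵘ-fromℚᵘ (mkℚᵘ i 0))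
                                                       (ℚ.toℚᵘ-fromℚᵘ (mkℚᵘ j 0)) ⟨
    ℚ.toℚᵘ (i ℚ./ 1) ℚᵘ.+ ℚ.toℚᵘ (j ℚ./ 1) ≈⟨ ℚ.toℚᵘ-homo-+ (i ℚ./ 1) (j ℚ./ 1) ⟨
    ℚ.toℚᵘ ((i ℚ./ 1) ℚ.+ (j ℚ./ 1))       ∎)
    where
    open ℚᵘ.≃-Reasoning
    open ℤ-Solver

-- Pic_Fr: framed divisors up to isomorphism.  The arguments say that the tensor
-- product and the unit are framed.
Pic : (∀ X Y → IsFramed X → IsFramed Y → IsFramed (X ⊗ᵀ Y)) → IsFramed 𝟙 →
      RawMonoid (suc 0ℓ) 0ℓ
Pic ⊗-framed 𝟙-framed = record
  { Carrier = FramedDivisor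
  ; _≈_     = λ X Y → proj₁ X ≅ proj₁ Y
  ; _∙_     = λ X Y → proj₁ X ⊗ᵀ proj₁ Y
                    , ⊗-framed (proj₁ X) (proj₁ Y) (proj₂ X) (proj₂ Y)
  ; ε       = 𝟙 , 𝟙-framed
  }

fromℚᶠ-+ : ∀ p q → fromℚᶠ (p ℚ.+ q) ≈ᶠ fromℚᶠ p +ᶠ fromℚᶠ q
fromℚᶠ-+ p q = mk≈ (pointwise λ _ → cross-multiply (p ℚ.+ q) p q (ℚ.toℚᵘ-homo-+ p q))
  where
  open ℤ-Solver
  cross-multiply : ∀ r p q → ℚ.toℚᵘ r ℚᵘ.≃ ℚ.toℚᵘ p ℚᵘ.+ ℚ.toℚᵘ q →
                   (↧ p ℤ.* ↧ q) ℤ.* ↥ r ≡ ↧ r ℤ.* (↧ q ℤ.* ↥ p ℤ.+ ↧ p ℤ.* ↥ q)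
  cross-multiply r@record{} p@record{} q@record{} (*≡* eq) =
    ≡.trans (ℤ.*-comm (↧ p ℤ.* ↧ q) (↥ r)) (≡.trans eq
      (solve 5 (λ a b c d e → (a :* d :+ c :* b) :* e := e :* (d :* a :+ b :* c))
        refl (↥ p) (↧ p) (↥ q) (↧ q) (↧ r)))

fromℚᶠ-neg : ∀ p → fromℚᶠ (ℚ.- p) ≈ᶠ -ᶠ fromℚᶠ p
fromℚᶠ-neg p = mk≈ (pointwise λ _ → eq)
  where
  eq : ↧ p ℤ.* ↥ (ℚ.- p) ≡ ↧ (ℚ.- p) ℤ.* (ℤ.- ↥ p)
  eq = ≡.cong₂ ℤ._*_ (≡.sym (ℚ.↧-neg p)) (ℚ.↥-neg p)

integral-+ : ∀ x y → integral x +ᶠ integral y ≈ᶠ integral (x +ᶻ y)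
integral-+ x y = mk≈ (pointwise λ n →
  solve 2 (λ x y → con 1ℤ :* (con 1ℤ :* x :+ con 1ℤ :* y) := con 1ℤ :* (x :+ y))
    refl (res x n) (res y n))
  where open ℤ-Solver

integral-injective : ∀ {x y} → integral x ≈ᶠ integral y → x ≈ᶻ y
integral-injective (mk≈ p) = ι-cancel 1ℤ p

-- L_a = {q ∈ ℚ ∣ q a_f ∈ Ẑ}.  The element of Ẑ equal to q a_f is unique
-- (integral-injective), and equality is that of the underlying rationals.
record Multiplier (a : 𝔸ᶠ) : Set where
  no-eta-equality
  constructor multiplier
  field
    rational  : ℚ
    value     : Ẑ
    is-value  : fromℚᶠ rational *ᶠ a ≈ᶠ integral value

open Multiplier public

module _ (a : 𝔸ᶠ) where

  private
    module R = 𝔸ᶠᴿ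
    open RingProperties 𝔸ᶠᴿ.ring using (-‿distribˡ-*)

    scale : ∀ {p q} → p ≡ q → fromℚᶠ p *ᶠ a ≈ᶠ fromℚᶠ q *ᶠ a
    scale refl = R.refl

    sum : ∀ p q → fromℚᶠ (p ℚ.+ q) *ᶠ a ≈ᶠ fromℚᶠ p *ᶠ a +ᶠ fromℚᶠ q *ᶠ a
    sum p q = R.trans (R.*-congʳ {a} (fromℚᶠ-+ p q)) (R.distribʳ a (fromℚᶠ p) (fromℚᶠ q))

    +-value : ∀ p q {x y} → fromℚᶠ p *ᶠ a ≈ᶠ integral x → fromℚᶠ q *ᶠ a ≈ᶠ integral y →
              fromℚᶠ (p ℚ.+ q) *ᶠ a ≈ᶠ integral (x +ᶻ y)
    +-value p q {x} {y} u v =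
      R.trans (sum p q) (R.trans (R.+-cong u v) (integral-+ x y))

    neg-value : ∀ p {x} → fromℚᶠ p *ᶠ a ≈ᶠ integral x →
                fromℚᶠ (ℚ.- p) *ᶠ a ≈ᶠ integral (-ᶻ x)
    neg-value p u = R.trans (R.*-congʳ {a} (fromℚᶠ-neg p))
                   (R.trans (R.sym (-‿distribˡ-* (fromℚᶠ p) a)) (R.-‿cong u))

    zero-value : fromℚᶠ 0ℚ *ᶠ a ≈ᶠ integral (ι 0ℤ)
    zero-value = R.zeroˡ a

  multipliers : Ab
  multipliers = record
    { Carrier = Multiplier a
    ; _≈_     = λ x y → rational x ≡ rational y
    ; _∙_     = λ x y → multiplier (rational x ℚ.+ rational y) (value x +ᶻ value y)
                          (+-value (rational x) (rational y) (is-value x) (is-value y))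
    ; ε       = multiplier 0ℚ (ι 0ℤ) zero-value
    ; _⁻¹     = λ x → multiplier (ℚ.- rational x) (-ᶻ value x)
                        (neg-value (rational x) (is-value x))
    ; isAbelianGroup = record
      { isGroup = record
        { isMonoid = record
          { isSemigroup = record
            { isMagma = record
              { isEquivalence = record { refl = refl ; sym = ≡.sym ; trans = ≡.trans }
              ; ∙-cong        = ≡.cong₂ ℚ._+_
              }
            ; assoc = λ x y z → ℚ.+-assoc (rational x) (rational y) (rational z)
            }
          ; identity = (λ x → ℚ.+-identityˡ (rational x)) , (λ x → ℚ.+-identityʳ (rational x))
          }
        ; inverse = (λ x → ℚ.+-inverseˡ (rational x)) , (λ x → ℚ.+-inverseʳ (rational x))
        ; ⁻¹-cong = ≡.cong (λ q → ℚ.- q)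
        }
      ; comm = λ x y → ℚ.+-comm (rational x) (rational y)
      }
    }

  valueHom : Hom multipliers Ẑ⁺
  valueHom = additive multipliers Ẑ⁺ value
    (λ {x} {y} eq → integral-injective
      (R.trans (R.sym (is-value x)) (R.trans (scale eq) (is-value y))))
    (λ _ _ → Ẑᴿ.refl)

D : 𝔸 → Triple
D (a , r) = record
  { L = multipliers a
  ; ξ = valueHom a
  ; τ = additive (multipliers a) ℝ⁺ (λ x → fromℚʳ (rational x) *ʳ r)
      (λ eq → termwise λ n → ≡.cong (ℚ._* seq r n) eq)
      (λ x y → termwise λ n → ℚ.*-distribʳ-+ (seq r n) (rational x) (rational y))
  }

{-# OPTIONS --safe #-}

-- The isomorphism class of D_a ⊗ D_b is read off inside ℚ: multiplication
-- L_a ⊗ L_b → L_ab is injective, since rank one groups are locally cyclic and so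
-- every tensor is pure, and surjective, since a rational q = m / n with
-- q (x / d) (y / e) ∈ Ẑ splits according to gcd (m x, n d e).
--
-- The remaining statements reduce to D by showing that every framed divisor
-- (L, ξ, τ) is D_a for a = (ξ(e), τ(e)), where e ≠ 0 in L.  The point is that
-- L ⊆ ℚ is all of L_a: an integer dividing ξ(e) divides e, because a profinite
-- integer x with exactly the divisors of e extends to a homomorphism L → Ẑ with
-- e ↦ x, which must be a multiple of ξ.  Such x exist by compactness of Ẑ, which
-- also shows that ξ_a generates Hom(L_a, Ẑ).

module Submission where

open import Algebra.Bundles using (AbelianGroup; CommutativeRing; RawMonoid)
open import Algebra.Morphism.Bundles using (module GroupHomomorphism)
open import Algebra.Morphism.Structures using (module GroupMorphisms; module MonoidMorphisms)
import Algebra.Properties.AbelianGroup as AbelianGroupProperties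
import Algebra.Properties.Monoid.Mult as Mult
open import Algebra.Structures using (IsCommutativeMonoid)
open import Axiom.ExcludedMiddle using (ExcludedMiddle)
open import Data.Empty using (⊥; ⊥-elim)
open import Data.Integer.Base as ℤ using (ℤ; +_; -[1+_]; 0ℤ; 1ℤ)
import Data.Integer.DivMod as ℤ
open import Data.Integer.Divisibility.Signed as ℤ∣ using (divides)
import Data.Integer.GCD as ℤ
import Data.Integer.Properties as ℤ
open import Data.Integer.Solver using () renaming (module +-*-Solver to ℤ-Solver)
open import Data.Nat.Base as ℕ using (ℕ; zero; suc; _!)
import Data.Nat.Coprimality as Coprime
import Data.Nat.Divisibility as ℕ∣
import Data.Nat.GCD as ℕ
import Data.Nat.LCM as ℕ
import Data.Nat.Properties as ℕ
open import Data.Product.Base using (∃-syntax; Σ-syntax; _×_; _,_; proj₁; proj₂)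
open import Data.Rational.Base as ℚ using (ℚ; mkℚ; 0ℚ; 1ℚ; ↥_; ↧_)
import Data.Rational.Properties as ℚ
open import Data.Rational.Solver using () renaming (module +-*-Solver to ℚ-Solver)
open import Data.Rational.Unnormalised.Base as ℚᵘ using (*≡*)
import Data.Rational.Unnormalised.Properties as ℚᵘ
open import Data.Sum.Base using (_⊎_; inj₁; inj₂; [_,_]′)
open import Level using (0ℓ)
import Relation.Binary.Reasoning.Setoid as SetoidReasoning
open import Relation.Binary.PropositionalEquality as ≡ using (_≡_; _≢_; refl)
open import Relation.Nullary.Decidable using (Dec; yes; no; decidable-stable)
open import Relation.Nullary.Negation using (¬_; contradiction)
open import Defs

-- Three obstacles shape the argument. Ẑ has zero divisors, so neither x nor y can be cancelled from
-- m x y = N z when a multiplier of ab is split. The splitting is done on residues modulo |N|, where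
-- Bézout's identity applies, and it lifts because an integer dividing the modulus divides a
-- profinite integer as soon as it divides its residue. The map ξ need not be injective: for L = ℚ
-- every homomorphism to Ẑ is zero, and so is the generator. Hence L is identified with a group of
-- rationals through coordinates y = (m / n) e relative to an independent e, and ξ serves only to
-- decide which denominators occur. Divisibility in an abstract L and the existence of solutions at
-- infinitely many levels are not decidable. Excluded middle enters in these two places: finding the
-- divisors of e below a bound, and choosing a residue that still has solutions at every level.

-- Greatest common divisors in ℤ

bézout : ∀ i j → ∃[ g ] g ℤ∣.∣ i × g ℤ∣.∣ j × ∃[ s ] ∃[ t ] s ℤ.* i ℤ.+ t ℤ.* j ≡ g
bézout i j =
  ℤ.gcd i j , ℤ∣.∣ᵤ⇒∣ (ℤ.gcd[i,j]∣i i j) , ℤ∣.∣ᵤ⇒∣ (ℤ.gcd[i,j]∣j i j)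
  , combination (ℕ.Bézout.identity (ℕ.gcd-GCD ℤ.∣ i ∣ ℤ.∣ j ∣))
  where
  open ℤ-Solver
  lift : ∀ {d x y m n} → d ℕ.+ y ℕ.* n ≡ x ℕ.* m → + d ℤ.+ + y ℤ.* + n ≡ + x ℤ.* + m
  lift {d} {x} {y} {m} {n} eq =
    ≡.trans (≡.cong (λ z → + d ℤ.+ z) (≡.sym (ℤ.pos-* y n)))
            (≡.trans (≡.cong (+_) eq) (ℤ.pos-* x m))
  solve-for : ∀ {d a b} → d ℤ.+ b ≡ a → d ≡ a ℤ.- b
  solve-for {d} {a} {b} refl = solve 2 (λ d b → d := (d :+ b) :- b) refl d b
  combination : ∀ {d} → ℕ.Bézout.Identity d ℤ.∣ i ∣ ℤ.∣ j ∣ →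
                ∃[ s ] ∃[ t ] s ℤ.* i ℤ.+ t ℤ.* j ≡ + d
  -- The identity for |i| and |j| comes with either sign; the factors `u` and `v` with |i| = u i and
  -- |j| = v j carry it back to i and j.
  combination {d} identity with ℤ∣.m∣∣m∣ {i} | ℤ∣.m∣∣m∣ {j} | identity
  ... | divides u ∣i∣≡ui | divides v ∣j∣≡vj | ℕ.Bézout.+- x y eq =
    + x ℤ.* u , ℤ.- (+ y ℤ.* v)
    , ≡.trans (solve 6 (λ x u i y v j → (x :* u) :* i :+ (:- (y :* v)) :* j :=
                                        x :* (u :* i) :- y :* (v :* j))
                 refl (+ x) u i (+ y) v j)
              (≡.sym (solve-for (≡.subst₂ (λ a b → + d ℤ.+ + y ℤ.* b ≡ + x ℤ.* a)
                                          ∣i∣≡ui ∣j∣≡vj (lift {d} {x} {y} eq))))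
  ... | divides u ∣i∣≡ui | divides v ∣j∣≡vj | ℕ.Bézout.-+ x y eq =
    ℤ.- (+ x ℤ.* u) , + y ℤ.* v
    , ≡.trans (solve 6 (λ x u i y v j → (:- (x :* u)) :* i :+ (y :* v) :* j :=
                                        y :* (v :* j) :- x :* (u :* i))
                 refl (+ x) u i (+ y) v j)
              (≡.sym (solve-for (≡.subst₂ (λ a b → + d ℤ.+ + x ℤ.* a ≡ + y ℤ.* b)
                                          ∣i∣≡ui ∣j∣≡vj (lift {d} {y} {x} eq))))

*-≢0 : ∀ {i j} → i ≢ 0ℤ → j ≢ 0ℤ → i ℤ.* j ≢ 0ℤ
*-≢0 {i} i≢0 j≢0 ij≡0 with ℤ.i*j≡0⇒i≡0∨j≡0 i ij≡0
... | inj₁ i≡0 = i≢0 i≡0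
... | inj₂ j≡0 = j≢0 j≡0

-- Integer multiples in abelian groups

ℤ⁺ : Ab
ℤ⁺ = ℤ.+-0-abelianGroup

module _ (A B : Ab) (h : Hom A B) where

  private
    module A = AbelianGroup A
    module B = AbelianGroup B
    module h = GroupHomomorphism h
    module MA = Mult A.monoid
    module MB = Mult B.monoid

    ×ℕ-homo : ∀ n x → ⟦ h ⟧ (n MA.× x) B.≈ n MB.× ⟦ h ⟧ x
    ×ℕ-homo zero    x = h.ε-homo
    ×ℕ-homo (suc n) x = B.trans (h.homo x (n MA.× x)) (B.∙-congˡ (×ℕ-homo n x))

  ·-homo : ∀ n x → ⟦ h ⟧ (_·_ A n x) B.≈ _·_ B n (⟦ h ⟧ x)
  ·-homo (+ n)    x = ×ℕ-homo n x
  ·-homo -[1+ n ] x =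
    B.trans (h.⁻¹-homo (suc n MA.× x)) (B.⁻¹-cong (×ℕ-homo (suc n) x))

module Multiples (A : Ab) where

  open AbelianGroup A renaming (refl to ≈-refl; sym to ≈-sym; trans to ≈-trans)
  open AbelianGroupProperties A
  open Mult monoid using (×-homo-+; ×-congʳ) renaming (_×_ to _×ℕ_)
  open SetoidReasoning setoid

  infixr 8 _∗_

  _∗_ : ℤ → Carrier → Carrier
  n ∗ x = _·_ A n x

  ∗-congˡ : ∀ n {x y} → x ≈ y → n ∗ x ≈ n ∗ y
  ∗-congˡ (+ n)    x≈y = ×-congʳ n x≈y
  ∗-congˡ -[1+ n ] x≈y = ⁻¹-cong (×-congʳ (suc n) x≈y)

  ∗-congʳ : ∀ {m n} x → m ≡ n → m ∗ x ≈ n ∗ x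
  ∗-congʳ x refl = ≈-refl

  1∗ : ∀ x → 1ℤ ∗ x ≈ x
  1∗ = identityʳ

  private
    -- This is the mixed-sign case of `∗-homo-+`: a sum of opposite signs computes to `⊖`, and each
    -- common successor contributes a cancelling x ∙ x ⁻¹.
    ⊖-∗ : ∀ m n x → (m ℤ.⊖ n) ∗ x ≈ m ×ℕ x ∙ (n ×ℕ x) ⁻¹
    ⊖-∗ m       zero    x = ≈-sym (≈-trans (∙-congˡ ε⁻¹≈ε) (identityʳ (m ×ℕ x)))
    ⊖-∗ zero    (suc n) x = ≈-sym (identityˡ ((suc n ×ℕ x) ⁻¹))
    ⊖-∗ (suc m) (suc n) x = begin
      (suc m ℤ.⊖ suc n) ∗ x            ≈⟨ ∗-congʳ x (ℤ.[1+m]⊖[1+n]≡m⊖n m n) ⟩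
      (m ℤ.⊖ n) ∗ x                    ≈⟨ ⊖-∗ m n x ⟩
      a ∙ b ⁻¹                         ≈⟨ ∙-congˡ (identityˡ (b ⁻¹)) ⟨
      a ∙ (ε ∙ b ⁻¹)                   ≈⟨ ∙-congˡ (∙-congʳ (inverseʳ x)) ⟨
      a ∙ ((x ∙ x ⁻¹) ∙ b ⁻¹)          ≈⟨ ∙-congˡ (assoc x (x ⁻¹) (b ⁻¹)) ⟩
      a ∙ (x ∙ (x ⁻¹ ∙ b ⁻¹))          ≈⟨ assoc a x (x ⁻¹ ∙ b ⁻¹) ⟨
      (a ∙ x) ∙ (x ⁻¹ ∙ b ⁻¹)          ≈⟨ ∙-cong (comm a x) (⁻¹-∙-comm x b) ⟩
      (x ∙ a) ∙ (x ∙ b) ⁻¹             ∎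
      where
      a = m ×ℕ x
      b = n ×ℕ x

  ∗-homo-+ : ∀ x m n → (m ℤ.+ n) ∗ x ≈ m ∗ x ∙ n ∗ x
  ∗-homo-+ x (+ m)    (+ n)    = ×-homo-+ x m n
  ∗-homo-+ x (+ m)    -[1+ n ] = ⊖-∗ m (suc n) x
  ∗-homo-+ x -[1+ m ] (+ n)    =
    ≈-trans (⊖-∗ n (suc m) x) (comm (n ×ℕ x) ((suc m ×ℕ x) ⁻¹))
  ∗-homo-+ x -[1+ m ] -[1+ n ] = begin
    (suc (suc (m ℕ.+ n)) ×ℕ x) ⁻¹          ≈⟨ ⁻¹-cong (×-homo-+ x 2 (m ℕ.+ n)) ⟩
    (2 ×ℕ x ∙ (m ℕ.+ n) ×ℕ x) ⁻¹           ≈⟨ ⁻¹-cong (∙-congˡ (×-homo-+ x m n)) ⟩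
    (2 ×ℕ x ∙ (m ×ℕ x ∙ n ×ℕ x)) ⁻¹        ≈⟨ ⁻¹-cong rearrange ⟩
    (suc m ×ℕ x ∙ suc n ×ℕ x) ⁻¹           ≈⟨ ⁻¹-∙-comm (suc m ×ℕ x) (suc n ×ℕ x) ⟨
    (suc m ×ℕ x) ⁻¹ ∙ (suc n ×ℕ x) ⁻¹      ∎
    where
    a = m ×ℕ x
    b = n ×ℕ x
    rearrange : (x ∙ (x ∙ ε)) ∙ (a ∙ b) ≈ (x ∙ a) ∙ (x ∙ b)
    rearrange = begin
      (x ∙ (x ∙ ε)) ∙ (a ∙ b)   ≈⟨ ∙-congʳ (∙-congˡ (identityʳ x)) ⟩
      (x ∙ x) ∙ (a ∙ b)         ≈⟨ assoc x x (a ∙ b) ⟩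
      x ∙ (x ∙ (a ∙ b))         ≈⟨ ∙-congˡ (assoc x a b) ⟨
      x ∙ ((x ∙ a) ∙ b)         ≈⟨ ∙-congˡ (∙-congʳ (comm x a)) ⟩
      x ∙ ((a ∙ x) ∙ b)         ≈⟨ ∙-congˡ (assoc a x b) ⟩
      x ∙ (a ∙ (x ∙ b))         ≈⟨ assoc x a (x ∙ b) ⟨
      (x ∙ a) ∙ (x ∙ b)         ∎

  multiples-of : Carrier → Hom ℤ⁺ A
  multiples-of x = additive ℤ⁺ A (_∗ x) (∗-congʳ x) (∗-homo-+ x)

  -- A homomorphism out of ℤ is determined by its value at 1, which yields the
  -- remaining module laws.
  ℤ-hom : ∀ (f : Hom ℤ⁺ A) n → ⟦ f ⟧ n ≈ n ∗ ⟦ f ⟧ 1ℤ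
  ℤ-hom f n = ≈-trans (GroupHomomorphism.⟦⟧-cong f (≡.sym (n·1≡n n))) (·-homo ℤ⁺ A f n 1ℤ)
    where
    n×1≡n : ∀ n → Mult._×_ (AbelianGroup.monoid ℤ⁺) n 1ℤ ≡ + n
    n×1≡n zero    = refl
    n×1≡n (suc n) = ≡.cong ℤ.suc (n×1≡n n)
    n·1≡n : ∀ n → _·_ ℤ⁺ n 1ℤ ≡ n
    n·1≡n (+ n)    = n×1≡n n
    n·1≡n -[1+ n ] = ≡.cong ℤ.-_ (n×1≡n (suc n))

  ∗-assoc : ∀ m n x → (m ℤ.* n) ∗ x ≈ m ∗ n ∗ x
  ∗-assoc m n x = ≈-trans (ℤ-hom f m) (∗-congˡ m (∗-congʳ x (ℤ.*-identityˡ n)))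
    where
    f = additive ℤ⁺ A (λ m → (m ℤ.* n) ∗ x) (λ { refl → ≈-refl })
          (λ i j → ≈-trans (∗-congʳ x (ℤ.*-distribʳ-+ n i j)) (∗-homo-+ x (i ℤ.* n) (j ℤ.* n)))

  ∗-swap : ∀ m n x → m ∗ n ∗ x ≈ n ∗ m ∗ x
  ∗-swap m n x = ≈-trans (≈-sym (∗-assoc m n x))
                (≈-trans (∗-congʳ x (ℤ.*-comm m n)) (∗-assoc n m x))

  ∗-distrib : ∀ n x y → n ∗ (x ∙ y) ≈ n ∗ x ∙ n ∗ y
  ∗-distrib n x y = ≈-sym (≈-trans (ℤ-hom f n) (∗-congˡ n (∙-cong (1∗ x) (1∗ y))))
    where
    f = additive ℤ⁺ A (λ n → n ∗ x ∙ n ∗ y) (λ { refl → ≈-refl }) λ i j → begin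
      (i ℤ.+ j) ∗ x ∙ (i ℤ.+ j) ∗ y       ≈⟨ ∙-cong (∗-homo-+ x i j) (∗-homo-+ y i j) ⟩
      (i ∗ x ∙ j ∗ x) ∙ (i ∗ y ∙ j ∗ y)   ≈⟨ interchange (i ∗ x) (j ∗ x) (i ∗ y) (j ∗ y) ⟩
      (i ∗ x ∙ i ∗ y) ∙ (j ∗ x ∙ j ∗ y)   ∎
      where
      open import Algebra.Properties.CommutativeSemigroup commutativeSemigroup
        using (interchange)

  scaling : ℤ → Hom A A
  scaling n = additive A A (n ∗_) (∗-congˡ n) (∗-distrib n)

  ∗-ε : ∀ n → n ∗ ε ≈ ε
  ∗-ε n = GroupHomomorphism.ε-homo (scaling n)

  ∗-cancel : TorsionFree A → ∀ n {x y} → n ≢ 0ℤ → n ∗ x ≈ n ∗ y → x ≈ y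
  ∗-cancel torsionFree n {x} {y} n≢0 eq =
    x∙y⁻¹≈ε⇒x≈y x y (torsionFree n (x ∙ y ⁻¹) n≢0 (begin
      n ∗ (x ∙ y ⁻¹)       ≈⟨ ∗-distrib n x (y ⁻¹) ⟩
      n ∗ x ∙ n ∗ (y ⁻¹)   ≈⟨ ∙-congˡ (GroupHomomorphism.⁻¹-homo (scaling n) y) ⟩
      n ∗ x ∙ (n ∗ y) ⁻¹   ≈⟨ x≈y⇒x∙y⁻¹≈ε eq ⟩
      ε                    ∎))

  -- The rule for adding fractions, with `x` and `y` read as m / n and m′ / n′ times `e`.
  fraction-+ : ∀ {x y e} n m n′ m′ → n ∗ x ≈ m ∗ e → n′ ∗ y ≈ m′ ∗ e →
               (n ℤ.* n′) ∗ (x ∙ y) ≈ (n′ ℤ.* m ℤ.+ n ℤ.* m′) ∗ e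
  fraction-+ {x} {y} {e} n m n′ m′ p q = begin
    (n ℤ.* n′) ∗ (x ∙ y)                ≈⟨ ∗-distrib (n ℤ.* n′) x y ⟩
    (n ℤ.* n′) ∗ x ∙ (n ℤ.* n′) ∗ y     ≈⟨ ∙-cong
                                             (≈-trans (∗-congʳ x (ℤ.*-comm n n′)) (∗-assoc n′ n x))
                                             (∗-assoc n n′ y) ⟩
    n′ ∗ n ∗ x ∙ n ∗ n′ ∗ y             ≈⟨ ∙-cong (∗-congˡ n′ p) (∗-congˡ n q) ⟩
    n′ ∗ m ∗ e ∙ n ∗ m′ ∗ e             ≈⟨ ∙-cong (∗-assoc n′ m e) (∗-assoc n m′ e) ⟨
    (n′ ℤ.* m) ∗ e ∙ (n ℤ.* m′) ∗ e     ≈⟨ ∗-homo-+ e (n′ ℤ.* m) (n ℤ.* m′) ⟨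
    (n′ ℤ.* m ℤ.+ n ℤ.* m′) ∗ e         ∎

  Independent : Carrier → Set
  Independent e = ∀ n → n ∗ e ≈ ε → n ≡ 0ℤ

  independent-injective : ∀ {e} → Independent e → ∀ m n → m ∗ e ≈ n ∗ e → m ≡ n
  independent-injective {e} independent m n eq = ℤ.i-j≡0⇒i≡j m n (independent (m ℤ.- n) (begin
    (m ℤ.- n) ∗ e         ≈⟨ ∗-homo-+ e m (ℤ.- n) ⟩
    m ∗ e ∙ (ℤ.- n) ∗ e   ≈⟨ ∙-congˡ (GroupHomomorphism.⁻¹-homo (multiples-of e) n) ⟩
    m ∗ e ∙ (n ∗ e) ⁻¹    ≈⟨ x≈y⇒x∙y⁻¹≈ε eq ⟩
    ε                     ∎))

-- Local cyclicity of rank one groups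

LocallyCyclic : Ab → Set
LocallyCyclic A = ∀ x y → ∃[ u ] ∃[ p ] ∃[ q ] x ≈ _·_ A p u × y ≈ _·_ A q u
  where open AbelianGroup A

-- Clearing denominators gives N x = a e and N y = b e. If s a + t b = g is the gcd, with a = p g
-- and b = r g, then u = s x + t y satisfies N u = g e; hence N x = N p u and N y = N r u, and N
-- cancels.
rankOne⇒locallyCyclic : ∀ A → TorsionFree A → RankOne A → LocallyCyclic A
rankOne⇒locallyCyclic A torsionFree (e , _ , fraction) x y
  with fraction x | fraction y
... | n , m , n≢0 , nx≈me | n′ , m′ , n′≢0 , n′y≈m′e
  with bézout (n′ ℤ.* m) (n ℤ.* m′)
... | g , divides p a≡pg , divides r b≡rg , s , t , sa+tb≡g =
  u , p , r , cancel x p (n′ ℤ.* m) a≡pg Nx≈ae , cancel y r (n ℤ.* m′) b≡rg Ny≈be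
  where
  open AbelianGroup A renaming (refl to ≈-refl; sym to ≈-sym; trans to ≈-trans)
  open Multiples A
  open SetoidReasoning setoid
  N = n ℤ.* n′
  a = n′ ℤ.* m
  b = n ℤ.* m′
  u = s ∗ x ∙ t ∗ y
  Nx≈ae : N ∗ x ≈ a ∗ e
  Nx≈ae = begin
    N ∗ x          ≈⟨ ∗-congʳ x (ℤ.*-comm n n′) ⟩
    (n′ ℤ.* n) ∗ x ≈⟨ ∗-assoc n′ n x ⟩
    n′ ∗ n ∗ x     ≈⟨ ∗-congˡ n′ nx≈me ⟩
    n′ ∗ m ∗ e     ≈⟨ ∗-assoc n′ m e ⟨
    a ∗ e          ∎
  Ny≈be : N ∗ y ≈ b ∗ e
  Ny≈be = begin
    N ∗ y          ≈⟨ ∗-assoc n n′ y ⟩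
    n ∗ n′ ∗ y     ≈⟨ ∗-congˡ n n′y≈m′e ⟩
    n ∗ m′ ∗ e     ≈⟨ ∗-assoc n m′ e ⟨
    b ∗ e          ∎
  Nu≈ge : N ∗ u ≈ g ∗ e
  Nu≈ge = begin
    N ∗ (s ∗ x ∙ t ∗ y)             ≈⟨ ∗-distrib N (s ∗ x) (t ∗ y) ⟩
    N ∗ s ∗ x ∙ N ∗ t ∗ y           ≈⟨ ∙-cong (∗-swap N s x) (∗-swap N t y) ⟩
    s ∗ N ∗ x ∙ t ∗ N ∗ y           ≈⟨ ∙-cong (∗-congˡ s Nx≈ae) (∗-congˡ t Ny≈be) ⟩
    s ∗ a ∗ e ∙ t ∗ b ∗ e           ≈⟨ ∙-cong (∗-assoc s a e) (∗-assoc t b e) ⟨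
    (s ℤ.* a) ∗ e ∙ (t ℤ.* b) ∗ e   ≈⟨ ∗-homo-+ e (s ℤ.* a) (t ℤ.* b) ⟨
    (s ℤ.* a ℤ.+ t ℤ.* b) ∗ e       ≈⟨ ∗-congʳ e sa+tb≡g ⟩
    g ∗ e                           ∎
  cancel : ∀ z p c → c ≡ p ℤ.* g → N ∗ z ≈ c ∗ e → z ≈ p ∗ u
  cancel z p c c≡pg Nz≈ce = ∗-cancel torsionFree N (*-≢0 n≢0 n′≢0) (begin
    N ∗ z          ≈⟨ Nz≈ce ⟩
    c ∗ e          ≈⟨ ∗-congʳ e c≡pg ⟩
    (p ℤ.* g) ∗ e  ≈⟨ ∗-assoc p g e ⟩
    p ∗ g ∗ e      ≈⟨ ∗-congˡ p Nu≈ge ⟨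
    p ∗ N ∗ u      ≈⟨ ∗-swap p N u ⟩
    N ∗ p ∗ u      ∎)

-- Homomorphisms out of rank one groups

module _ (A T : Ab) (torsionFree : TorsionFree T) (rankOne : RankOne A) where

  private
    module A = AbelianGroup A
    module T = AbelianGroup T
    module MA = Multiples A
    module MT = Multiples T
    e = proj₁ rankOne
    independent = proj₁ (proj₂ rankOne)
    fraction = proj₂ (proj₂ rankOne)

  -- From n x = m e follows n f(x) = m f(e), and this determines f(x) because `T` is torsion-free.
  hom-unique : ∀ (f g : Hom A T) → ⟦ f ⟧ e T.≈ ⟦ g ⟧ e → ∀ x → ⟦ f ⟧ x T.≈ ⟦ g ⟧ x
  hom-unique f g fe≈ge x with fraction x
  ... | n , m , n≢0 , nx≈me = MT.∗-cancel torsionFree n n≢0 (begin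
    n MT.∗ ⟦ f ⟧ x     ≈⟨ ·-homo A T f n x ⟨
    ⟦ f ⟧ (n MA.∗ x)   ≈⟨ GroupHomomorphism.⟦⟧-cong f nx≈me ⟩
    ⟦ f ⟧ (m MA.∗ e)   ≈⟨ ·-homo A T f m e ⟩
    m MT.∗ ⟦ f ⟧ e     ≈⟨ MT.∗-congˡ m fe≈ge ⟩
    m MT.∗ ⟦ g ⟧ e     ≈⟨ ·-homo A T g m e ⟨
    ⟦ g ⟧ (m MA.∗ e)   ≈⟨ GroupHomomorphism.⟦⟧-cong g nx≈me ⟨
    ⟦ g ⟧ (n MA.∗ x)   ≈⟨ ·-homo A T g n x ⟩
    n MT.∗ ⟦ g ⟧ x     ∎)
    where open SetoidReasoning T.setoid

  -- v = (m/n) t where x = (m/n) e.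
  Proportional : T.Carrier → A.Carrier → T.Carrier → Set
  Proportional t x v =
    ∃[ n ] ∃[ m ] n ≢ 0ℤ × n MA.∗ x A.≈ m MA.∗ e × n MT.∗ v T.≈ m MT.∗ t

  -- Independence of `e` forces n′ m = n m′, so the two fractions agree and the values coincide
  -- after multiplication by n′ n.
  proportional-unique : ∀ {t x y v w} → x A.≈ y → Proportional t x v → Proportional t y w → v T.≈ w
  proportional-unique {t} {x} {y} {v} {w} x≈y
    (n , m , n≢0 , nx≈me , nv≈mt) (n′ , m′ , n′≢0 , n′y≈m′e , n′w≈m′t) =
    MT.∗-cancel torsionFree (n′ ℤ.* n) (*-≢0 n′≢0 n≢0) (begin
      (n′ ℤ.* n) MT.∗ v    ≈⟨ MT.∗-assoc n′ n v ⟩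
      n′ MT.∗ n MT.∗ v     ≈⟨ MT.∗-congˡ n′ nv≈mt ⟩
      n′ MT.∗ m MT.∗ t     ≈⟨ MT.∗-assoc n′ m t ⟨
      (n′ ℤ.* m) MT.∗ t    ≈⟨ MT.∗-congʳ t n′m≡nm′ ⟩
      (n ℤ.* m′) MT.∗ t    ≈⟨ MT.∗-assoc n m′ t ⟩
      n MT.∗ m′ MT.∗ t     ≈⟨ MT.∗-congˡ n n′w≈m′t ⟨
      n MT.∗ n′ MT.∗ w     ≈⟨ MT.∗-swap n n′ w ⟩
      n′ MT.∗ n MT.∗ w     ≈⟨ MT.∗-assoc n′ n w ⟨
      (n′ ℤ.* n) MT.∗ w    ∎)
    where
    open SetoidReasoning T.setoid
    module R = SetoidReasoning A.setoid
    n′m≡nm′ : n′ ℤ.* m ≡ n ℤ.* m′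
    n′m≡nm′ = MA.independent-injective independent (n′ ℤ.* m) (n ℤ.* m′) (R.begin
      (n′ ℤ.* m) MA.∗ e   R.≈⟨ MA.∗-assoc n′ m e ⟩
      n′ MA.∗ m MA.∗ e    R.≈⟨ MA.∗-congˡ n′ nx≈me ⟨
      n′ MA.∗ n MA.∗ x    R.≈⟨ MA.∗-swap n′ n x ⟩
      n MA.∗ n′ MA.∗ x    R.≈⟨ MA.∗-congˡ n (MA.∗-congˡ n′ x≈y) ⟩
      n MA.∗ n′ MA.∗ y    R.≈⟨ MA.∗-congˡ n n′y≈m′e ⟩
      n MA.∗ m′ MA.∗ e    R.≈⟨ MA.∗-assoc n m′ e ⟨
      (n ℤ.* m′) MA.∗ e   R.∎)

  -- Proportionality is single-valued and closed under addition, so a choice of values, in whatever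
  -- way it is made, is automatically a homomorphism.
  extend : ∀ t → (∀ x → ∃[ v ] Proportional t x v) → Hom A T
  extend t total = additive A T (λ x → proj₁ (total x))
    (λ {x} {y} x≈y → proportional-unique x≈y (proj₂ (total x)) (proj₂ (total y)))
    (λ x y → proportional-unique A.refl (proj₂ (total (x A.∙ y)))
                                        (sum (proj₂ (total x)) (proj₂ (total y))))
    where
    sum : ∀ {x y v w} → Proportional t x v → Proportional t y w →
          Proportional t (x A.∙ y) (v T.∙ w)
    sum (n , m , n≢0 , p , p′) (k , l , k≢0 , q , q′) =
      n ℤ.* k , k ℤ.* m ℤ.+ n ℤ.* l , *-≢0 n≢0 k≢0
      , MA.fraction-+ n m k l p q , MT.fraction-+ n m k l p′ q′

  extension : ∀ t → (∀ x → ∃[ v ] Proportional t x v) → Σ[ h ∈ Hom A T ] ⟦ h ⟧ e T.≈ t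
  extension t total = extend t total , proportional-unique A.refl (proj₂ (total e))
    (1ℤ , 1ℤ , (λ ()) , A.refl , T.refl)

-- Integers inside ℚ

-- Opaque, because comparing unfolded rationals is prohibitively slow.
opaque
  fromℤ : ℤ → ℚ
  fromℤ i = mkℚ i 0 (Coprime.sym (Coprime.1-coprimeTo ℤ.∣ i ∣))

  fromℤ-0 : fromℤ 0ℤ ≡ 0ℚ
  fromℤ-0 = refl

  fromℤ-1 : fromℤ 1ℤ ≡ 1ℚ
  fromℤ-1 = refl

  fromℤ-+ : ∀ i j → fromℤ (i ℤ.+ j) ≡ fromℤ i ℚ.+ fromℤ j
  fromℤ-+ i j = ℚ.toℚᵘ-injective (ℚᵘ.≃-trans
    (*≡* (solve 2 (λ i j → (i :+ j) :* con 1ℤ := (i :* con 1ℤ :+ j :* con 1ℤ) :* con 1ℤ)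
            refl i j))
    (ℚᵘ.≃-sym (ℚ.toℚᵘ-homo-+ (fromℤ i) (fromℤ j))))
    where open ℤ-Solver

  fromℤ-* : ∀ i j → fromℤ (i ℤ.* j) ≡ fromℤ i ℚ.* fromℤ j
  fromℤ-* i j = ℚ.toℚᵘ-injective (ℚᵘ.≃-trans
    (*≡* refl) (ℚᵘ.≃-sym (ℚ.toℚᵘ-homo-* (fromℤ i) (fromℤ j))))

  fromℤ-injective : ∀ {i j} → fromℤ i ≡ fromℤ j → i ≡ j
  fromℤ-injective = ≡.cong ↥_

  ratio⇒cross : ∀ n m q → fromℤ n ℚ.* q ≡ fromℤ m → n ℤ.* ↥ q ≡ m ℤ.* ↧ q
  ratio⇒cross n m q@record{} eq
    with ℚᵘ.≃-trans (ℚᵘ.≃-sym (ℚ.toℚᵘ-homo-* (fromℤ n) q)) (ℚᵘ.≃-reflexive (≡.cong ℚ.toℚᵘ eq))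
  ... | *≡* cross = ≡.trans (≡.sym (ℤ.*-identityʳ (n ℤ.* ↥ q)))
                   (≡.trans cross (≡.cong (m ℤ.*_) (≡.cong (+_) (ℕ.+-identityʳ (ℚ.↧ₙ q)))))

  ↧*q≡↥ : ∀ q → fromℤ (↧ q) ℚ.* q ≡ fromℤ (↥ q)
  ↧*q≡↥ q@record{} = ℚ.toℚᵘ-injective (ℚᵘ.≃-trans (ℚ.toℚᵘ-homo-* (fromℤ (↧ q)) q)
    (*≡* (solve 2 (λ n d → (d :* n) :* con 1ℤ := n :* (con 1ℤ :* d)) refl (↥ q) (↧ q))))
    where open ℤ-Solver

fromℤ-≢0 : ∀ {i} → i ≢ 0ℤ → fromℤ i ≢ 0ℚ
fromℤ-≢0 i≢0 eq = i≢0 (fromℤ-injective (≡.trans eq (≡.sym fromℤ-0)))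

ℚ-cancelˡ : ∀ p {q r} → p ≢ 0ℚ → p ℚ.* q ≡ p ℚ.* r → q ≡ r
ℚ-cancelˡ p {q} {r} p≢0 eq =
  ≡.trans (expand q) (≡.trans (≡.cong (ℚ.1/ p ℚ.*_) eq) (≡.sym (expand r)))
  where
  instance _ = ℚ.≢-nonZero p≢0
  expand : ∀ q → q ≡ ℚ.1/ p ℚ.* (p ℚ.* q)
  expand q = ≡.trans (≡.sym (ℚ.*-identityˡ q))
            (≡.trans (≡.cong (ℚ._* q) (≡.sym (ℚ.*-inverseˡ p))) (ℚ.*-assoc (ℚ.1/ p) p q))

p*q≡0⇒p≡0∨q≡0 : ∀ p q → p ℚ.* q ≡ 0ℚ → p ≡ 0ℚ ⊎ q ≡ 0ℚ
p*q≡0⇒p≡0∨q≡0 p q eq with p ℚ.≟ 0ℚ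
... | yes p≡0 = inj₁ p≡0
... | no  p≢0 = inj₂ (ℚ-cancelˡ p p≢0 (≡.trans eq (≡.sym (ℚ.*-zeroʳ p))))

ratio : ∀ m {n} → n ≢ 0ℤ → ∃[ q ] fromℤ n ℚ.* q ≡ fromℤ m
ratio m {n} n≢0 = ℚ.1/ fromℤ n ℚ.* fromℤ m ,
  ≡.trans (≡.sym (ℚ.*-assoc (fromℤ n) (ℚ.1/ fromℤ n) (fromℤ m)))
  (≡.trans (≡.cong (ℚ._* fromℤ m) (ℚ.*-inverseʳ (fromℤ n))) (ℚ.*-identityˡ (fromℤ m)))
  where instance _ = ℚ.≢-nonZero (fromℤ-≢0 n≢0)

ℚ⁺ : Ab
ℚ⁺ = ℚ.+-0-abelianGroup

1*≡ : ∀ q → fromℤ 1ℤ ℚ.* q ≡ q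
1*≡ q = ≡.trans (≡.cong (ℚ._* q) fromℤ-1) (ℚ.*-identityˡ q)

·≡* : ∀ n q → _·_ ℚ⁺ n q ≡ fromℤ n ℚ.* q
·≡* n q = ≡.sym (≡.trans (Multiples.ℤ-hom ℚ⁺ f n) (Multiples.∗-congˡ ℚ⁺ n (1*≡ q)))
  where
  f = additive ℤ⁺ ℚ⁺ (λ n → fromℤ n ℚ.* q) (λ { refl → refl })
    (λ i j → ≡.trans (≡.cong (ℚ._* q) (fromℤ-+ i j)) (ℚ.*-distribʳ-+ q (fromℤ i) (fromℤ j)))

-- ℚ inside the adeles

fromℚᶠ-* : ∀ p q → fromℚᶠ (p ℚ.* q) ≈ᶠ fromℚᶠ p *ᶠ fromℚᶠ q
fromℚᶠ-* p q = mk≈ (pointwise λ _ → cross-multiply (p ℚ.* q) p q (ℚ.toℚᵘ-homo-* p q))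
  where
  cross-multiply : ∀ r p q → ℚ.toℚᵘ r ℚᵘ.≃ ℚ.toℚᵘ p ℚᵘ.* ℚ.toℚᵘ q →
                   (↧ p ℤ.* ↧ q) ℤ.* ↥ r ≡ ↧ r ℤ.* (↥ p ℤ.* ↥ q)
  cross-multiply r@record{} p@record{} q@record{} (*≡* eq) =
    ≡.trans (ℤ.*-comm (↧ p ℤ.* ↧ q) (↥ r)) (≡.trans eq (ℤ.*-comm (↥ p ℤ.* ↥ q) (↧ r)))

fromℚᶠ-cong : ∀ {p q} → p ≡ q → fromℚᶠ p ≈ᶠ fromℚᶠ q
fromℚᶠ-cong refl = 𝔸ᶠᴿ.refl

integral-* : ∀ x y → integral x *ᶠ integral y ≈ᶠ integral (x *ᶻ y)
integral-* x y = mk≈ (pointwise λ _ → refl)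

-- Multiples and divisibility in Ẑ and ℝ

Ẑ-· : ∀ n z → _·_ Ẑ⁺ n z ≈ᶻ ι n *ᶻ z
Ẑ-· n z = Ẑᴿ.sym (Ẑᴿ.trans (Multiples.ℤ-hom Ẑ⁺ f n) (Multiples.∗-congˡ Ẑ⁺ n (Ẑᴿ.*-identityˡ z)))
  where
  f = additive ℤ⁺ Ẑ⁺ (λ n → ι n *ᶻ z) (λ { refl → Ẑᴿ.refl })
    (λ i j → pointwise λ k → ℤ.*-distribʳ-+ (res z k) i j)

Ẑ-torsionFree : TorsionFree Ẑ⁺
Ẑ-torsionFree n z n≢0 nz≈0 = ι-cancel n {{ℤ.≢-nonZero n≢0}}
  (Ẑᴿ.trans (Ẑᴿ.sym (Ẑ-· n z)) (Ẑᴿ.trans nz≈0 (Ẑᴿ.sym (Ẑᴿ.zeroʳ (ι n)))))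

ℝ-· : ∀ n z → _·_ ℝ⁺ n z ≈ʳ fromℚʳ (fromℤ n) *ʳ z
ℝ-· n z = ℝᴿ.sym (ℝᴿ.trans (Multiples.ℤ-hom ℝ⁺ f n)
  (Multiples.∗-congˡ ℝ⁺ n (termwise λ k → 1*≡ (seq z k))))
  where
  f = additive ℤ⁺ ℝ⁺ (λ n → fromℚʳ (fromℤ n) *ʳ z) (λ { refl → ℝᴿ.refl })
    (λ i j → termwise λ k → ≡.trans (≡.cong (ℚ._* seq z k) (fromℤ-+ i j))
                                    (ℚ.*-distribʳ-+ (seq z k) (fromℤ i) (fromℤ j)))

module _ (R : CommutativeRing 0ℓ 0ℓ) where

  private
    open module R = CommutativeRing R using (_≈_; _*_; 0#; 1#)

  invertible-cancel : ∀ c d z → c * d ≈ 1# → d * z ≈ 0# → z ≈ 0#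
  invertible-cancel c d z cd≈1 dz≈0 = begin
    z             ≈⟨ R.*-identityˡ z ⟨
    1# * z        ≈⟨ R.*-congʳ cd≈1 ⟨
    (c * d) * z   ≈⟨ R.*-assoc c d z ⟩
    c * (d * z)   ≈⟨ R.*-congˡ dz≈0 ⟩
    c * 0#        ≈⟨ R.zeroʳ c ⟩
    0#            ∎
    where open SetoidReasoning R.setoid

ℝ-torsionFree : TorsionFree ℝ⁺
ℝ-torsionFree n z n≢0 nz≈0 = from-inverse (ratio 1ℤ n≢0)
  where
  from-inverse : ∃[ q ] fromℤ n ℚ.* q ≡ fromℤ 1ℤ → z ≈ʳ ℝᴿ.0#
  from-inverse (q , nq≡1) =
    invertible-cancel ℝ-commutativeRing (fromℚʳ q) (fromℚʳ (fromℤ n)) z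
      (termwise λ _ → ≡.trans (ℚ.*-comm q (fromℤ n)) (≡.trans nq≡1 fromℤ-1))
      (≈ʳ-trans (≈ʳ-sym (ℝ-· n z)) nz≈0)

nonZero⇒≢0 : ∀ i .{{_ : ℤ.NonZero i}} → i ≢ 0ℤ
nonZero⇒≢0 i i≡0 = ℕ.≢-nonZero⁻¹ ℤ.∣ i ∣ (≡.cong ℤ.∣_∣ i≡0)

∣-nonZero : ∀ {g} M .{{_ : ℕ.NonZero M}} → g ℤ∣.∣ + M → g ≢ 0ℤ
∣-nonZero M g∣M refl = ℕ.≢-nonZero⁻¹ M (ℤ.+-injective (ℤ∣.0∣⇒≡0 g∣M))

mod-∣ : ∀ {g M i j} → g ℤ∣.∣ + M → i ≡ j mod M → g ℤ∣.∣ j → g ℤ∣.∣ i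
mod-∣ {g} {M} {i} {j} g∣M (mkmod M∣i-j) g∣j = ≡.subst (g ℤ∣.∣_)
  (solve 2 (λ i j → (i :- j) :+ j := i) refl i j)
  (ℤ∣.∣m∣n⇒∣m+n (ℤ∣.∣-trans g∣M M∣i-j) g∣j)
  where open ℤ-Solver

mod-weaken : ∀ {m n i j} → m ℕ∣.∣ n → i ≡ j mod n → i ≡ j mod m
mod-weaken m∣n (mkmod n∣i-j) = mkmod (ℤ∣.∣-trans (ℤ∣.∣ᵤ⇒∣ m∣n) n∣i-j)

-- The kernel of Ẑ → ℤ/M is M Ẑ.
Ẑ-divide : ∀ M .{{_ : ℕ.NonZero M}} g x → g ℤ∣.∣ + M → g ℤ∣.∣ res x M → ∃[ y ] x ≈ᶻ ι g *ᶻ y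
-- The residue of the quotient modulo k is computed at level M k: dividing by g, a divisor of M,
-- loses at most a factor M of precision.
Ẑ-divide M g x g∣M g∣xM = mkẐ (λ k → quotient k) coherent′
                        , mk≈ λ k → mod-trans (mod-sym (coherent x (ℕ∣.n∣m*n M {k})))
                                              (mod-reflexive (quotient-equality k))
  where
  instance
    M*k≢0 : ∀ {k} .{{_ : ℕ.NonZero k}} → ℕ.NonZero (M ℕ.* k)
    M*k≢0 {k} = ℕ.m*n≢0 M k
    g-nonZero : ℤ.NonZero g
    g-nonZero = ℤ.≢-nonZero (∣-nonZero M g∣M)
  g∣x : ∀ k .{{_ : ℕ.NonZero k}} → g ℤ∣.∣ res x (M ℕ.* k)
  g∣x k = mod-∣ g∣M (coherent x (ℕ∣.m∣m*n k)) g∣xM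
  quotient : ∀ k .{{_ : ℕ.NonZero k}} → ℤ
  quotient k = ℤ∣._∣_.quotient (g∣x k)
  quotient-equality : ∀ k .{{_ : ℕ.NonZero k}} → res x (M ℕ.* k) ≡ g ℤ.* quotient k
  quotient-equality k = ≡.trans (ℤ∣._∣_.equality (g∣x k)) (ℤ.*-comm (quotient k) g)
  coherent′ : ∀ {j k} .{{_ : ℕ.NonZero j}} .{{_ : ℕ.NonZero k}} →
              j ℕ∣.∣ k → quotient k ≡ quotient j mod j
  coherent′ {j} {k} j∣k = mkmod (ℤ∣.*-cancelˡ-∣ g
    (≡.subst (g ℤ.* + j ℤ∣.∣_) difference
      (ℤ∣.∣-trans (ℤ∣.*-monoˡ-∣ (+ j) g∣M)
        (≡.subst (ℤ∣._∣ (res x (M ℕ.* k) ℤ.- res x (M ℕ.* j))) (ℤ.pos-* M j)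
          (divides-difference (coherent x (ℕ∣.*-monoʳ-∣ M j∣k)))))))
    where
    open ℤ-Solver
    difference : res x (M ℕ.* k) ℤ.- res x (M ℕ.* j) ≡ g ℤ.* (quotient k ℤ.- quotient j)
    difference = ≡.trans (≡.cong₂ ℤ._-_ (quotient-equality k) (quotient-equality j))
      (solve 3 (λ g a b → g :* a :- g :* b := g :* (a :- b)) refl g (quotient k) (quotient j))

-- The groups L_a

rationalHom : ∀ a → Hom (multipliers a) ℚ⁺
rationalHom a = additive (multipliers a) ℚ⁺ rational (λ eq → eq) (λ _ _ → refl)

rational-· : ∀ a n x → rational (_·_ (multipliers a) n x) ≡ fromℤ n ℚ.* rational x
rational-· a n x = ≡.trans (·-homo (multipliers a) ℚ⁺ (rationalHom a) n x) (·≡* n (rational x))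

value-· : ∀ a n x → value (_·_ (multipliers a) n x) ≈ᶻ ι n *ᶻ value x
value-· a n x = Ẑᴿ.trans (·-homo (multipliers a) Ẑ⁺ (valueHom a) n x) (Ẑ-· n (value x))

-- Here u / e is meant as the reduced form of m / n. The hypotheses combine to n times the claim,
-- and n cancels in the torsion-free Ẑ.
cancel-cross : ∀ n m u e d {x z} → n ≢ 0ℤ → n ℤ.* u ≡ m ℤ.* e → ι (n ℤ.* d) *ᶻ z ≈ᶻ ι m *ᶻ x →
               ι 1ℤ *ᶻ (ι u *ᶻ x) ≈ᶻ ι (e ℤ.* d) *ᶻ z
cancel-cross n m u e d {x} {z} n≢0 nu≡me ndz≈mx = ι-cancel n {{ℤ.≢-nonZero n≢0}} (mk≈ λ k →
  mod-combination (ℤ.- e) 0ℤ (eq (res x k) (res z k)) (cong-mod ndz≈mx k) (cong-mod ndz≈mx k))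
  where
  open ℤ-Solver
  eq : ∀ x z → (ℤ.- e) ℤ.* (n ℤ.* d ℤ.* z ℤ.- m ℤ.* x) ℤ.+ 0ℤ ℤ.* (n ℤ.* d ℤ.* z ℤ.- m ℤ.* x) ≡
       n ℤ.* (1ℤ ℤ.* (u ℤ.* x)) ℤ.- n ℤ.* ((e ℤ.* d) ℤ.* z)
  eq x z = ≡.trans
    (solve 6 (λ x z d e m n →
        (:- e) :* (n :* d :* z :- m :* x) :+ con 0ℤ :* (n :* d :* z :- m :* x) :=
        (m :* e) :* x :- n :* ((e :* d) :* z))
      refl x z d e m n)
    (≡.trans (≡.cong (λ c → c ℤ.* x ℤ.- n ℤ.* ((e ℤ.* d) ℤ.* z)) (≡.sym nu≡me))
    (solve 6 (λ x z d e u n → (n :* u) :* x :- n :* ((e :* d) :* z) :=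
                              n :* (con 1ℤ :* (u :* x)) :- n :* ((e :* d) :* z))
      refl x z d e u n))

-- Membership in L_a may thus be tested on any fraction m / n representing q, whereas `fromℚᶠ` sees
-- only the reduced one.
multiplierOfRatio : ∀ m x d {{_ : ℤ.NonZero d}} {n} → n ≢ 0ℤ → ∀ z → ι (n ℤ.* d) *ᶻ z ≈ᶻ ι m *ᶻ x →
                    ∀ q → fromℤ n ℚ.* q ≡ fromℤ m → fromℚᶠ q *ᶠ (x ÷ d) ≈ᶠ integral z
multiplierOfRatio m x d {n} n≢0 z ndz≈mx q nq≡m =
  mk≈ crossed
  where
  crossed : ι 1ℤ *ᶻ (ι (↥ q) *ᶻ x) ≈ᶻ ι (↧ q ℤ.* d) *ᶻ z
  crossed = cancel-cross n m (↥ q) (↧ q) d {x} {z} n≢0 (ratio⇒cross n m q nq≡m) ndz≈mx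

-- Since d (x / d) = x, every L_a contains the nonzero integer d; it serves as the base element
-- wherever rank one is used.
denominatorMultiplier : ∀ x d {{_ : ℤ.NonZero d}} → Multiplier (x ÷ d)
denominatorMultiplier x d = multiplier (fromℤ d) x
  (multiplierOfRatio d x d {1ℤ} (λ ()) x
    (pointwise λ k → ≡.cong (ℤ._* res x k) (ℤ.*-identityˡ d)) (fromℤ d) (1*≡ (fromℤ d)))

multipliers-torsionFree : ∀ a → TorsionFree (multipliers a)
multipliers-torsionFree a n x n≢0 nx≈0 = ℚ-cancelˡ (fromℤ n) (fromℤ-≢0 n≢0)
  (≡.trans (≡.sym (rational-· a n x)) (≡.trans nx≈0 (≡.sym (ℚ.*-zeroʳ (fromℤ n)))))

multipliers-rankOne : ∀ a → RankOne (multipliers a)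
multipliers-rankOne a@(x ÷ d) = base , independent , fraction
  where
  base = denominatorMultiplier x d
  d≢0 : d ≢ 0ℤ
  d≢0 = nonZero⇒≢0 d
  independent : ∀ n → rational (_·_ (multipliers a) n base) ≡ 0ℚ → n ≡ 0ℤ
  independent n eq =
    [ (λ n≡0 → fromℤ-injective (≡.trans n≡0 (≡.sym fromℤ-0)))
    , (λ d≡0 → contradiction d≡0 (fromℤ-≢0 d≢0)) ]′
    (p*q≡0⇒p≡0∨q≡0 (fromℤ n) (fromℤ d) (≡.trans (≡.sym (rational-· a n base)) eq))
  fraction : ∀ y → ∃[ n ] ∃[ m ] n ≢ 0ℤ ×
             rational (_·_ (multipliers a) n y) ≡ rational (_·_ (multipliers a) m base)
  fraction y = d ℤ.* ↧ q , ↥ q , *-≢0 d≢0 (λ ()) , (begin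
    rational (_·_ (multipliers a) (d ℤ.* ↧ q) y)  ≡⟨ rational-· a (d ℤ.* ↧ q) y ⟩
    fromℤ (d ℤ.* ↧ q) ℚ.* q                       ≡⟨ ≡.cong (ℚ._* q) (fromℤ-* d (↧ q)) ⟩
    fromℤ d ℚ.* fromℤ (↧ q) ℚ.* q                 ≡⟨ ℚ.*-assoc (fromℤ d) (fromℤ (↧ q)) q ⟩
    fromℤ d ℚ.* (fromℤ (↧ q) ℚ.* q)               ≡⟨ ≡.cong (fromℤ d ℚ.*_) (↧*q≡↥ q) ⟩
    fromℤ d ℚ.* fromℤ (↥ q)                       ≡⟨ ℚ.*-comm (fromℤ d) (fromℤ (↥ q)) ⟩
    fromℤ (↥ q) ℚ.* fromℤ d                       ≡⟨ rational-· a (↥ q) base ⟨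
    rational (_·_ (multipliers a) (↥ q) base)     ∎)
    where
    open ≡.≡-Reasoning
    q = rational y

multipliers-locallyCyclic : ∀ a → LocallyCyclic (multipliers a)
multipliers-locallyCyclic a =
  rankOne⇒locallyCyclic (multipliers a) (multipliers-torsionFree a) (multipliers-rankOne a)

multiplyMultipliers : ∀ a b → Multiplier a → Multiplier b → Multiplier (a *ᶠ b)
multiplyMultipliers a b x y =
  multiplier (rational x ℚ.* rational y) (value x *ᶻ value y) (begin
    fromℚᶠ (rational x ℚ.* rational y) *ᶠ (a *ᶠ b)
      ≈⟨ 𝔸ᶠᴿ.*-congʳ {a *ᶠ b} (fromℚᶠ-* (rational x) (rational y)) ⟩
    (fromℚᶠ (rational x) *ᶠ fromℚᶠ (rational y)) *ᶠ (a *ᶠ b)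
      ≈⟨ interchange (fromℚᶠ (rational x)) (fromℚᶠ (rational y)) a b ⟩
    (fromℚᶠ (rational x) *ᶠ a) *ᶠ (fromℚᶠ (rational y) *ᶠ b)
      ≈⟨ 𝔸ᶠᴿ.*-cong (is-value x) (is-value y) ⟩
    integral (value x) *ᶠ integral (value y)
      ≈⟨ integral-* (value x) (value y) ⟩
    integral (value x *ᶻ value y) ∎)
  where
  open SetoidReasoning 𝔸ᶠᴿ.setoid
  open import Algebra.Properties.CommutativeSemigroup 𝔸ᶠᴿ.*-commutativeSemigroup
    using (interchange)

scale-relation : ∀ g m d x w → ι m *ᶻ x ≈ᶻ ι g *ᶻ w → ι (g ℤ.* d) *ᶻ w ≈ᶻ ι (m ℤ.* d) *ᶻ x
scale-relation g m d x w mx≈gw = mk≈ λ k → mod-combination (ℤ.- d) 0ℤ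
  (solve 5 (λ g d w m x → (:- d) :* (m :* x :- g :* w) :+ con 0ℤ :* (m :* x :- g :* w) :=
                          (g :* d) :* w :- (m :* d) :* x)
    refl g d (res w k) m (res x k))
  (cong-mod mx≈gw k) (cong-mod mx≈gw k)
  where open ℤ-Solver

scale-relation₁ : ∀ h e y w → y ≈ᶻ ι h *ᶻ w → ι (h ℤ.* e) *ᶻ w ≈ᶻ ι e *ᶻ y
scale-relation₁ h e y w y≈hw = mk≈ λ k → mod-combination (ℤ.- e) 0ℤ
  (solve 4 (λ h e w y → (:- e) :* (y :- h :* w) :+ con 0ℤ :* (y :- h :* w) :=
                        (h :* e) :* w :- e :* y)
    refl h e (res w k) (res y k))
  (cong-mod y≈hw k) (cong-mod y≈hw k)
  where open ℤ-Solver

-- Write a = x / d, b = y / e and w = m / n, so that m x y = N z with N = n d e.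
-- For g = gcd (m x, N) and h = N / g, both m x / g and y / h lie in Ẑ, and
-- w = (m d / g) (e / h).
factorMultiplier : ∀ a b (w : Multiplier (a *ᶠ b)) →
  ∃[ u ] ∃[ v ] rational (multiplyMultipliers a b u v) ≡ rational w
factorMultiplier (x ÷ d) (y ÷ e) w =
  factor (bézout (m ℤ.* xM) N)
  where
  open ℤ-Solver
  q = rational w
  z = value w
  m = ↥ q
  n = ↧ q
  N = n ℤ.* (d ℤ.* e)
  M = ℤ.∣ N ∣
  instance
    M≢0 : ℕ.NonZero M
    M≢0 = ℤ.i*j≢0 n (d ℤ.* e) {{_}} {{ℤ.i*j≢0 d e}}
  d≢0 = nonZero⇒≢0 d
  e≢0 = nonZero⇒≢0 e
  xM = res x M
  yM = res y M
  -- `is-value` is the identity m x y = N z in Ẑ, read here modulo |N|.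
  N∣mxy : N ℤ∣.∣ m ℤ.* xM ℤ.* yM
  N∣mxy = ≡.subst (N ℤ∣.∣_)
    (solve 3 (λ m x y → con 1ℤ :* (m :* (x :* y)) := m :* x :* y) refl m xM yM)
    (mod-∣ ℤ∣.m∣∣m∣ (cong-mod (_≈ᶠ_.cross (is-value w)) M) (ℤ∣.∣m⇒∣m*n (res z M) ℤ∣.∣-refl))
  factor : ∃[ g ] g ℤ∣.∣ m ℤ.* xM × g ℤ∣.∣ N × ∃[ s ] ∃[ t ] s ℤ.* (m ℤ.* xM) ℤ.+ t ℤ.* N ≡ g →
           ∃[ u ] ∃[ v ] rational (multiplyMultipliers (x ÷ d) (y ÷ e) u v) ≡ q
  factor (g , g∣mx , g∣N@(divides h N≡hg) , s , t , eq)
    = assemble (Ẑ-divide M g (ι m *ᶻ x) g∣M g∣mx) (Ẑ-divide M h y h∣M h∣y)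
               (ratio (m ℤ.* d) g≢0) (ratio e h≢0)
    where
    g∣M = ℤ∣.∣-trans g∣N ℤ∣.m∣∣m∣
    g≢0 = ∣-nonZero M g∣M
    h∣N : h ℤ∣.∣ N
    h∣N = divides g (≡.trans N≡hg (ℤ.*-comm h g))
    h∣M = ℤ∣.∣-trans h∣N ℤ∣.m∣∣m∣
    h≢0 = ∣-nonZero M h∣M
    instance
      g-nonZero = ℤ.≢-nonZero g≢0
    -- Multiplying s m x + t N = g by y exhibits g y as a multiple of N = g h, and g cancels among
    -- integers.
    h∣y : h ℤ∣.∣ yM
    h∣y = ℤ∣.*-cancelˡ-∣ g (≡.subst₂ ℤ∣._∣_ (≡.trans N≡hg (ℤ.*-comm h g)) expand
      (ℤ∣.∣m∣n⇒∣m+n (ℤ∣.∣n⇒∣m*n s N∣mxy) (ℤ∣.∣n⇒∣m*n (t ℤ.* yM) ℤ∣.∣-refl)))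
      where
      expand : s ℤ.* (m ℤ.* xM ℤ.* yM) ℤ.+ t ℤ.* yM ℤ.* N ≡ g ℤ.* yM
      expand = ≡.trans
        (solve 5 (λ s c y t N → s :* (c :* y) :+ t :* y :* N := (s :* c :+ t :* N) :* y)
                         refl s (m ℤ.* xM) yM t N)
                       (≡.cong (ℤ._* yM) eq)
    gh≢0 : fromℤ g ℚ.* fromℤ h ≢ 0ℚ
    gh≢0 eq = fromℤ-≢0 (*-≢0 g≢0 h≢0) (≡.trans (fromℤ-* g h) eq)
    module Q = ℚ-Solver
    product : ∀ {r s} → fromℤ g ℚ.* r ≡ fromℤ (m ℤ.* d) → fromℤ h ℚ.* s ≡ fromℤ e →
              fromℤ g ℚ.* fromℤ h ℚ.* (r ℚ.* s) ≡ fromℤ g ℚ.* fromℤ h ℚ.* q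
    product {r} {s} gr≡md hs≡e = begin
      fromℤ g ℚ.* fromℤ h ℚ.* (r ℚ.* s)
        ≡⟨ Q.solve 4 (λ g h r s → g Q.:* h Q.:* (r Q.:* s) Q.:= (g Q.:* r) Q.:* (h Q.:* s))
             refl (fromℤ g) (fromℤ h) (r) (s) ⟩
      (fromℤ g ℚ.* r) ℚ.* (fromℤ h ℚ.* s)
        ≡⟨ ≡.cong₂ ℚ._*_ (gr≡md) (hs≡e) ⟩
      fromℤ (m ℤ.* d) ℚ.* fromℤ e
        ≡⟨ ≡.cong (ℚ._* fromℤ e) (fromℤ-* m d) ⟩
      fromℤ m ℚ.* fromℤ d ℚ.* fromℤ e
        ≡⟨ ≡.cong (λ c → c ℚ.* fromℤ d ℚ.* fromℤ e) (↧*q≡↥ q) ⟨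
      fromℤ n ℚ.* q ℚ.* fromℤ d ℚ.* fromℤ e
        ≡⟨ Q.solve 4 (λ n q d e → n Q.:* q Q.:* d Q.:* e Q.:= n Q.:* (d Q.:* e) Q.:* q)
             refl (fromℤ n) q (fromℤ d) (fromℤ e) ⟩
      fromℤ n ℚ.* (fromℤ d ℚ.* fromℤ e) ℚ.* q
        ≡⟨ ≡.cong (λ c → fromℤ n ℚ.* c ℚ.* q) (fromℤ-* d e) ⟨
      fromℤ n ℚ.* fromℤ (d ℤ.* e) ℚ.* q
        ≡⟨ ≡.cong (ℚ._* q) (fromℤ-* n (d ℤ.* e)) ⟨
      fromℤ N ℚ.* q
        ≡⟨ ≡.cong (λ c → fromℤ c ℚ.* q) (≡.trans N≡hg (ℤ.*-comm h g)) ⟩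
      fromℤ (g ℤ.* h) ℚ.* q
        ≡⟨ ≡.cong (ℚ._* q) (fromℤ-* g h) ⟩
      fromℤ g ℚ.* fromℤ h ℚ.* q ∎
      where open ≡.≡-Reasoning
    assemble : ∃[ w ] ι m *ᶻ x ≈ᶻ ι g *ᶻ w → ∃[ w ] y ≈ᶻ ι h *ᶻ w →
               ∃[ r ] fromℤ g ℚ.* r ≡ fromℤ (m ℤ.* d) → ∃[ s ] fromℤ h ℚ.* s ≡ fromℤ e →
               ∃[ u ] ∃[ v ] rational (multiplyMultipliers (x ÷ d) (y ÷ e) u v) ≡ q
    assemble (w₁ , mx≈gw₁) (w₂ , y≈hw₂) (r , gr≡md) (s , hs≡e) =
      multiplier r w₁
        (multiplierOfRatio (m ℤ.* d) x d g≢0 w₁ (scale-relation g m d x w₁ mx≈gw₁) r gr≡md)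
      , multiplier s w₂
        (multiplierOfRatio e y e h≢0 w₂ (scale-relation₁ h e y w₂ y≈hw₂) s hs≡e)
      , ℚ-cancelˡ (fromℤ g ℚ.* fromℤ h) gh≢0 (product gr≡md hs≡e)

open Triple using (L; ξ; τ)

compose : ∀ A B C → Hom A B → Hom B C → Hom A C
compose A B C f g = additive A C (λ x → ⟦ g ⟧ (⟦ f ⟧ x))
  (λ eq → g.⟦⟧-cong (f.⟦⟧-cong eq))
  (λ x y → C.trans (g.⟦⟧-cong (f.homo x y)) (g.homo (⟦ f ⟧ x) (⟦ f ⟧ y)))
  where
  module C = AbelianGroup C
  module f = GroupHomomorphism f
  module g = GroupHomomorphism g

-- Tensor products

module _ (A B C : Ab) where

  private
    module A = AbelianGroup A
    module B = AbelianGroup B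
    module C = AbelianGroup C

  tensor-hom-unique : ∀ (f g : Hom (tensorProduct A B) C) →
                      (∀ x y → ⟦ f ⟧ (x ⊗ y) C.≈ ⟦ g ⟧ (x ⊗ y)) → ∀ t → ⟦ f ⟧ t C.≈ ⟦ g ⟧ t
  tensor-hom-unique f g eq = go
    where
    module f = GroupHomomorphism f
    module g = GroupHomomorphism g
    go : ∀ t → ⟦ f ⟧ t C.≈ ⟦ g ⟧ t
    go (x ⊗ y) = eq x y
    go (s ⊕ t) = C.trans (f.homo s t) (C.trans (C.∙-cong (go s) (go t)) (C.sym (g.homo s t)))
    go 𝟘       = C.trans f.ε-homo (C.sym g.ε-homo)
    go (⊖ s)   = C.trans (f.⁻¹-homo s) (C.trans (C.⁻¹-cong (go s)) (C.sym (g.⁻¹-homo s)))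

  module _ (β : A.Carrier → B.Carrier → C.Carrier)
           (β-cong : ∀ {x x′ y y′} → x A.≈ x′ → y B.≈ y′ → β x y C.≈ β x′ y′)
           (β-distribˡ : ∀ x y y′ → β x (y B.∙ y′) C.≈ β x y C.∙ β x y′)
           (β-distribʳ : ∀ x x′ y → β (x A.∙ x′) y C.≈ β x y C.∙ β x′ y) where

    private
      lift : Tensor A B → C.Carrier
      lift (x ⊗ y) = β x y
      lift (s ⊕ t) = lift s C.∙ lift t
      lift 𝟘       = C.ε
      lift (⊖ s)   = lift s C.⁻¹

      lift-cong : ∀ {s t} → _∼_ A B s t → lift s C.≈ lift t
      lift-cong ∼-refl              = C.refl
      lift-cong (∼-sym p)           = C.sym (lift-cong p)
      lift-cong (∼-trans p q)       = C.trans (lift-cong p) (lift-cong q)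
      lift-cong (⊗-cong p q)        = β-cong p q
      lift-cong (⊕-cong p q)        = C.∙-cong (lift-cong p) (lift-cong q)
      lift-cong (⊖-cong p)          = C.⁻¹-cong (lift-cong p)
      lift-cong (⊕-assoc s t u)     = C.assoc (lift s) (lift t) (lift u)
      lift-cong (⊕-comm s t)        = C.comm (lift s) (lift t)
      lift-cong (⊕-identityˡ s)     = C.identityˡ (lift s)
      lift-cong (⊖-inverseˡ s)      = C.inverseˡ (lift s)
      lift-cong (⊗-distribˡ x y y′) = β-distribˡ x y y′
      lift-cong (⊗-distribʳ x x′ y) = β-distribʳ x x′ y

    -- The existence half of the universal property of the tensor product; `tensor-hom-unique` is
    -- the uniqueness half.
    bilinear : Hom (tensorProduct A B) C
    bilinear = additive (tensorProduct A B) C lift lift-cong (λ _ _ → C.refl)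

module _ (A B : Ab) (cyclicᴬ : LocallyCyclic A) (cyclicᴮ : LocallyCyclic B) where

  private
    module A = AbelianGroup A
    module B = AbelianGroup B
    T : Ab
    T = tensorProduct A B
    module T = AbelianGroup T
    module MT = Multiples T
    open AbelianGroupProperties T

    left : B.Carrier → Hom A T
    left y = additive A T (_⊗ y) (λ eq → ⊗-cong eq B.refl) (λ x x′ → ⊗-distribʳ x x′ y)

    right : A.Carrier → Hom B T
    right x = additive B T (x ⊗_) (λ eq → ⊗-cong A.refl eq) (λ y y′ → ⊗-distribˡ x y y′)

    coefficient : ∀ {x y u v} p r → x A.≈ _·_ A p u → y B.≈ _·_ B r v →
                  x ⊗ y T.≈ (p ℤ.* r) MT.∗ (u ⊗ v)
    coefficient {x} {y} {u} {v} p r x≈pu y≈rv = begin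
      x ⊗ y                         ≈⟨ ⊗-cong x≈pu y≈rv ⟩
      _·_ A p u ⊗ _·_ B r v         ≈⟨ ·-homo A T (left (_·_ B r v)) p u ⟩
      p MT.∗ (u ⊗ _·_ B r v)        ≈⟨ MT.∗-congˡ p (·-homo B T (right u) r v) ⟩
      p MT.∗ r MT.∗ (u ⊗ v)         ≈⟨ MT.∗-assoc p r (u ⊗ v) ⟨
      (p ℤ.* r) MT.∗ (u ⊗ v)        ∎
      where open SetoidReasoning T.setoid

    -- Local cyclicity makes x, x′ multiples of one u and y, y′ multiples of one v. Both summands
    -- are then multiples of u ⊗ v, and the total coefficient can be moved into the left factor.
    pure-+ : ∀ x y x′ y′ → ∃[ u ] ∃[ v ] (x ⊗ y) ⊕ (x′ ⊗ y′) T.≈ u ⊗ v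
    pure-+ x y x′ y′ with cyclicᴬ x x′ | cyclicᴮ y y′
    ... | u , p , p′ , x≈pu , x′≈p′u | v , r , r′ , y≈rv , y′≈r′v =
      _·_ A c u , v , (begin
        (x ⊗ y) ⊕ (x′ ⊗ y′)
          ≈⟨ ⊕-cong (coefficient p r x≈pu y≈rv) (coefficient p′ r′ x′≈p′u y′≈r′v) ⟩
        ((p ℤ.* r) MT.∗ (u ⊗ v)) ⊕ ((p′ ℤ.* r′) MT.∗ (u ⊗ v))
          ≈⟨ MT.∗-homo-+ (u ⊗ v) (p ℤ.* r) (p′ ℤ.* r′) ⟨
        c MT.∗ (u ⊗ v)
          ≈⟨ ·-homo A T (left v) c u ⟨
        _·_ A c u ⊗ v ∎)
      where
      open SetoidReasoning T.setoid
      c = p ℤ.* r ℤ.+ p′ ℤ.* r′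

  tensor-pure : ∀ t → ∃[ x ] ∃[ y ] t T.≈ x ⊗ y
  tensor-pure (x ⊗ y) = x , y , ∼-refl
  tensor-pure (s ⊕ t) with tensor-pure s | tensor-pure t
  ... | x , y , s∼xy | x′ , y′ , t∼x′y′ with pure-+ x y x′ y′
  ... | u , v , eq = u , v , ∼-trans (⊕-cong s∼xy t∼x′y′) eq
  tensor-pure 𝟘       =
    A.ε , B.ε , ∼-sym (GroupHomomorphism.ε-homo (left B.ε))
  tensor-pure (⊖ s)   with tensor-pure s
  ... | x , y , s∼xy =
    x A.⁻¹ , y , ∼-trans (⊖-cong s∼xy) (∼-sym (GroupHomomorphism.⁻¹-homo (left y) x))

-- Isomorphisms of triples

isomorphism : ∀ X Y (f : Hom (L X) (L Y)) →
  (∀ x → AbelianGroup._≈_ (L Y) (⟦ f ⟧ x) (AbelianGroup.ε (L Y)) →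
         AbelianGroup._≈_ (L X) x (AbelianGroup.ε (L X))) →
  (∀ y → ∃[ x ] AbelianGroup._≈_ (L Y) (⟦ f ⟧ x) y) →
  (∀ x → ⟦ ξ Y ⟧ (⟦ f ⟧ x) ≈ᶻ ⟦ ξ X ⟧ x) → (∀ x → ⟦ τ Y ⟧ (⟦ f ⟧ x) ≈ʳ ⟦ τ X ⟧ x) →
  X ≅ Y
isomorphism X Y f kernel surjective ξ-compatible τ-compatible = record
  { φ             = ⟦ f ⟧
  ; isIsomorphism = record
    { isGroupMonomorphism = record
      { isGroupHomomorphism = f.isGroupHomomorphism
      ; injective           = λ {x} {y} fx≈fy → X.x∙y⁻¹≈ε⇒x≈y x y (kernel (x X.∙ y X.⁻¹)
          (Y.trans (f.homo x (y X.⁻¹)) (Y.trans (Y.∙-congˡ (f.⁻¹-homo y)) (Y.x≈y⇒x∙y⁻¹≈ε fx≈fy))))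
      }
    ; surjective          = λ y → proj₁ (surjective y) , λ z≈x →
        Y.trans (f.⟦⟧-cong z≈x) (proj₂ (surjective y))
    }
  ; ξ-compatible  = ξ-compatible
  ; τ-compatible  = τ-compatible
  }
  where
  module f = GroupHomomorphism f
  module X where
    open AbelianGroup (L X) public
    open AbelianGroupProperties (L X) public
  module Y where
    open AbelianGroup (L Y) public
    open AbelianGroupProperties (L Y) public

module Isomorphism {X Y} (X≅Y : X ≅ Y) where

  private
    module X = AbelianGroup (L X)
    module Y = AbelianGroup (L Y)

  open _≅_ X≅Y public
  open GroupMorphisms.IsGroupIsomorphism isIsomorphism public

  to : Hom (L X) (L Y)
  to = record { ⟦_⟧ = φ ; isGroupHomomorphism = isGroupHomomorphism }

  φ⁻¹ : Y.Carrier → X.Carrier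
  φ⁻¹ y = proj₁ (surjective y)

  φ-φ⁻¹ : ∀ y → φ (φ⁻¹ y) Y.≈ y
  φ-φ⁻¹ y = proj₂ (surjective y) X.refl

  φ⁻¹-φ : ∀ x → φ⁻¹ (φ x) X.≈ x
  φ⁻¹-φ x = injective (φ-φ⁻¹ (φ x))

  kernel : ∀ x → φ x Y.≈ Y.ε → x X.≈ X.ε
  kernel x eq = injective (Y.trans eq (Y.sym (GroupHomomorphism.ε-homo to)))

  from : Hom (L Y) (L X)
  from = additive (L Y) (L X) φ⁻¹
    (λ {y} {y′} y≈y′ → injective (Y.trans (φ-φ⁻¹ y) (Y.trans y≈y′ (Y.sym (φ-φ⁻¹ y′)))))
    (λ y y′ → injective (Y.trans (φ-φ⁻¹ (y Y.∙ y′))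
      (Y.sym (Y.trans (GroupHomomorphism.homo to (φ⁻¹ y) (φ⁻¹ y′))
                      (Y.∙-cong (φ-φ⁻¹ y) (φ-φ⁻¹ y′))))))

≅-refl : ∀ {X} → X ≅ X
≅-refl {X} = isomorphism X X (additive (L X) (L X) (λ x → x) (λ eq → eq) (λ _ _ → X.refl))
  (λ _ eq → eq) (λ x → x , X.refl) (λ _ → Ẑᴿ.refl) (λ _ → ℝᴿ.refl)
  where module X = AbelianGroup (L X)

≅-sym : ∀ {X Y} → X ≅ Y → Y ≅ X
≅-sym {X} {Y} X≅Y = isomorphism Y X I.from
  (λ y eq → Y.trans (Y.sym (I.φ-φ⁻¹ y))
    (Y.trans (GroupHomomorphism.⟦⟧-cong I.to eq) (GroupHomomorphism.ε-homo I.to)))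
  (λ x → I.φ x , I.φ⁻¹-φ x)
  (λ y → Ẑᴿ.trans (Ẑᴿ.sym (I.ξ-compatible (I.φ⁻¹ y))) (GroupHomomorphism.⟦⟧-cong (ξ Y) (I.φ-φ⁻¹ y)))
  (λ y → ℝᴿ.trans (ℝᴿ.sym (I.τ-compatible (I.φ⁻¹ y))) (GroupHomomorphism.⟦⟧-cong (τ Y) (I.φ-φ⁻¹ y)))
  where
  module I = Isomorphism X≅Y
  module Y = AbelianGroup (L Y)

≅-trans : ∀ {X Y Z} → X ≅ Y → Y ≅ Z → X ≅ Z
≅-trans {X} {Y} {Z} X≅Y Y≅Z = isomorphism X Z (compose (L X) (L Y) (L Z) I.to J.to)
  (λ x eq → I.kernel x (J.kernel (I.φ x) eq))
  (λ z → I.φ⁻¹ (J.φ⁻¹ z) ,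
    Z.trans (GroupHomomorphism.⟦⟧-cong J.to (I.φ-φ⁻¹ (J.φ⁻¹ z))) (J.φ-φ⁻¹ z))
  (λ x → Ẑᴿ.trans (J.ξ-compatible (I.φ x)) (I.ξ-compatible x))
  (λ x → ℝᴿ.trans (J.τ-compatible (I.φ x)) (I.τ-compatible x))
  where
  module I = Isomorphism X≅Y
  module J = Isomorphism Y≅Z
  module Z = AbelianGroup (L Z)

-- The tensor product of D_a and D_b

fromℚʳ-interchange : ∀ p q r s →
  fromℚʳ (p ℚ.* q) *ʳ (r *ʳ s) ≈ʳ (fromℚʳ p *ʳ r) *ʳ (fromℚʳ q *ʳ s)
fromℚʳ-interchange p q r s = termwise λ n → interchange p q (seq r n) (seq s n)
  where
  open import Algebra.Properties.CommutativeSemigroup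
    (CommutativeRing.*-commutativeSemigroup ℚ.+-*-commutativeRing) using (interchange)

fromℚʳ-*-cong : ∀ p q r s t u w → w ≡ p ℚ.* q → fromℚʳ p *ʳ r ≈ʳ t → fromℚʳ q *ʳ s ≈ʳ u →
                fromℚʳ w *ʳ (r *ʳ s) ≈ʳ t *ʳ u
fromℚʳ-*-cong p q r s t u w refl pr≈t qs≈u =
  ≈ʳ-trans {fromℚʳ (p ℚ.* q) *ʳ (r *ʳ s)} {(fromℚʳ p *ʳ r) *ʳ (fromℚʳ q *ʳ s)} {t *ʳ u}
    (fromℚʳ-interchange p q r s)
    (ℝᴿ.*-cong {fromℚʳ p *ʳ r} {t} {fromℚʳ q *ʳ s} {u} pr≈t qs≈u)

-- X ⊗ Y → L_ab, x ⊗ y ↦ φ x ψ y, is injective because every tensor is pure and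
-- ℚ has no zero divisors, and surjective by factorMultiplier.
module TensorCoordinates {X Y : Triple} {a b : 𝔸ᶠ} {r s : ℝ}
  (cyclicˣ : LocallyCyclic (L X)) (cyclicʸ : LocallyCyclic (L Y))
  (φ : ∣ L X ∣ → Multiplier a) (ψ : ∣ L Y ∣ → Multiplier b)
  (φ-isHom : GroupMorphisms.IsGroupHomomorphism
               (AbelianGroup.rawGroup (L X)) (AbelianGroup.rawGroup (multipliers a)) φ)
  (ψ-isHom : GroupMorphisms.IsGroupHomomorphism
               (AbelianGroup.rawGroup (L Y)) (AbelianGroup.rawGroup (multipliers b)) ψ)
  (φ-kernel : ∀ x → rational (φ x) ≡ 0ℚ → AbelianGroup._≈_ (L X) x (AbelianGroup.ε (L X)))
  (ψ-kernel : ∀ y → rational (ψ y) ≡ 0ℚ → AbelianGroup._≈_ (L Y) y (AbelianGroup.ε (L Y)))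
  (φ-surjective : ∀ (u : Multiplier a) → ∃[ x ] rational (φ x) ≡ rational u)
  (ψ-surjective : ∀ (v : Multiplier b) → ∃[ y ] rational (ψ y) ≡ rational v)
  (φ-ξ : ∀ x → value (φ x) ≈ᶻ ⟦ ξ X ⟧ x) (ψ-ξ : ∀ y → value (ψ y) ≈ᶻ ⟦ ξ Y ⟧ y)
  (φ-τ : ∀ x → fromℚʳ (rational (φ x)) *ʳ r ≈ʳ ⟦ τ X ⟧ x)
  (ψ-τ : ∀ y → fromℚʳ (rational (ψ y)) *ʳ s ≈ʳ ⟦ τ Y ⟧ y) where

  private
    module X = AbelianGroup (L X)
    module Y = AbelianGroup (L Y)
  φ-hom : Hom (L X) (multipliers a)
  φ-hom = record { ⟦_⟧ = φ ; isGroupHomomorphism = φ-isHom }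
  ψ-hom : Hom (L Y) (multipliers b)
  ψ-hom = record { ⟦_⟧ = ψ ; isGroupHomomorphism = ψ-isHom }
  module φ-hom = GroupHomomorphism φ-hom
  module ψ-hom = GroupHomomorphism ψ-hom
  Lab : Ab
  Lab = multipliers (a *ᶠ b)
  β : X.Carrier → Y.Carrier → Multiplier (a *ᶠ b)
  β x y = multiplyMultipliers a b (φ x) (ψ y)
  μ : Hom (tensorProduct (L X) (L Y)) Lab
  μ = bilinear (L X) (L Y) Lab β
    (λ p q → ≡.cong₂ ℚ._*_ (φ-hom.⟦⟧-cong p) (ψ-hom.⟦⟧-cong q))
    (λ x y y′ → ≡.trans (≡.cong (rational (φ x) ℚ.*_) (ψ-hom.homo y y′))
                        (ℚ.*-distribˡ-+ (rational (φ x)) (rational (ψ y)) (rational (ψ y′))))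
    (λ x x′ y → ≡.trans (≡.cong (ℚ._* rational (ψ y)) (φ-hom.homo x x′))
                        (ℚ.*-distribʳ-+ (rational (ψ y)) (rational (φ x)) (rational (φ x′))))

  kernel : ∀ t → rational (⟦ μ ⟧ t) ≡ 0ℚ → _∼_ (L X) (L Y) t 𝟘
  kernel t μt≡0 = zero-pure (tensor-pure (L X) (L Y) cyclicˣ cyclicʸ t)
    where
    zero-pure : ∃[ x ] ∃[ y ] _∼_ (L X) (L Y) t (x ⊗ y) → _∼_ (L X) (L Y) t 𝟘
    zero-pure (x , y , t∼xy) = [ left , right ]′
      (p*q≡0⇒p≡0∨q≡0 (rational (φ x)) (rational (ψ y))
        (≡.trans (≡.sym (GroupHomomorphism.⟦⟧-cong μ t∼xy)) μt≡0))
      where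
      module P = AbelianGroupProperties (tensorProduct (L X) (L Y))
      left : rational (φ x) ≡ 0ℚ → _∼_ (L X) (L Y) t 𝟘
      left eq = ∼-trans t∼xy (∼-trans (⊗-cong (φ-kernel x eq) Y.refl)
        (P.identityˡ-unique (X.ε ⊗ y) (X.ε ⊗ y)
          (∼-trans (∼-sym (⊗-distribʳ X.ε X.ε y)) (⊗-cong (X.identityˡ X.ε) Y.refl))))
      right : rational (ψ y) ≡ 0ℚ → _∼_ (L X) (L Y) t 𝟘
      right eq = ∼-trans t∼xy (∼-trans (⊗-cong X.refl (ψ-kernel y eq))
        (P.identityˡ-unique (x ⊗ Y.ε) (x ⊗ Y.ε)
          (∼-trans (∼-sym (⊗-distribˡ x Y.ε Y.ε)) (⊗-cong X.refl (Y.identityˡ Y.ε)))))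

  surjective : ∀ w → ∃[ t ] rational (⟦ μ ⟧ t) ≡ rational w
  surjective w = preimage (factorMultiplier a b w)
    where
    preimage : ∃[ u ] ∃[ v ] rational (multiplyMultipliers a b u v) ≡ rational w →
               ∃[ t ] rational (⟦ μ ⟧ t) ≡ rational w
    preimage (u , v , uv≡w) = proj₁ (φ-surjective u) ⊗ proj₁ (ψ-surjective v) ,
      ≡.trans (≡.cong₂ ℚ._*_ (proj₂ (φ-surjective u)) (proj₂ (ψ-surjective v))) uv≡w

  ξ-compatible : ∀ t → value (⟦ μ ⟧ t) ≈ᶻ ⟦ ξ (X ⊗ᵀ Y) ⟧ t
  ξ-compatible = tensor-hom-unique (L X) (L Y) Ẑ⁺
    (compose (tensorProduct (L X) (L Y)) Lab Ẑ⁺ μ (valueHom (a *ᶠ b))) (ξ (X ⊗ᵀ Y))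
    (λ x y → Ẑᴿ.*-cong (φ-ξ x) (ψ-ξ y))

  τ-pure : ∀ x y → ⟦ τ (D (a *ᶠ b , r *ʳ s)) ⟧ (β x y) ≈ʳ ⟦ τ X ⟧ x *ʳ ⟦ τ Y ⟧ y
  τ-pure x y = fromℚʳ-*-cong (rational (φ x)) (rational (ψ y)) r s (⟦ τ X ⟧ x) (⟦ τ Y ⟧ y)
                 (rational (β x y)) refl (φ-τ x) (ψ-τ y)

  extend-pure : ∀ (h : Hom Lab ℝ⁺) → (∀ x y → ⟦ h ⟧ (β x y) ≈ʳ ⟦ τ X ⟧ x *ʳ ⟦ τ Y ⟧ y) →
                ∀ t → ⟦ h ⟧ (⟦ μ ⟧ t) ≈ʳ ⟦ τ (X ⊗ᵀ Y) ⟧ t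
  extend-pure h = tensor-hom-unique (L X) (L Y) ℝ⁺
    (compose (tensorProduct (L X) (L Y)) Lab ℝ⁺ μ h) (τ (X ⊗ᵀ Y))

  represented : X ⊗ᵀ Y ≅ D (a *ᶠ b , r *ʳ s)
  represented = isomorphism (X ⊗ᵀ Y) (D (a *ᶠ b , r *ʳ s)) μ kernel surjective ξ-compatible
    (extend-pure (τ (D (a *ᶠ b , r *ʳ s))) τ-pure)

𝔸-* : ∀ a r b s → (a *ᶠ b , r *ʳ s) ≡ (a , r) 𝔸ᴿ.* (b , s)
𝔸-* a r b s = ≡.cong₂ _,_ finite infinite
  where
  finite : a *ᶠ b ≡ proj₁ ((a , r) 𝔸ᴿ.* (b , s))
  finite = refl
  infinite : r *ʳ s ≡ proj₂ ((a , r) 𝔸ᴿ.* (b , s))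
  infinite = refl

≅D-τ : ∀ {X} a r → (X≅D : X ≅ D (a , r)) → ∀ x → fromℚʳ (rational (_≅_.φ X≅D x)) *ʳ r ≈ʳ ⟦ τ X ⟧ x
≅D-τ a r X≅D = _≅_.τ-compatible X≅D

⊗-represent₀ : ∀ {X Y} a r b s → LocallyCyclic (L X) → LocallyCyclic (L Y) →
              X ≅ D (a , r) → Y ≅ D (b , s) → X ⊗ᵀ Y ≅ D (a *ᶠ b , r *ʳ s)
⊗-represent₀ {X} {Y} a r b s cyclicˣ cyclicʸ X≅Da Y≅Db =
    TensorCoordinates.represented {X} {Y} {a} {b} {r} {s} cyclicˣ cyclicʸ (_≅_.φ X≅Da) (_≅_.φ Y≅Db)
      I.isGroupHomomorphism J.isGroupHomomorphism I.kernel J.kernel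
      (λ u → I.φ⁻¹ u , I.φ-φ⁻¹ u) (λ v → J.φ⁻¹ v , J.φ-φ⁻¹ v)
      (_≅_.ξ-compatible X≅Da) (_≅_.ξ-compatible Y≅Db) (≅D-τ a r X≅Da) (≅D-τ b s Y≅Db)
  where
  module I = Isomorphism X≅Da
  module J = Isomorphism Y≅Db

-- Matching on the equation keeps D (a 𝔸ᴿ.* b) from being unfolded.
≅D-* : ∀ Z a b c → c ≡ a 𝔸ᴿ.* b → Z ≅ D c → Z ≅ D (a 𝔸ᴿ.* b)
≅D-* Z a b c refl Z≅Dc = Z≅Dc

-- Allowing `X` and `Y` to be merely isomorphic to `D a` and `D b` makes the lemma iterable: X ⊗ Y
-- is again represented, so nested tensor products reduce to products of adeles.
⊗-represent : ∀ {X Y} a b → LocallyCyclic (L X) → LocallyCyclic (L Y) →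
              X ≅ D a → Y ≅ D b → X ⊗ᵀ Y ≅ D (a 𝔸ᴿ.* b)
⊗-represent {X} {Y} (a , r) (b , s) cyclicˣ cyclicʸ X≅Da Y≅Db =
  ≅D-* (X ⊗ᵀ Y) (a , r) (b , s) (a *ᶠ b , r *ʳ s) (𝔸-* a r b s)
    (⊗-represent₀ {X} {Y} a r b s cyclicˣ cyclicʸ X≅Da Y≅Db)

-- The monoid ℚ^× ∖ 𝔸

ℚ-inverse : ∀ q → q ≢ 0ℚ → ∃[ q′ ] q′ ≢ 0ℚ × q ℚ.* q′ ≡ 1ℚ
ℚ-inverse q q≢0 = ℚ.1/ q , 1/q≢0 , ℚ.*-inverseʳ q
  where
  instance _ = ℚ.≢-nonZero q≢0
  1/q≢0 : ℚ.1/ q ≢ 0ℚ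
  1/q≢0 eq = q≢0 (≡.trans (≡.sym (ℚ.*-identityʳ q))
    (≡.trans (≡.cong (q ℚ.*_) (≡.trans (≡.sym (ℚ.*-inverseʳ q))
                                       (≡.trans (≡.cong (q ℚ.*_) eq) (ℚ.*-zeroʳ q))))
             (ℚ.*-zeroʳ q)))

ℚ-*-≢0 : ∀ {p q} → p ≢ 0ℚ → q ≢ 0ℚ → p ℚ.* q ≢ 0ℚ
ℚ-*-≢0 {p} {q} p≢0 q≢0 pq≡0 = [ p≢0 , q≢0 ]′ (p*q≡0⇒p≡0∨q≡0 p q pq≡0)

-- Since (δ p a)(δ q c) = δ (pq) (ac) in a commutative ring, multiplication descends to orbits of
-- the nonzero rationals. An abstract ring keeps the construction of the adeles out of the
-- calculation.
module Orbits (R : CommutativeRing 0ℓ 0ℓ) (δ : ℚ → CommutativeRing.Carrier R)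
  (δ-1 : CommutativeRing._≈_ R (δ 1ℚ) (CommutativeRing.1# R))
  (δ-* : ∀ p q → CommutativeRing._≈_ R (δ (p ℚ.* q)) (CommutativeRing._*_ R (δ p) (δ q))) where

  open CommutativeRing R hiding (refl; sym; trans)

  infix 4 _∼′_

  _∼′_ : Carrier → Carrier → Set
  a ∼′ b = ∃[ q ] q ≢ 0ℚ × δ q * a ≈ b

  open SetoidReasoning setoid
  open import Algebra.Properties.CommutativeSemigroup *-commutativeSemigroup using (interchange)

  δ-cong : ∀ {p q} → p ≡ q → δ p ≈ δ q
  δ-cong refl = CommutativeRing.refl R

  ≈⇒∼′ : ∀ {a b} → a ≈ b → a ∼′ b
  ≈⇒∼′ {a} {b} a≈b = 1ℚ , (λ ()) , (begin
    δ 1ℚ * a  ≈⟨ *-congʳ δ-1 ⟩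
    1# * a    ≈⟨ *-identityˡ a ⟩
    a         ≈⟨ a≈b ⟩
    b         ∎)

  ∼′-sym : ∀ {a b} → a ∼′ b → b ∼′ a
  ∼′-sym {a} {b} (q , q≢0 , qa≈b) = invert (ℚ-inverse q q≢0)
    where
    invert : ∃[ q′ ] q′ ≢ 0ℚ × q ℚ.* q′ ≡ 1ℚ → b ∼′ a
    invert (q′ , q′≢0 , qq′≡1) = q′ , q′≢0 , (begin
      δ q′ * b          ≈⟨ *-congˡ qa≈b ⟨
      δ q′ * (δ q * a)  ≈⟨ *-assoc (δ q′) (δ q) a ⟨
      (δ q′ * δ q) * a  ≈⟨ *-congʳ (δ-* q′ q) ⟨
      δ (q′ ℚ.* q) * a  ≈⟨ *-congʳ (δ-cong (≡.trans (ℚ.*-comm q′ q) qq′≡1)) ⟩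
      δ 1ℚ * a          ≈⟨ *-congʳ δ-1 ⟩
      1# * a            ≈⟨ *-identityˡ a ⟩
      a                 ∎)

  ∼′-trans : ∀ {a b c} → a ∼′ b → b ∼′ c → a ∼′ c
  ∼′-trans {a} {b} {c} (p , p≢0 , pa≈b) (q , q≢0 , qb≈c) = q ℚ.* p , ℚ-*-≢0 q≢0 p≢0 , (begin
    δ (q ℚ.* p) * a  ≈⟨ *-congʳ (δ-* q p) ⟩
    (δ q * δ p) * a  ≈⟨ *-assoc (δ q) (δ p) a ⟩
    δ q * (δ p * a)  ≈⟨ *-congˡ pa≈b ⟩
    δ q * b          ≈⟨ qb≈c ⟩
    c                ∎)

  ∼′-*-cong : ∀ {a b c d} → a ∼′ b → c ∼′ d → a * c ∼′ b * d
  ∼′-*-cong {a} {b} {c} {d} (p , p≢0 , pa≈b) (q , q≢0 , qc≈d) = p ℚ.* q , ℚ-*-≢0 p≢0 q≢0 , (begin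
    δ (p ℚ.* q) * (a * c)    ≈⟨ *-congʳ (δ-* p q) ⟩
    (δ p * δ q) * (a * c)    ≈⟨ interchange (δ p) (δ q) a c ⟩
    (δ p * a) * (δ q * c)    ≈⟨ *-cong pa≈b qc≈d ⟩
    b * d                    ∎)

  isCommutativeMonoid : IsCommutativeMonoid _∼′_ _*_ 1#
  isCommutativeMonoid = record
    { isMonoid = record
      { isSemigroup = record
        { isMagma = record
          { isEquivalence = record
            { refl  = ≈⇒∼′ (CommutativeRing.refl R)
            ; sym   = ∼′-sym
            ; trans = ∼′-trans
            }
          ; ∙-cong = ∼′-*-cong
          }
        ; assoc = λ a b c → ≈⇒∼′ (*-assoc a b c)
        }
      ; identity = (λ a → ≈⇒∼′ (*-identityˡ a)) , (λ a → ≈⇒∼′ (*-identityʳ a))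
      }
    ; comm = λ a b → ≈⇒∼′ (*-comm a b)
    }

diagonal-1 : diagonal 1ℚ 𝔸ᴿ.≈ 𝔸ᴿ.1#
diagonal-1 = 𝔸ᶠᴿ.refl , ℝᴿ.refl

diagonal-* : ∀ p q → diagonal (p ℚ.* q) 𝔸ᴿ.≈ diagonal p 𝔸ᴿ.* diagonal q
diagonal-* p q = fromℚᶠ-* p q , termwise λ _ → refl

Yℚ-laws : SatisfiesCommutativeMonoidLaws Yℚ
Yℚ-laws = Orbits.isCommutativeMonoid 𝔸-commutativeRing diagonal diagonal-1 diagonal-*

integral-cong : ∀ {x y} → x ≈ᶻ y → integral x ≈ᶠ integral y
integral-cong {x} {y} x≈y = mk≈ (mk≈ λ n → mod-* (mod-reflexive {i = 1ℤ} refl) (cong-mod x≈y n))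

-- D respects the action of ℚ^×

fromℚʳ-rescale : ∀ x q q′ r s w → w ≡ x ℚ.* q′ → q ℚ.* q′ ≡ 1ℚ → fromℚʳ q *ʳ r ≈ʳ s →
                 fromℚʳ w *ʳ s ≈ʳ fromℚʳ x *ʳ r
fromℚʳ-rescale x q q′ r s w refl qq′≡1 qr≈s =
  ≈ʳ-trans {fromℚʳ (x ℚ.* q′) *ʳ s} {fromℚʳ (x ℚ.* q′) *ʳ (fromℚʳ q *ʳ r)} {fromℚʳ x *ʳ r}
    (ℝᴿ.*-cong {fromℚʳ (x ℚ.* q′)} {fromℚʳ (x ℚ.* q′)} {s} {fromℚʳ q *ʳ r}
      (≈ʳ-refl {fromℚʳ (x ℚ.* q′)}) (≈ʳ-sym {fromℚʳ q *ʳ r} {s} qr≈s))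
    (termwise {fromℚʳ (x ℚ.* q′) *ʳ (fromℚʳ q *ʳ r)} {fromℚʳ x *ʳ r} λ n → cancel (seq r n))
  where
  open ≡.≡-Reasoning
  cancel : ∀ c → (x ℚ.* q′) ℚ.* (q ℚ.* c) ≡ x ℚ.* c
  cancel c = begin
    (x ℚ.* q′) ℚ.* (q ℚ.* c)  ≡⟨ solve 4 (λ x q′ q c →
                                   (x :* q′) :* (q :* c) := x :* ((q :* q′) :* c))
                                   refl x q′ q c ⟩
    x ℚ.* ((q ℚ.* q′) ℚ.* c)  ≡⟨ ≡.cong (λ u → x ℚ.* (u ℚ.* c)) qq′≡1 ⟩
    x ℚ.* (1ℚ ℚ.* c)          ≡⟨ ≡.cong (x ℚ.*_) (ℚ.*-identityˡ c) ⟩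
    x ℚ.* c                   ∎
    where open ℚ-Solver

rescaleMultiplier : ∀ {a b} q q′ → q ℚ.* q′ ≡ 1ℚ → fromℚᶠ q *ᶠ a ≈ᶠ b → Multiplier a → Multiplier b
rescaleMultiplier {a} {b} q q′ qq′≡1 qa≈b x = multiplier (rational x ℚ.* q′) (value x) (begin
  fromℚᶠ (rational x ℚ.* q′) *ᶠ b
    ≈⟨ R.*-cong (fromℚᶠ-* (rational x) q′) (R.sym qa≈b) ⟩
  (fx *ᶠ fromℚᶠ q′) *ᶠ (fromℚᶠ q *ᶠ a)
    ≈⟨ R.*-assoc fx (fromℚᶠ q′) (fromℚᶠ q *ᶠ a) ⟩
  fx *ᶠ (fromℚᶠ q′ *ᶠ (fromℚᶠ q *ᶠ a))
    ≈⟨ R.*-congˡ {fx} (R.*-assoc (fromℚᶠ q′) (fromℚᶠ q) a) ⟨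
  fx *ᶠ ((fromℚᶠ q′ *ᶠ fromℚᶠ q) *ᶠ a)
    ≈⟨ R.*-congˡ {fx} (R.*-congʳ {a} (fromℚᶠ-* q′ q)) ⟨
  fx *ᶠ (fromℚᶠ (q′ ℚ.* q) *ᶠ a)
    ≈⟨ R.*-congˡ {fx} (R.*-congʳ {a} (fromℚᶠ-cong (≡.trans (ℚ.*-comm q′ q) qq′≡1))) ⟩
  fx *ᶠ (1ᶠ *ᶠ a)
    ≈⟨ R.*-congˡ {fx} (R.*-identityˡ a) ⟩
  fx *ᶠ a
    ≈⟨ is-value x ⟩
  integral (value x) ∎)
  where
  module R = 𝔸ᶠᴿ
  open SetoidReasoning R.setoid
  fx = fromℚᶠ (rational x)

unscaleMultiplier : ∀ {a b} q → fromℚᶠ q *ᶠ a ≈ᶠ b → Multiplier b → Multiplier a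
unscaleMultiplier {a} {b} q qa≈b y = multiplier (rational y ℚ.* q) (value y) (begin
  fromℚᶠ (rational y ℚ.* q) *ᶠ a    ≈⟨ R.*-congʳ {a} (fromℚᶠ-* (rational y) q) ⟩
  (fy *ᶠ fromℚᶠ q) *ᶠ a             ≈⟨ R.*-assoc fy (fromℚᶠ q) a ⟩
  fy *ᶠ (fromℚᶠ q *ᶠ a)             ≈⟨ R.*-congˡ {fy} qa≈b ⟩
  fy *ᶠ b                           ≈⟨ is-value y ⟩
  integral (value y)                ∎)
  where
  module R = 𝔸ᶠᴿ
  open SetoidReasoning R.setoid
  fy = fromℚᶠ (rational y)

-- The isomorphism is x ↦ x q′ with q′ = 1 / q; it preserves ξ and τ because (x q′)(q a) = x a at
-- both the finite and the infinite place.
D-rescale : ∀ a r b s q q′ → q′ ≢ 0ℚ → q ℚ.* q′ ≡ 1ℚ →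
            fromℚᶠ q *ᶠ a ≈ᶠ b → fromℚʳ q *ʳ r ≈ʳ s → D (a , r) ≅ D (b , s)
D-rescale a r b s q q′ q′≢0 qq′≡1 qa≈b qr≈s =
  isomorphism (D (a , r)) (D (b , s)) f kernel surjective (λ _ → Ẑᴿ.refl) τ-compatible
  where
  f : Hom (multipliers a) (multipliers b)
  f = additive (multipliers a) (multipliers b) (rescaleMultiplier {a} {b} q q′ qq′≡1 qa≈b)
    (≡.cong (ℚ._* q′)) (λ x y → ℚ.*-distribʳ-+ q′ (rational x) (rational y))
  kernel : ∀ x → rational x ℚ.* q′ ≡ 0ℚ → rational x ≡ 0ℚ
  kernel x eq = [ (λ x≡0 → x≡0) , (λ q′≡0 → contradiction q′≡0 q′≢0) ]′
    (p*q≡0⇒p≡0∨q≡0 (rational x) q′ eq)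
  surjective : ∀ (y : Multiplier b) → ∃[ x ] rational (⟦ f ⟧ x) ≡ rational y
  surjective y = unscaleMultiplier {a} {b} q qa≈b y ,
    ≡.trans (ℚ.*-assoc (rational y) q q′)
    (≡.trans (≡.cong (rational y ℚ.*_) qq′≡1) (ℚ.*-identityʳ (rational y)))
  τ-compatible : ∀ x → ⟦ τ (D (b , s)) ⟧ (⟦ f ⟧ x) ≈ʳ ⟦ τ (D (a , r)) ⟧ x
  τ-compatible x = fromℚʳ-rescale (rational x) q q′ r s (rational (⟦ f ⟧ x)) refl qq′≡1 qr≈s

scaled-finite : ∀ q a r b s → diagonal q 𝔸ᴿ.* (a , r) 𝔸ᴿ.≈ (b , s) → fromℚᶠ q *ᶠ a ≈ᶠ b
scaled-finite q a r b s (eq , _) = eq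

scaled-infinite : ∀ q a r b s → diagonal q 𝔸ᴿ.* (a , r) 𝔸ᴿ.≈ (b , s) → fromℚʳ q *ʳ r ≈ʳ s
scaled-infinite q a r b s (_ , mk≈ p) = mk≈ p

D-cong : ∀ a b → RawMonoid._≈_ Yℚ a b → D a ≅ D b
D-cong (a , r) (b , s) (q , q≢0 , qa≈b) = rescale (ℚ-inverse q q≢0)
  where
  rescale : ∃[ q′ ] q′ ≢ 0ℚ × q ℚ.* q′ ≡ 1ℚ → D (a , r) ≅ D (b , s)
  rescale (q′ , q′≢0 , qq′≡1) = D-rescale a r b s q q′ q′≢0 qq′≡1
    (scaled-finite q a r b s qa≈b) (scaled-infinite q a r b s qa≈b)

nonzeroMultiplier : ∀ a → ∃[ u ] rational {a} u ≢ 0ℚ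
nonzeroMultiplier (x ÷ d) = denominatorMultiplier x d , fromℤ-≢0 (nonZero⇒≢0 d)

module Yℚ = RawMonoid Yℚ

orbit : ∀ q a r b s → q ≢ 0ℚ → fromℚᶠ q *ᶠ a ≈ᶠ b → fromℚʳ q *ʳ r ≈ʳ s → (a , r) Yℚ.≈ (b , s)
orbit q a r b s q≢0 qa≈b (mk≈ p) = q , q≢0 , qa≈b , mk≈ p

orbit-join : ∀ a b c → a Yℚ.≈ c → b Yℚ.≈ c → a Yℚ.≈ b
orbit-join a b c a∼c b∼c = E.trans {a} {c} {b} a∼c (E.sym {b} {c} b∼c)
  where module E = IsCommutativeMonoid Yℚ-laws

-- For u ≠ 0 in L_a with image v in L_b, both a and b lie in the orbit of (v b_f, v b_∞).
D-injective : ∀ a r b s → D (a , r) ≅ D (b , s) → (a , r) Yℚ.≈ (b , s)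
D-injective a r b s Da≅Db = common (nonzeroMultiplier a)
  where
  module I = Isomorphism Da≅Db
  common : ∃[ u ] rational {a} u ≢ 0ℚ → (a , r) Yℚ.≈ (b , s)
  common (u , u≢0) = from-image (_≅_.φ Da≅Db u) (λ v≡0 → u≢0 (I.kernel u v≡0))
                                (_≅_.ξ-compatible Da≅Db u) (_≅_.τ-compatible Da≅Db u)
    where
    from-image : (v : Multiplier b) → rational v ≢ 0ℚ → value v ≈ᶻ value u →
                 fromℚʳ (rational v) *ʳ s ≈ʳ fromℚʳ (rational u) *ʳ r → (a , r) Yℚ.≈ (b , s)
    from-image v v≢0 ξ-eq τ-eq = orbit-join (a , r) (b , s)
      (integral (value v) , fromℚʳ (rational v) *ʳ s)
      (orbit (rational u) a r (integral (value v)) (fromℚʳ (rational v) *ʳ s) u≢0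
        (𝔸ᶠᴿ.trans (is-value u) (integral-cong {value u} {value v} (Ẑᴿ.sym ξ-eq)))
        (≈ʳ-sym {fromℚʳ (rational v) *ʳ s} {fromℚʳ (rational u) *ʳ r} τ-eq))
      (orbit (rational v) b s (integral (value v)) (fromℚʳ (rational v) *ʳ s) v≢0
        (is-value v) (≈ʳ-refl {fromℚʳ (rational v) *ʳ s}))

-- Compactness of Ẑ

module _ (excludedMiddle : ExcludedMiddle 0ℓ)
         (P : ∀ n .{{_ : ℕ.NonZero n}} → ℤ → Set)
         (restrict : ∀ m n c .{{_ : ℕ.NonZero m}} .{{_ : ℕ.NonZero n}} → m ℕ∣.∣ n → P n c → P m c)
         (respects : ∀ n c d .{{_ : ℕ.NonZero n}} → c ≡ d mod n → P n c → P n d)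
         (solvable : ∀ n .{{_ : ℕ.NonZero n}} → ∃[ c ] P n c) where

  private
    -- The factorials form a chain under divisibility and every n ≥ 1 divides one of them, so the
    -- limit over all n can be taken along a sequence.
    P! : ℕ → ℤ → Set
    P! k = P (k !) {{k ℕ.!≢0}}

    solvable! : ∀ k → ∃[ c ] P! k c
    solvable! k = solvable (k !) {{k ℕ.!≢0}}

    Solution : ℕ → ℤ → ℕ → Set
    Solution k c j = ∃[ d ] d ≡ c mod (k !) × P! j d

    -- The invariant of König's lemma: the residue c modulo k! has solutions of every level j above
    -- it. A solution at level k alone could turn out to be a dead end.
    Extendable : ℕ → ℤ → Set
    Extendable k c = ∀ j → Solution k c j

    byContradiction : ∀ {A : Set} → (¬ A → ⊥) → A
    byContradiction {A} ¬¬a = decidable-stable (excludedMiddle {A}) ¬¬a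

    obstruction : ∀ k c → ¬ Extendable k c → ∃[ j ] ¬ Solution k c j
    obstruction k c ¬extendable = byContradiction λ none →
      ¬extendable λ j → byContradiction λ ¬solution → none (j , ¬solution)

    obstruction-mono : ∀ k c {i j} → i ℕ.≤ j → ¬ Solution k c i → ¬ Solution k c j
    obstruction-mono k c {i} {j} i≤j ¬solution (d , d≡c , Pd) =
      ¬solution (d , d≡c , restrict (i !) (j !) d {{i ℕ.!≢0}} {{j ℕ.!≢0}} (ℕ∣.m≤n⇒m!∣n! i≤j) Pd)

    common-bound : ∀ (Q : ℕ → ℕ → Set) → (∀ i {j j′} → j ℕ.≤ j′ → Q i j → Q i j′) →
                   ∀ n → (∀ i → ∃[ j ] Q i j) → ∃[ j ] (∀ i → i ℕ.< n → Q i j)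
    common-bound Q mono zero    bound = 0 , λ _ ()
    common-bound Q mono (suc n) bound with common-bound Q mono n bound | bound n
    ... | j , below | j′ , Qnj′ = j ℕ.⊔ j′ , λ i i<1+n → case i i<1+n
      where
      case : ∀ i → i ℕ.< suc n → Q i (j ℕ.⊔ j′)
      case i (ℕ.s≤s i≤n) with i ℕ.≟ n
      ... | yes refl = mono i (ℕ.m≤n⊔m j j′) Qnj′
      ... | no  i≢n  = mono i (ℕ.m≤m⊔n j j′) (below i (ℕ.≤∧≢⇒< i≤n i≢n))

    -- One step of a factorial-base expansion: for i = 0, ..., k these represent all lifts of c from
    -- modulus k! to modulus (k + 1)!.
    digit : ∀ k c i → ℤ
    digit k c i = c ℤ.+ + i ℤ.* + (k !)

    next-digit : ∀ k c d → d ≡ c mod (k !) →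
                 ∃[ i ] i ℕ.< suc k × d ≡ digit k c i mod (suc k !)
    next-digit k c d (mkmod (divides t d-c≡tk!)) =
      -- The digit is t = (d - c) / k! reduced modulo k + 1.
      t ℤ.%ℕ suc k , ℤ.n%ℕd<d t (suc k) , mkmod (divides (t ℤ./ℕ suc k) (begin
        d ℤ.- (c ℤ.+ i ℤ.* F)                 ≡⟨ solve 4 (λ d c i F →
                                                   d :- (c :+ i :* F) := (d :- c) :- i :* F)
                                                   refl d c i F ⟩
        (d ℤ.- c) ℤ.- i ℤ.* F                 ≡⟨ ≡.cong (λ u → u ℤ.- i ℤ.* F) d-c≡tk! ⟩
        t ℤ.* F ℤ.- i ℤ.* F                   ≡⟨ ≡.cong (λ u → u ℤ.* F ℤ.- i ℤ.* F)
                                                        (ℤ.a≡a%ℕn+[a/ℕn]*n t (suc k)) ⟩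
        (i ℤ.+ w ℤ.* n) ℤ.* F ℤ.- i ℤ.* F     ≡⟨ solve 4 (λ i w n F →
                                                   (i :+ w :* n) :* F :- i :* F := w :* (n :* F))
                                                   refl i w n F ⟩
        w ℤ.* (n ℤ.* F)                       ≡⟨ ≡.cong (w ℤ.*_) (ℤ.pos-* (suc k) (k !)) ⟨
        w ℤ.* + (suc k !)                     ∎))
      where
      open ≡.≡-Reasoning
      open ℤ-Solver
      i = + (t ℤ.%ℕ suc k)
      w = t ℤ./ℕ suc k
      n = + suc k
      F = + (k !)

    -- Only finitely many digits are available, so if none of them were extendable
    -- then c itself would be obstructed at a common level.
    extend-digit : ∀ k c → Extendable k c → ∃[ i ] Extendable (suc k) (digit k c i)
    extend-digit k c extendable = byContradiction λ none → all-obstructed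
      (common-bound (λ i j → ¬ Solution (suc k) (digit k c i) j)
        (λ i → obstruction-mono (suc k) (digit k c i)) (suc k)
        (λ i → obstruction (suc k) (digit k c i) (λ extended → none (i , extended))))
      where
      all-obstructed : ∃[ j ] (∀ i → i ℕ.< suc k → ¬ Solution (suc k) (digit k c i) j) → ⊥
      all-obstructed (j , obstructed) =
        let (d , d≡c , Pd) = extendable j
            (i , i<1+k , d≡digit) = next-digit k c d d≡c
        in obstructed i i<1+k (d , d≡digit , Pd)

    approximation : ∀ k → ∃[ c ] Extendable k c
    -- The modulus 0! is 1, so every solution lies above 0.
    approximation zero    = 0ℤ , λ j → let (d , Pd) = solvable! j in
      d , mkmod (divides (d ℤ.- 0ℤ) (≡.sym (ℤ.*-identityʳ (d ℤ.- 0ℤ)))) , Pd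
    approximation (suc k) = let (c , extendable) = approximation k
                                (i , extended) = extend-digit k c extendable
                            in digit k c i , extended

    approx : ℕ → ℤ
    approx k = proj₁ (approximation k)

    digit-mod : ∀ k c i → digit k c i ≡ c mod (k !)
    digit-mod k c i = mkmod (divides (+ i)
      (solve 3 (λ c i F → (c :+ i :* F) :- c := i :* F) refl c (+ i) (+ (k !))))
      where open ℤ-Solver

    approx-coherent : ∀ {m n} → m ℕ.≤′ n → approx n ≡ approx m mod (m !)
    approx-coherent ℕ.≤′-refl = mod-reflexive refl
    approx-coherent {m} {suc n} (ℕ.≤′-step m≤n) = mod-trans
      (mod-weaken (ℕ∣.m≤n⇒m!∣n! (ℕ.≤′⇒≤ m≤n)) 
        (digit-mod n (approx n) (proj₁ (extend-digit n (approx n) (proj₂ (approximation n))))))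
      (approx-coherent m≤n)

    n∣n! : ∀ n .{{_ : ℕ.NonZero n}} → n ℕ∣.∣ n !
    n∣n! (suc n) = ℕ∣.m∣m*n (n !)

  Ẑ-compact : ∃[ c ] (∀ n .{{_ : ℕ.NonZero n}} → P n (res c n))
  Ẑ-compact = mkẐ (λ n → approx n) (λ {m} {n} m∣n →
      mod-weaken (n∣n! m) (approx-coherent (ℕ.≤⇒≤′ (ℕ∣.∣⇒≤ m∣n))))
    , solved
    where
    solved : ∀ n .{{_ : ℕ.NonZero n}} → P n (approx n)
    -- Extendability of stage n is used at level n itself: it gives a genuine solution d modulo n!
    -- congruent to the approximation, and n divides n!.
    solved n = let (d , d≡c , Pd) = proj₂ (approximation n) n in
      respects n d (approx n) (mod-weaken (n∣n! n) d≡c)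
        (restrict n (n !) d {{_}} {{n ℕ.!≢0}} (n∣n! n) Pd)

-- Framedness of D_a

scaleHom : ∀ A → Ẑ → Hom A Ẑ⁺ → Hom A Ẑ⁺
scaleHom A c h = additive A Ẑ⁺ (λ x → c *ᶻ ⟦ h ⟧ x)
  (λ eq → Ẑᴿ.*-congˡ {c} (GroupHomomorphism.⟦⟧-cong h eq))
  (λ x y → Ẑᴿ.trans (Ẑᴿ.*-congˡ {c} (GroupHomomorphism.homo h x y))
                    (Ẑᴿ.distribˡ c (⟦ h ⟧ x) (⟦ h ⟧ y)))

-- By compactness it is enough to solve c x ≡ y modulo each n. Let g = s x + t n be the gcd of n and
-- the residue of x. Then g divides x in Ẑ, hence y = g w by hypothesis, and c = s w is a solution.
Ẑ-divisible : ExcludedMiddle 0ℓ → ∀ x y →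
  (∀ n .{{_ : ℕ.NonZero n}} g z → g ℤ∣.∣ + n → x ≈ᶻ ι g *ᶻ z → ∃[ w ] y ≈ᶻ ι g *ᶻ w) →
  ∃[ c ] y ≈ᶻ c *ᶻ x
Ẑ-divisible excludedMiddle x y divisors = conclude
  (Ẑ-compact excludedMiddle (λ n c → c ℤ.* res x n ≡ res y n mod n) restrict respects solvable)
  where
  restrict : ∀ m n c .{{_ : ℕ.NonZero m}} .{{_ : ℕ.NonZero n}} → m ℕ∣.∣ n →
             c ℤ.* res x n ≡ res y n mod n → c ℤ.* res x m ≡ res y m mod m
  restrict m n c m∣n eq = mod-trans (mod-* (mod-reflexive {i = c} refl) (mod-sym (coherent x m∣n)))
    (mod-trans (mod-weaken m∣n eq) (coherent y m∣n))
  respects : ∀ n c d .{{_ : ℕ.NonZero n}} → c ≡ d mod n →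
             c ℤ.* res x n ≡ res y n mod n → d ℤ.* res x n ≡ res y n mod n
  respects n c d c≡d eq = mod-trans (mod-* (mod-sym c≡d) (mod-reflexive {i = res x n} refl)) eq
  solvable : ∀ n .{{_ : ℕ.NonZero n}} → ∃[ c ] c ℤ.* res x n ≡ res y n mod n
  solvable n = solve-mod (bézout (res x n) (+ n))
    where
    solve-mod : ∃[ g ] g ℤ∣.∣ res x n × g ℤ∣.∣ + n × ∃[ s ] ∃[ t ] s ℤ.* res x n ℤ.+ t ℤ.* + n ≡ g →
                ∃[ c ] c ℤ.* res x n ≡ res y n mod n
    solve-mod (g , g∣x , g∣n , s , t , eq) = from-quotients (Ẑ-divide n g x g∣n g∣x)
      where
      from-quotients : ∃[ z ] x ≈ᶻ ι g *ᶻ z → ∃[ c ] c ℤ.* res x n ≡ res y n mod n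
      from-quotients (z , x≈gz) = quotient (divisors n g z g∣n x≈gz)
        where
        open ℤ-Solver
        quotient : ∃[ w ] y ≈ᶻ ι g *ᶻ w → ∃[ c ] c ℤ.* res x n ≡ res y n mod n
        quotient (w , y≈gw) = s ℤ.* res w n ,
          mod-trans (mkmod (divides (ℤ.- (t ℤ.* res w n)) (begin
            s ℤ.* w′ ℤ.* x′ ℤ.- g ℤ.* w′
              ≡⟨ ≡.cong (λ u → s ℤ.* w′ ℤ.* x′ ℤ.- u ℤ.* w′) eq ⟨
            s ℤ.* w′ ℤ.* x′ ℤ.- (s ℤ.* x′ ℤ.+ t ℤ.* + n) ℤ.* w′
              ≡⟨ solve 5 (λ s w x t n →
                     s :* w :* x :- (s :* x :+ t :* n) :* w := (:- (t :* w)) :* n)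
                   refl s w′ x′ t (+ n) ⟩
            ℤ.- (t ℤ.* w′) ℤ.* + n ∎)))
          (mod-sym (cong-mod y≈gw n))
          where
          open ≡.≡-Reasoning
          w′ = res w n
          x′ = res x n
  conclude : ∃[ c ] (∀ n .{{_ : ℕ.NonZero n}} → res c n ℤ.* res x n ≡ res y n mod n) →
             ∃[ c ] y ≈ᶻ c *ᶻ x
  conclude (c , cx≡y) = c , mk≈ λ n → mod-sym (cx≡y n)

-- By `hom-unique` only the base element d of L_a with a = x / d matters, and ξ takes the value x
-- there. If x = g z, then d / g also lies in L_a, so g divides h(d); `Ẑ-divisible` then gives h(d)
-- = c x.
D-generates : ExcludedMiddle 0ℓ → ∀ a → Generates (multipliers a) (valueHom a)
D-generates excludedMiddle a@(x ÷ d) h =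
  conclude (Ẑ-divisible excludedMiddle x (⟦ h ⟧ base) divisors)
  where
  base : Multiplier a
  base = denominatorMultiplier x d
  divisors : ∀ n .{{_ : ℕ.NonZero n}} g z → g ℤ∣.∣ + n → x ≈ᶻ ι g *ᶻ z →
             ∃[ w ] ⟦ h ⟧ base ≈ᶻ ι g *ᶻ w
  divisors n g z g∣n x≈gz = quotient (ratio d g≢0)
    where
    g≢0 = ∣-nonZero n g∣n
    quotient : ∃[ q ] fromℤ g ℚ.* q ≡ fromℤ d → ∃[ w ] ⟦ h ⟧ base ≈ᶻ ι g *ᶻ w
    quotient (q , gq≡d) = ⟦ h ⟧ u , Ẑᴿ.trans (GroupHomomorphism.⟦⟧-cong h {base} {g·u} base≡g·u)
      (Ẑᴿ.trans (·-homo (multipliers a) Ẑ⁺ h g u) (Ẑ-· g (⟦ h ⟧ u)))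
      where
      u : Multiplier a
      u = multiplier q z (multiplierOfRatio d x d g≢0 z (scale-relation₁ g d x z x≈gz) q gq≡d)
      g·u = _·_ (multipliers a) g u
      base≡g·u : rational base ≡ rational g·u
      base≡g·u = ≡.sym (≡.trans (rational-· a g u) gq≡d)
  conclude : ∃[ c ] ⟦ h ⟧ base ≈ᶻ c *ᶻ x → ∃[ c ] (∀ q → ⟦ h ⟧ q ≈ᶻ c *ᶻ value q)
  conclude (c , eq) = c , hom-unique (multipliers a) Ẑ⁺ Ẑ-torsionFree (multipliers-rankOne a)
    h (scaleHom (multipliers a) c (valueHom a)) eq

D-framed : ExcludedMiddle 0ℓ → ∀ a → IsFramed (D a)
D-framed excludedMiddle (a , r) = record
  { torsionFree = multipliers-torsionFree a
  ; rankOne     = multipliers-rankOne a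
  ; generates   = D-generates excludedMiddle a
  }

-- Integer divisors of an element

module Divisors (A : Ab) (cyclic : LocallyCyclic A) (e : ∣ A ∣)
                (independent : Multiples.Independent A e) where

  open AbelianGroup A renaming (refl to ≈-refl; sym to ≈-sym; trans to ≈-trans)
  open Multiples A
  open SetoidReasoning setoid

  Divisor : ℤ → Set
  Divisor n = ∃[ y ] n ∗ y ≈ e

  divisor-∣ : ∀ m n → m ℤ∣.∣ n → Divisor n → Divisor m
  divisor-∣ m n (divides q n≡qm) (y , ny≈e) = q ∗ y , (begin
    m ∗ q ∗ y        ≈⟨ ∗-assoc m q y ⟨
    (m ℤ.* q) ∗ y    ≈⟨ ∗-congʳ y (≡.trans (ℤ.*-comm m q) (≡.sym n≡qm)) ⟩
    n ∗ y            ≈⟨ ny≈e ⟩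
    e                ∎)

  divisor-of-base : ∀ {u} b → e ≈ b ∗ u → Divisor b
  divisor-of-base {u} b e≈bu = u , ≈-sym e≈bu

  generator-independent : ∀ {u b} → e ≈ b ∗ u → Independent u
  generator-independent {u} {b} e≈bu n nu≈ε = independent n (begin
    n ∗ e        ≈⟨ ∗-congˡ n e≈bu ⟩
    n ∗ b ∗ u    ≈⟨ ∗-swap n b u ⟩
    b ∗ n ∗ u    ≈⟨ ∗-congˡ b nu≈ε ⟩
    b ∗ ε        ≈⟨ ∗-ε b ⟩
    ε            ∎)

  coefficient-≢0 : ∀ {u b} → e ≈ b ∗ u → b ≢ 0ℤ
  coefficient-≢0 e≈bu refl with () ← independent 1ℤ (≈-trans (1∗ e) e≈bu)

  -- If e / m and e / n are the multiples p u and q u of one element u, then e = k u with k = m p =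
  -- n q, the two products agreeing by independence. So a common multiple of m and n divides `e`,
  -- and with it the lcm.
  divisor-lcm : ∀ m n → Divisor (+ m) → Divisor (+ n) → Divisor (+ ℕ.lcm m n)
  divisor-lcm m n (y , my≈e) (z , nz≈e) = common (cyclic y z)
    where
    common : ∃[ u ] ∃[ p ] ∃[ q ] y ≈ p ∗ u × z ≈ q ∗ u → Divisor (+ ℕ.lcm m n)
    common (u , p , q , y≈pu , z≈qu) = divisor-∣ (+ ℕ.lcm m n) k (ℤ∣.∣ᵤ⇒∣ {+ ℕ.lcm m n} {k}
        (ℕ.lcm-least (ℤ∣.∣⇒∣ᵤ {+ m} {k} (divides p (ℤ.*-comm (+ m) p)))
                     (ℤ∣.∣⇒∣ᵤ {+ n} {k} (divides q (≡.trans k≡nq (ℤ.*-comm (+ n) q))))))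
        (u , ≈-sym e≈ku)
      where
      k = + m ℤ.* p
      e≈ku : e ≈ k ∗ u
      e≈ku = begin
        e              ≈⟨ my≈e ⟨
        (+ m) ∗ y        ≈⟨ ∗-congˡ (+ m) y≈pu ⟩
        (+ m) ∗ p ∗ u    ≈⟨ ∗-assoc (+ m) p u ⟨
        k ∗ u          ∎
      k≡nq : k ≡ + n ℤ.* q
      k≡nq = independent-injective (generator-independent {u} {k} e≈ku) k (+ n ℤ.* q) (begin
        k ∗ u            ≈⟨ e≈ku ⟨
        e                ≈⟨ nz≈e ⟨
        (+ n) ∗ z          ≈⟨ ∗-congˡ (+ n) z≈qu ⟩
        (+ n) ∗ q ∗ u      ≈⟨ ∗-assoc (+ n) q u ⟨
        (+ n ℤ.* q) ∗ u  ∎)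

  module _ (excludedMiddle : ExcludedMiddle 0ℓ) where

    -- The lcm of all divisors of M up to k that divide `e` again has both properties; excluded
    -- middle decides whether k + 1 joins the list. For k = M all divisors of M are covered when M ≠
    -- 0.
    greatestDivisor : ∀ M k → ∃[ g ] g ℕ∣.∣ M × Divisor (+ g) ×
                      (∀ n → n ℕ.≤ k → n ℕ∣.∣ M → Divisor (+ n) → n ℕ∣.∣ g)
    -- The only candidate n ≤ 0 is zero, and zero does not divide `e`, since an independent element
    -- is nonzero.
    greatestDivisor M zero    = 1 , ℕ∣.1∣ M , (e , 1∗ e) , λ { zero _ _ div → contradiction-0 div }
      where
      contradiction-0 : Divisor 0ℤ → 0 ℕ∣.∣ 1
      contradiction-0 (y , 0≈e) with () ← independent 1ℤ (≈-trans (1∗ e) (≈-sym 0≈e))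
    greatestDivisor M (suc k) = step (greatestDivisor M k) excludedMiddle
      where
      step : ∃[ g ] g ℕ∣.∣ M × Divisor (+ g) ×
               (∀ n → n ℕ.≤ k → n ℕ∣.∣ M → Divisor (+ n) → n ℕ∣.∣ g) →
             Dec (suc k ℕ∣.∣ M × Divisor (+ suc k)) →
             ∃[ g ] g ℕ∣.∣ M × Divisor (+ g) ×
               (∀ n → n ℕ.≤ suc k → n ℕ∣.∣ M → Divisor (+ n) → n ℕ∣.∣ g)
      step (g , g∣M , div-g , greatest) (yes (k∣M , div-k)) =
        ℕ.lcm g (suc k) , ℕ.lcm-least g∣M k∣M , divisor-lcm g (suc k) div-g div-k , greatest′
        where
        greatest′ : ∀ n → n ℕ.≤ suc k → n ℕ∣.∣ M → Divisor (+ n) → n ℕ∣.∣ ℕ.lcm g (suc k)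
        greatest′ n n≤1+k n∣M div with n ℕ.≟ suc k
        ... | yes refl = ℕ.n∣lcm[m,n] g (suc k)
        ... | no  n≢   = ℕ∣.∣-trans (greatest n (ℕ.≤-pred (ℕ.≤∧≢⇒< n≤1+k n≢)) n∣M div)
                                    (ℕ.m∣lcm[m,n] g (suc k))
      step (g , g∣M , div-g , greatest) (no ¬k) = g , g∣M , div-g , greatest′
        where
        greatest′ : ∀ n → n ℕ.≤ suc k → n ℕ∣.∣ M → Divisor (+ n) → n ℕ∣.∣ g
        greatest′ n n≤1+k n∣M div with n ℕ.≟ suc k
        ... | yes refl = ⊥-elim (¬k (n∣M , div))
        ... | no  n≢   = greatest n (ℕ.≤-pred (ℕ.≤∧≢⇒< n≤1+k n≢)) n∣M div

    -- The integers dividing `e` describe a supernatural number, the characteristic of `e` in Baer's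
    -- theory of rank one groups; x realises it in Ẑ. At level M the solution is the greatest
    -- divisor of M that divides `e`. Only divisors of M are tested there, because divisibility by
    -- these depends on the residue alone.
    divisorElement : ∃[ x ] (∀ n .{{_ : ℕ.NonZero n}} →
                     (+ n ℤ∣.∣ res x n → Divisor (+ n)) × (Divisor (+ n) → + n ℤ∣.∣ res x n))
    divisorElement = diagonalise (Ẑ-compact excludedMiddle SameDivisors restrict respects solvable)
      where
      SameDivisors : ∀ M .{{_ : ℕ.NonZero M}} → ℤ → Set
      SameDivisors M c = ∀ n → n ℕ∣.∣ M →
        (+ n ℤ∣.∣ c → Divisor (+ n)) × (Divisor (+ n) → + n ℤ∣.∣ c)
      restrict : ∀ m n c .{{_ : ℕ.NonZero m}} .{{_ : ℕ.NonZero n}} → m ℕ∣.∣ n →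
                 SameDivisors n c → SameDivisors m c
      restrict m n c m∣n same k k∣m = same k (ℕ∣.∣-trans k∣m m∣n)
      respects : ∀ n c d .{{_ : ℕ.NonZero n}} → c ≡ d mod n → SameDivisors n c → SameDivisors n d
      respects n c d c≡d same k k∣n =
          (λ k∣d → proj₁ (same k k∣n) (mod-∣ (ℤ∣.∣ᵤ⇒∣ k∣n) c≡d k∣d))
        , (λ div → mod-∣ (ℤ∣.∣ᵤ⇒∣ k∣n) (mod-sym c≡d) (proj₂ (same k k∣n) div))
      solvable : ∀ M .{{_ : ℕ.NonZero M}} → ∃[ c ] SameDivisors M c
      solvable M = let (g , g∣M , div-g , greatest) = greatestDivisor M M in
        + g , λ n n∣M → (λ n∣g → divisor-∣ (+ n) (+ g) n∣g div-g)
                      , (λ div → ℤ∣.∣ᵤ⇒∣ (greatest n (ℕ∣.∣⇒≤ n∣M) n∣M div))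
      diagonalise : ∃[ x ] (∀ M .{{_ : ℕ.NonZero M}} → SameDivisors M (res x M)) →
                    ∃[ x ] (∀ n .{{_ : ℕ.NonZero n}} →
                      (+ n ℤ∣.∣ res x n → Divisor (+ n)) × (Divisor (+ n) → + n ℤ∣.∣ res x n))
      diagonalise (x , same) = x , λ n → same n n ℕ∣.∣-refl

-- If p divides ξ(e), then p divides e.  Otherwise let x ∈ Ẑ have exactly the
-- divisors of e: then e ↦ x extends to L → Ẑ, and it is not a multiple of ξ.
module _ (excludedMiddle : ExcludedMiddle 0ℓ) (A : Ab) (torsionFree : TorsionFree A)
         (rankOne : RankOne A) (ξ : Hom A Ẑ⁺) (generates : Generates A ξ) where

  private
    e = proj₁ rankOne
    cyclic = rankOne⇒locallyCyclic A torsionFree rankOne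
    open AbelianGroup A using (_≈_; setoid)
    open Multiples A
    open Divisors A cyclic e (proj₁ (proj₂ rankOne))
    module MẐ = Multiples Ẑ⁺

  divides-base : ∀ p z → p ≢ 0ℤ → ⟦ ξ ⟧ e ≈ᶻ ι p *ᶻ z → ∃[ y ] p ∗ y ≈ e
  divides-base p z p≢0 ξe≈pz = from-element (divisorElement excludedMiddle)
    where
    from-element : ∃[ x ] (∀ n .{{_ : ℕ.NonZero n}} →
      (+ n ℤ∣.∣ res x n → Divisor (+ n)) × (Divisor (+ n) → + n ℤ∣.∣ res x n)) → Divisor p
    from-element (x , same) = from-extension (extension A Ẑ⁺ Ẑ-torsionFree rankOne x total)
      where
      divides-x : ∀ b → b ≢ 0ℤ → Divisor b → ∃[ w ] x ≈ᶻ ι b *ᶻ w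
      divides-x b b≢0 div = Ẑ-divide ℤ.∣ b ∣ b x ℤ∣.m∣∣m∣ (ℤ∣.∣-trans ℤ∣.m∣∣m∣
        (proj₂ (same ℤ.∣ b ∣) (divisor-∣ (+ ℤ.∣ b ∣) b ℤ∣.∣m∣∣m div)))
        where instance _ = ℤ.≢-nonZero b≢0
      total : ∀ y → ∃[ v ] Proportional A Ẑ⁺ Ẑ-torsionFree rankOne x y v
      total y = from-generator (cyclic y e)
        where
        from-generator : ∃[ u ] ∃[ α ] ∃[ β ] y ≈ α ∗ u × e ≈ β ∗ u →
                         ∃[ v ] Proportional A Ẑ⁺ Ẑ-torsionFree rankOne x y v
        from-generator (u , α , β , y≈αu , e≈βu) =
          from-quotient (divides-x β (coefficient-≢0 {u} {β} e≈βu) (divisor-of-base β e≈βu))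
          where
          from-quotient : ∃[ w ] x ≈ᶻ ι β *ᶻ w →
                          ∃[ v ] Proportional A Ẑ⁺ Ẑ-torsionFree rankOne x y v
          -- Here y = (α / β) e. As β divides `e` it divides x, so y has to be sent to α (x / β) = α
          -- w.
          from-quotient (w , x≈βw) = α MẐ.∗ w , β , α , coefficient-≢0 {u} {β} e≈βu
            , (begin
                β ∗ y        ≈⟨ ∗-congˡ β y≈αu ⟩
                β ∗ α ∗ u    ≈⟨ ∗-swap β α u ⟩
                α ∗ β ∗ u    ≈⟨ ∗-congˡ α e≈βu ⟨
                α ∗ e        ∎)
            , Ẑᴿ.trans (MẐ.∗-swap β α w)
                (MẐ.∗-congˡ α (Ẑᴿ.trans (Ẑ-· β w) (Ẑᴿ.sym x≈βw)))
            where open SetoidReasoning setoid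
      from-extension : Σ[ h ∈ Hom A Ẑ⁺ ] ⟦ h ⟧ e ≈ᶻ x → Divisor p
      from-extension (h , he≈x) = multiple-of-ξ (generates h)
        where
        multiple-of-ξ : ∃[ c ] (∀ y → ⟦ h ⟧ y ≈ᶻ c *ᶻ ⟦ ξ ⟧ y) → Divisor p
        multiple-of-ξ (c , h≈cξ) = divisor-∣ p (+ ℤ.∣ p ∣) ℤ∣.m∣∣m∣ (proj₁ (same ℤ.∣ p ∣)
          (mod-∣ ℤ∣.∣-refl (cong-mod x≈pcz ℤ.∣ p ∣)
            (ℤ∣.∣-trans ℤ∣.∣m∣∣m (ℤ∣.∣m⇒∣m*n {p} {p} (res (c *ᶻ z) ℤ.∣ p ∣) ℤ∣.∣-refl))))
          where
          instance _ = ℤ.≢-nonZero p≢0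
          -- As h(e) = c ξ(e), divisibility of ξ(e) by p passes to x, and the choice of x turns it
          -- into divisibility of `e`.
          x≈pcz : x ≈ᶻ ι p *ᶻ (c *ᶻ z)
          x≈pcz = begin
            x                  ≈⟨ he≈x ⟨
            ⟦ h ⟧ e            ≈⟨ h≈cξ e ⟩
            c *ᶻ ⟦ ξ ⟧ e       ≈⟨ Ẑᴿ.*-congˡ {c} ξe≈pz ⟩
            c *ᶻ (ι p *ᶻ z)    ≈⟨ pointwise (λ k → solve 3 (λ c p z →
                                     c :* (p :* z) := p :* (c :* z)) refl (res c k) p (res z k)) ⟩
            ι p *ᶻ (c *ᶻ z)    ∎
            where
            open SetoidReasoning Ẑᴿ.setoid
            open ℤ-Solver using (solve; _:*_; _:=_)

-- Every framed divisor is some D_a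

τ-unit : ∀ w r → w ≡ 1ℚ → fromℚʳ w *ʳ r ≈ʳ r
τ-unit w r refl = termwise {fromℚʳ 1ℚ *ʳ r} {r} λ n → ℚ.*-identityˡ (seq r n)

-- The coordinate q = m / n of y, where n y = m e.
module _ (A : Ab) (e : ∣ A ∣) (independent : Multiples.Independent A e)
         (fraction : ∀ y → ∃[ n ] ∃[ m ] n ≢ 0ℤ × AbelianGroup._≈_ A (_·_ A n y) (_·_ A m e))
         (ξ : Hom A Ẑ⁺) where

  private
    module A = AbelianGroup A

  unitMultiplier : Multiplier (integral (⟦ ξ ⟧ e))
  unitMultiplier = denominatorMultiplier (⟦ ξ ⟧ e) 1ℤ

  Coordinate : ∣ A ∣ → Multiplier (integral (⟦ ξ ⟧ e)) → Set
  Coordinate = Proportional A (multipliers (integral (⟦ ξ ⟧ e)))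
    (multipliers-torsionFree (integral (⟦ ξ ⟧ e))) (e , independent , fraction) unitMultiplier

  coordinate : ∀ y → ∃[ v ] Coordinate y v
  coordinate y = from-fraction (fraction y)
    where
    from-fraction : ∃[ n ] ∃[ m ] n ≢ 0ℤ × _·_ A n y A.≈ _·_ A m e →
      ∃[ v ] Coordinate y v
    from-fraction (n , m , n≢0 , ny≈me) = from-ratio (ratio m n≢0)
      where
      multiples : ι (n ℤ.* 1ℤ) *ᶻ ⟦ ξ ⟧ y ≈ᶻ ι m *ᶻ ⟦ ξ ⟧ e
      multiples = begin
        ι (n ℤ.* 1ℤ) *ᶻ ⟦ ξ ⟧ y  ≈⟨ pointwise (λ k →
                                         ≡.cong (ℤ._* res (⟦ ξ ⟧ y) k) (ℤ.*-identityʳ n)) ⟩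
        ι n *ᶻ ⟦ ξ ⟧ y           ≈⟨ Ẑ-· n (⟦ ξ ⟧ y) ⟨
        _·_ Ẑ⁺ n (⟦ ξ ⟧ y)       ≈⟨ ·-homo A Ẑ⁺ ξ n y ⟨
        ⟦ ξ ⟧ (_·_ A n y)        ≈⟨ GroupHomomorphism.⟦⟧-cong ξ ny≈me ⟩
        ⟦ ξ ⟧ (_·_ A m e)        ≈⟨ ·-homo A Ẑ⁺ ξ m e ⟩
        _·_ Ẑ⁺ m (⟦ ξ ⟧ e)       ≈⟨ Ẑ-· m (⟦ ξ ⟧ e) ⟩
        ι m *ᶻ ⟦ ξ ⟧ e           ∎
        where open SetoidReasoning Ẑᴿ.setoid
      from-ratio : ∃[ q ] fromℤ n ℚ.* q ≡ fromℤ m →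
        ∃[ v ] Coordinate y v
      from-ratio (q , nq≡m) = v , n , m , n≢0 , ny≈me , (begin
        rational (_·_ (multipliers (integral (⟦ ξ ⟧ e))) n v)
          ≡⟨ rational-· (integral (⟦ ξ ⟧ e)) n v ⟩
        fromℤ n ℚ.* q                                    ≡⟨ nq≡m ⟩
        fromℤ m                                          ≡⟨ ℚ.*-identityʳ (fromℤ m) ⟨
        fromℤ m ℚ.* 1ℚ                                   ≡⟨ ≡.cong (fromℤ m ℚ.*_) fromℤ-1 ⟨
        fromℤ m ℚ.* fromℤ 1ℤ
          ≡⟨ rational-· (integral (⟦ ξ ⟧ e)) m unitMultiplier ⟨
        rational (_·_ (multipliers (integral (⟦ ξ ⟧ e))) m unitMultiplier)  ∎)
        where
        open ≡.≡-Reasoning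
        v : Multiplier (integral (⟦ ξ ⟧ e))
        v = multiplier q (⟦ ξ ⟧ y) (multiplierOfRatio m (⟦ ξ ⟧ e) 1ℤ n≢0 (⟦ ξ ⟧ y) multiples q nq≡m)

  coordinateHom : Σ[ f ∈ Hom A (multipliers (integral (⟦ ξ ⟧ e))) ] rational (⟦ f ⟧ e) ≡ fromℤ 1ℤ
  coordinateHom = extension A (multipliers (integral (⟦ ξ ⟧ e)))
    (multipliers-torsionFree (integral (⟦ ξ ⟧ e))) (e , independent , fraction)
    unitMultiplier coordinate

module _ (excludedMiddle : ExcludedMiddle 0ℓ) (X : Triple)
         (torsionFree : TorsionFree (L X))
         (e : ∣ L X ∣) (independent : Multiples.Independent (L X) e)
         (fraction : ∀ y → ∃[ n ] ∃[ m ] n ≢ 0ℤ ×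
                    AbelianGroup._≈_ (L X) (_·_ (L X) n y) (_·_ (L X) m e))
         (generates : Generates (L X) (ξ X)) where

  private
    module A = AbelianGroup (L X)
    module MA = Multiples (L X)

  represent : X ≅ D (integral (⟦ ξ X ⟧ e) , ⟦ τ X ⟧ e)
  represent = from-coordinates (coordinateHom (L X) e independent fraction (ξ X))
    where
    Q : Ab
    Q = multipliers (integral (⟦ ξ X ⟧ e))
    module MQ = Multiples (multipliers (integral (⟦ ξ X ⟧ e)))
    one : Multiplier (integral (⟦ ξ X ⟧ e))
    one = denominatorMultiplier (⟦ ξ X ⟧ e) 1ℤ
    from-coordinates : Σ[ f ∈ Hom (L X) (multipliers (integral (⟦ ξ X ⟧ e))) ]
                         rational (⟦ f ⟧ e) ≡ fromℤ 1ℤ →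
                       X ≅ D (integral (⟦ ξ X ⟧ e) , ⟦ τ X ⟧ e)
    from-coordinates (f , fe≡1) =
      isomorphism X (D (integral (⟦ ξ X ⟧ e) , ⟦ τ X ⟧ e)) f kernel surjective
        ξ-compatible (τ-compatible (τ (D (integral (⟦ ξ X ⟧ e) , ⟦ τ X ⟧ e))) τ-base)
      where
      kernel : ∀ y → rational (⟦ f ⟧ y) ≡ 0ℚ → y A.≈ A.ε
      kernel y fy≡0 = from-fraction (fraction y)
        where
        from-fraction : ∃[ n ] ∃[ m ] n ≢ 0ℤ × n MA.∗ y A.≈ m MA.∗ e → y A.≈ A.ε
        from-fraction (n , m , n≢0 , ny≈me) =
          torsionFree n y n≢0 (A.trans ny≈me (MA.∗-congʳ e (fromℤ-injective (begin
            fromℤ m                              ≡⟨ ℚ.*-identityʳ (fromℤ m) ⟨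
            fromℤ m ℚ.* 1ℚ                       ≡⟨ ≡.cong (fromℤ m ℚ.*_) (≡.trans fe≡1 fromℤ-1) ⟨
            fromℤ m ℚ.* rational (⟦ f ⟧ e)       ≡⟨ rational-· (integral (⟦ ξ X ⟧ e)) m (⟦ f ⟧ e) ⟨
            rational (m MQ.∗ ⟦ f ⟧ e)            ≡⟨ ·-homo (L X) Q f m e ⟨
            rational (⟦ f ⟧ (m MA.∗ e))          ≡⟨ GroupHomomorphism.⟦⟧-cong f ny≈me ⟨
            rational (⟦ f ⟧ (n MA.∗ y))          ≡⟨ ·-homo (L X) Q f n y ⟩
            rational (n MQ.∗ ⟦ f ⟧ y)            ≡⟨ rational-· (integral (⟦ ξ X ⟧ e)) n (⟦ f ⟧ y) ⟩
            fromℤ n ℚ.* rational (⟦ f ⟧ y)       ≡⟨ ≡.cong (fromℤ n ℚ.*_) fy≡0 ⟩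
            fromℤ n ℚ.* 0ℚ                       ≡⟨ ℚ.*-zeroʳ (fromℤ n) ⟩
            0ℚ                                   ≡⟨ fromℤ-0 ⟨
            fromℤ 0ℤ                             ∎))))
          where open ≡.≡-Reasoning

      surjective : ∀ w → ∃[ y ] rational (⟦ f ⟧ y) ≡ rational {(integral (⟦ ξ X ⟧ e))} w
      -- Write 1 = p u and w = q u in L_a. Then ξ(e) is p times the value of u, so `divides-base`
      -- yields y in L with p y = e; cancelling p shows that y maps to u, and hence q y to w.
      surjective w = from-generator (multipliers-locallyCyclic (integral (⟦ ξ X ⟧ e)) one w)
        where
        from-generator : ∃[ u ] ∃[ p ] ∃[ q ]
                           rational one ≡ rational (p MQ.∗ u) × rational w ≡ rational (q MQ.∗ u) →
                         ∃[ y ] rational (⟦ f ⟧ y) ≡ rational w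
        from-generator (u , p , q , one≡pu , w≡qu) = from-divisor
          (divides-base excludedMiddle (L X) torsionFree (e , independent , fraction)
            (ξ X) generates p (value u) p≢0
            (Ẑᴿ.trans (GroupHomomorphism.⟦⟧-cong (valueHom (integral (⟦ ξ X ⟧ e)))
                        {one} {p MQ.∗ u} one≡pu)
                      (value-· (integral (⟦ ξ X ⟧ e)) p u)))
          where
          p≢0 : p ≢ 0ℤ
          p≢0 refl = fromℤ-≢0 {1ℤ} (λ ()) one≡pu
          from-divisor : ∃[ y ] p MA.∗ y A.≈ e → ∃[ y ] rational (⟦ f ⟧ y) ≡ rational w
          from-divisor (y , py≈e) = q MA.∗ y , (begin
            rational (⟦ f ⟧ (q MA.∗ y))   ≡⟨ ·-homo (L X) Q f q y ⟩
            rational (q MQ.∗ ⟦ f ⟧ y)     ≡⟨ MQ.∗-congˡ q {⟦ f ⟧ y} {u} fy≡u ⟩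
            rational (q MQ.∗ u)           ≡⟨ w≡qu ⟨
            rational w                    ∎)
            where
            open ≡.≡-Reasoning
            fy≡u : rational (⟦ f ⟧ y) ≡ rational u
            fy≡u = MQ.∗-cancel (multipliers-torsionFree (integral (⟦ ξ X ⟧ e)))
              p {⟦ f ⟧ y} {u} p≢0 (begin
              rational (p MQ.∗ ⟦ f ⟧ y)     ≡⟨ ·-homo (L X) Q f p y ⟨
              rational (⟦ f ⟧ (p MA.∗ y))   ≡⟨ GroupHomomorphism.⟦⟧-cong f py≈e ⟩
              rational (⟦ f ⟧ e)            ≡⟨ fe≡1 ⟩
              rational one                  ≡⟨ one≡pu ⟩
              rational (p MQ.∗ u)           ∎)

      ξ-compatible : ∀ y → value (⟦ f ⟧ y) ≈ᶻ ⟦ ξ X ⟧ y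
      ξ-compatible = hom-unique (L X) Ẑ⁺ Ẑ-torsionFree (e , independent , fraction)
        (compose (L X) Q Ẑ⁺ f (valueHom (integral (⟦ ξ X ⟧ e)))) (ξ X)
        (GroupHomomorphism.⟦⟧-cong (valueHom (integral (⟦ ξ X ⟧ e))) {⟦ f ⟧ e} {one} fe≡1)

      τ-base : ⟦ τ (D (integral (⟦ ξ X ⟧ e) , ⟦ τ X ⟧ e)) ⟧ (⟦ f ⟧ e) ≈ʳ ⟦ τ X ⟧ e
      τ-base = τ-unit (rational (⟦ f ⟧ e)) (⟦ τ X ⟧ e) (≡.trans fe≡1 fromℤ-1)

      τ-compatible : ∀ (h : Hom Q ℝ⁺) → ⟦ h ⟧ (⟦ f ⟧ e) ≈ʳ ⟦ τ X ⟧ e →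
                     ∀ y → ⟦ h ⟧ (⟦ f ⟧ y) ≈ʳ ⟦ τ X ⟧ y
      τ-compatible h = hom-unique (L X) ℝ⁺ ℝ-torsionFree (e , independent , fraction)
        (compose (L X) Q ℝ⁺ f h) (τ X)

  -- The adele is returned as a variable with its equation, so that later arguments can carry it
  -- along without its construction.
  represented : ∃[ c ] c ≡ (integral (⟦ ξ X ⟧ e) , ⟦ τ X ⟧ e) × X ≅ D c
  represented = (integral (⟦ ξ X ⟧ e) , ⟦ τ X ⟧ e) , refl , represent

representative : ExcludedMiddle 0ℓ → ∀ X → IsFramed X → ∃[ c ] X ≅ D c
representative excludedMiddle X framed = forget
  (represented excludedMiddle X F.torsionFree (proj₁ F.rankOne) (proj₁ (proj₂ F.rankOne))
    (proj₂ (proj₂ F.rankOne)) F.generates)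
  where
  module F = IsFramed framed
  forget : ∀ {d} → ∃[ c ] c ≡ d × X ≅ D c → ∃[ c ] X ≅ D c
  forget (c , _ , X≅Dc) = c , X≅Dc

framed⇒locallyCyclic : ∀ X → IsFramed X → LocallyCyclic (L X)
framed⇒locallyCyclic X framed = rankOne⇒locallyCyclic (L X) F.torsionFree F.rankOne
  where module F = IsFramed framed

multiple-cong : ∀ c u v x y → u ≈ᶻ v → u ≈ᶻ c *ᶻ x → x ≈ᶻ y → v ≈ᶻ c *ᶻ y
multiple-cong c u v x y u≈v u≈cx x≈y =
  Ẑᴿ.trans (Ẑᴿ.sym u≈v) (Ẑᴿ.trans u≈cx (Ẑᴿ.*-congˡ {c} {x} {y} x≈y))

-- Together with `D-framed` this reduces framedness of a tensor product to finding an adele that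
-- represents it.
≅-framed : ∀ {X Y} → X ≅ Y → IsFramed X → IsFramed Y
≅-framed {X} {Y} X≅Y framed = record
  { torsionFree = torsionFree
  ; rankOne     = I.φ (proj₁ F.rankOne) , independent , fraction
  ; generates   = λ h → generates h (F.generates (compose (L X) (L Y) Ẑ⁺ I.to h))
  }
  where
  module F = IsFramed framed
  module I = Isomorphism X≅Y
  module X = AbelianGroup (L X)
  module Y = AbelianGroup (L Y)
  module MX = Multiples (L X)
  module MY = Multiples (L Y)
  e = proj₁ F.rankOne

  torsionFree : TorsionFree (L Y)
  torsionFree n y n≢0 ny≈ε = begin
    y                ≈⟨ I.φ-φ⁻¹ y ⟨
    I.φ (I.φ⁻¹ y)    ≈⟨ GroupHomomorphism.⟦⟧-cong I.to (F.torsionFree n (I.φ⁻¹ y) n≢0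
                          (X.trans (X.sym (·-homo (L Y) (L X) I.from n y))
                          (X.trans (GroupHomomorphism.⟦⟧-cong I.from ny≈ε)
                                   (GroupHomomorphism.ε-homo I.from)))) ⟩
    I.φ X.ε          ≈⟨ GroupHomomorphism.ε-homo I.to ⟩
    Y.ε              ∎
    where open SetoidReasoning Y.setoid

  independent : ∀ n → n MY.∗ I.φ e Y.≈ Y.ε → n ≡ 0ℤ
  independent n nφe≈ε = proj₁ (proj₂ F.rankOne) n
    (I.kernel (n MX.∗ e) (Y.trans (·-homo (L X) (L Y) I.to n e) nφe≈ε))

  fraction : ∀ y → ∃[ n ] ∃[ m ] n ≢ 0ℤ × n MY.∗ y Y.≈ m MY.∗ I.φ e
  fraction y = from-fraction (proj₂ (proj₂ F.rankOne) (I.φ⁻¹ y))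
    where
    from-fraction : ∃[ n ] ∃[ m ] n ≢ 0ℤ × n MX.∗ I.φ⁻¹ y X.≈ m MX.∗ e →
                    ∃[ n ] ∃[ m ] n ≢ 0ℤ × n MY.∗ y Y.≈ m MY.∗ I.φ e
    from-fraction (n , m , n≢0 , eq) = n , m , n≢0 , (begin
      n MY.∗ y                 ≈⟨ MY.∗-congˡ n (I.φ-φ⁻¹ y) ⟨
      n MY.∗ I.φ (I.φ⁻¹ y)     ≈⟨ ·-homo (L X) (L Y) I.to n (I.φ⁻¹ y) ⟨
      I.φ (n MX.∗ I.φ⁻¹ y)     ≈⟨ GroupHomomorphism.⟦⟧-cong I.to eq ⟩
      I.φ (m MX.∗ e)           ≈⟨ ·-homo (L X) (L Y) I.to m e ⟩
      m MY.∗ I.φ e             ∎)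
      where open SetoidReasoning Y.setoid

  generates : ∀ (h : Hom (L Y) Ẑ⁺) → ∃[ c ] (∀ x → ⟦ h ⟧ (I.φ x) ≈ᶻ c *ᶻ ⟦ ξ X ⟧ x) →
              ∃[ c ] (∀ y → ⟦ h ⟧ y ≈ᶻ c *ᶻ ⟦ ξ Y ⟧ y)
  generates h (c , eq) = c , λ y →
    multiple-cong c (⟦ h ⟧ (I.φ (I.φ⁻¹ y))) (⟦ h ⟧ y) (⟦ ξ X ⟧ (I.φ⁻¹ y)) (⟦ ξ Y ⟧ y)
      (GroupHomomorphism.⟦⟧-cong h (I.φ-φ⁻¹ y)) (eq (I.φ⁻¹ y))
      (Ẑᴿ.trans (Ẑᴿ.sym (I.ξ-compatible (I.φ⁻¹ y))) (GroupHomomorphism.⟦⟧-cong (ξ Y) (I.φ-φ⁻¹ y)))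

-- The unit

ℤ-·≡* : ∀ n k → _·_ ℤ⁺ n k ≡ n ℤ.* k
ℤ-·≡* n k = ≡.sym (≡.trans (Multiples.ℤ-hom ℤ⁺ f n) (Multiples.∗-congˡ ℤ⁺ n (ℤ.*-identityˡ k)))
  where
  f = additive ℤ⁺ ℤ⁺ (ℤ._* k) (≡.cong (ℤ._* k)) (ℤ.*-distribʳ-+ k)

𝟙-torsionFree : TorsionFree ℤ⁺
𝟙-torsionFree n k n≢0 nk≡0 = ℤ.*-cancelˡ-≡ n k 0ℤ {{ℤ.≢-nonZero n≢0}}
  (≡.trans (≡.sym (ℤ-·≡* n k)) (≡.trans nk≡0 (≡.sym (ℤ.*-zeroʳ n))))

1-independent : ∀ n → _·_ ℤ⁺ n 1ℤ ≡ 0ℤ → n ≡ 0ℤ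
1-independent n eq = ≡.trans (≡.sym (ℤ.*-identityʳ n)) (≡.trans (≡.sym (ℤ-·≡* n 1ℤ)) eq)

1-fraction : ∀ k → ∃[ n ] ∃[ m ] n ≢ 0ℤ × _·_ ℤ⁺ n k ≡ _·_ ℤ⁺ m 1ℤ
1-fraction k = 1ℤ , k , (λ ()) ,
  ≡.trans (ℤ-·≡* 1ℤ k) (≡.trans (ℤ.*-comm 1ℤ k) (≡.sym (ℤ-·≡* k 1ℤ)))

𝟙-generates : Generates ℤ⁺ (ξ 𝟙)
𝟙-generates h = ⟦ h ⟧ 1ℤ , λ k → Ẑᴿ.trans (Multiples.ℤ-hom Ẑ⁺ h k)
  (Ẑᴿ.trans (Ẑ-· k (⟦ h ⟧ 1ℤ)) (Ẑᴿ.*-comm (ι k) (⟦ h ⟧ 1ℤ)))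

𝟙-framed : IsFramed 𝟙
𝟙-framed = record
  { torsionFree = 𝟙-torsionFree
  ; rankOne     = 1ℤ , 1-independent , 1-fraction
  ; generates   = 𝟙-generates
  }

unit-orbit : ∀ u → u ≡ (1ᶠ , fromℚʳ 1ℚ) → (integral (⟦ ξ 𝟙 ⟧ 1ℤ) , ⟦ τ 𝟙 ⟧ 1ℤ) Yℚ.≈ u
unit-orbit u refl = orbit 1ℚ (integral (⟦ ξ 𝟙 ⟧ 1ℤ)) (⟦ τ 𝟙 ⟧ 1ℤ) 1ᶠ (fromℚʳ 1ℚ) (λ ())
  (mk≈ (pointwise λ _ → refl)) (termwise λ _ → refl)

D-unit : ∀ u → (integral (⟦ ξ 𝟙 ⟧ 1ℤ) , ⟦ τ 𝟙 ⟧ 1ℤ) Yℚ.≈ u →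
         ∃[ c ] c ≡ (integral (⟦ ξ 𝟙 ⟧ 1ℤ) , ⟦ τ 𝟙 ⟧ 1ℤ) × 𝟙 ≅ D c → D u ≅ 𝟙
D-unit u eq (c , refl , 𝟙≅Dc) = ≅-sym (≅-trans 𝟙≅Dc (D-cong c u eq))

-- Representing ℤ through its element 1 gives the adele (ξ(1), τ(1)), which is the unit up to the
-- orbit relation; L_1 need not be computed by hand.
D-1 : ExcludedMiddle 0ℓ → ∀ u → u ≡ (1ᶠ , fromℚʳ 1ℚ) → D u ≅ 𝟙
D-1 excludedMiddle u eq = D-unit u (unit-orbit u eq)
  (represented excludedMiddle 𝟙 𝟙-torsionFree 1ℤ 1-independent 1-fraction 𝟙-generates)

-- Products of representatives

⊗-represent-≡ : ∀ {X Y} a b c → c ≡ a 𝔸ᴿ.* b → LocallyCyclic (L X) → LocallyCyclic (L Y) →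
                X ≅ D a → Y ≅ D b → X ⊗ᵀ Y ≅ D c
⊗-represent-≡ {X} {Y} a b c refl = ⊗-represent {X} {Y} a b

D-⊗ : ∀ a b c → c ≡ a 𝔸ᴿ.* b → D c ≅ D a ⊗ᵀ D b
D-⊗ a@(a′ , _) b@(b′ , _) c eq = ≅-sym (⊗-represent-≡ {D a} {D b} a b c eq
  (multipliers-locallyCyclic a′) (multipliers-locallyCyclic b′) (≅-refl {D a}) (≅-refl {D b}))

-- Products enter the lemmas below as variables with a defining equation, which keeps adelic
-- arithmetic folded until a ring law is applied to it.
product : ∀ a b → ∃[ c ] c ≡ a 𝔸ᴿ.* b
product a b = a 𝔸ᴿ.* b , refl

D-injective′ : ∀ a b → D a ≅ D b → a Yℚ.≈ b
D-injective′ (a , r) (b , s) = D-injective a r b s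

components : ∀ a b c → c ≡ a 𝔸ᴿ.* b → proj₁ c ≡ proj₁ a *ᶠ proj₁ b × proj₂ c ≡ proj₂ a *ʳ proj₂ b
components a b _ refl = refl , refl

equal-orbit : ∀ a r b s → a ≈ᶠ b → r ≈ʳ s → (a , r) Yℚ.≈ (b , s)
equal-orbit a r b s a≈b r≈s = orbit 1ℚ a r b s (λ ())
  (𝔸ᶠᴿ.trans (𝔸ᶠᴿ.*-identityˡ a) a≈b)
  (≈ʳ-trans {fromℚʳ 1ℚ *ʳ r} {r} {s} (τ-unit 1ℚ r refl) r≈s)

𝔸ᶠ-assoc : ∀ a b c ab bc l r → ab ≡ a *ᶠ b → bc ≡ b *ᶠ c → l ≡ ab *ᶠ c → r ≡ a *ᶠ bc → l ≈ᶠ r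
𝔸ᶠ-assoc a b c _ _ _ _ refl refl refl refl = 𝔸ᶠᴿ.*-assoc a b c

ℝ-assoc : ∀ a b c ab bc l r → ab ≡ a *ʳ b → bc ≡ b *ʳ c → l ≡ ab *ʳ c → r ≡ a *ʳ bc → l ≈ʳ r
ℝ-assoc a b c _ _ _ _ refl refl refl refl = termwise λ n → ℚ.*-assoc (seq a n) (seq b n) (seq c n)

assoc-orbit : ∀ a b c ab bc l r → ab ≡ a 𝔸ᴿ.* b → bc ≡ b 𝔸ᴿ.* c →
              l ≡ ab 𝔸ᴿ.* c → r ≡ a 𝔸ᴿ.* bc → l Yℚ.≈ r
assoc-orbit a b c ab bc l r ab≡ bc≡ l≡ r≡ =
  go (components a b ab ab≡) (components b c bc bc≡) (components ab c l l≡) (components a bc r r≡)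
  where
  go : proj₁ ab ≡ proj₁ a *ᶠ proj₁ b × proj₂ ab ≡ proj₂ a *ʳ proj₂ b →
       proj₁ bc ≡ proj₁ b *ᶠ proj₁ c × proj₂ bc ≡ proj₂ b *ʳ proj₂ c →
       proj₁ l ≡ proj₁ ab *ᶠ proj₁ c × proj₂ l ≡ proj₂ ab *ʳ proj₂ c →
       proj₁ r ≡ proj₁ a *ᶠ proj₁ bc × proj₂ r ≡ proj₂ a *ʳ proj₂ bc → l Yℚ.≈ r
  go (p , p′) (q , q′) (s , s′) (t , t′) = equal-orbit (proj₁ l) (proj₂ l) (proj₁ r) (proj₂ r)
    (𝔸ᶠ-assoc (proj₁ a) (proj₁ b) (proj₁ c) (proj₁ ab) (proj₁ bc) (proj₁ l) (proj₁ r) p q s t)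
    (ℝ-assoc (proj₂ a) (proj₂ b) (proj₂ c) (proj₂ ab) (proj₂ bc) (proj₂ l) (proj₂ r) p′ q′ s′ t′)

𝔸ᶠ-comm : ∀ a b l r → l ≡ a *ᶠ b → r ≡ b *ᶠ a → l ≈ᶠ r
𝔸ᶠ-comm a b _ _ refl refl = 𝔸ᶠᴿ.*-comm a b

ℝ-comm : ∀ a b l r → l ≡ a *ʳ b → r ≡ b *ʳ a → l ≈ʳ r
ℝ-comm a b _ _ refl refl = termwise λ n → ℚ.*-comm (seq a n) (seq b n)

comm-orbit : ∀ a b l r → l ≡ a 𝔸ᴿ.* b → r ≡ b 𝔸ᴿ.* a → l Yℚ.≈ r
comm-orbit a b l r l≡ r≡ = go (components a b l l≡) (components b a r r≡)
  where
  go : proj₁ l ≡ proj₁ a *ᶠ proj₁ b × proj₂ l ≡ proj₂ a *ʳ proj₂ b →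
       proj₁ r ≡ proj₁ b *ᶠ proj₁ a × proj₂ r ≡ proj₂ b *ʳ proj₂ a → l Yℚ.≈ r
  go (p , p′) (q , q′) = equal-orbit (proj₁ l) (proj₂ l) (proj₁ r) (proj₂ r)
    (𝔸ᶠ-comm (proj₁ a) (proj₁ b) (proj₁ l) (proj₁ r) p q)
    (ℝ-comm (proj₂ a) (proj₂ b) (proj₂ l) (proj₂ r) p′ q′)

𝔸ᶠ-identity : ∀ a l → l ≡ 1ᶠ *ᶠ a → l ≈ᶠ a
𝔸ᶠ-identity a _ refl = 𝔸ᶠᴿ.*-identityˡ a

ℝ-identity : ∀ a l → l ≡ fromℚʳ 1ℚ *ʳ a → l ≈ʳ a
ℝ-identity a _ refl = τ-unit 1ℚ a refl

identity-orbit : ∀ a u l → u ≡ (1ᶠ , fromℚʳ 1ℚ) → l ≡ u 𝔸ᴿ.* a → l Yℚ.≈ a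
identity-orbit a u l refl l≡ = go (components u a l l≡)
  where
  go : proj₁ l ≡ 1ᶠ *ᶠ proj₁ a × proj₂ l ≡ fromℚʳ 1ℚ *ʳ proj₂ a → l Yℚ.≈ a
  go (p , p′) = equal-orbit (proj₁ l) (proj₂ l) (proj₁ a) (proj₂ a)
    (𝔸ᶠ-identity (proj₁ a) (proj₁ l) p) (ℝ-identity (proj₂ a) (proj₂ l) p′)

-- Both sides are represented by the same product of adeles, so no induced map between tensor
-- products has to be built.
⊗-isomorphic : ∀ {X Y X′ Y′} a b → LocallyCyclic (L X) → LocallyCyclic (L Y) →
               LocallyCyclic (L X′) → LocallyCyclic (L Y′) →
               X ≅ D a → Y ≅ D b → X′ ≅ D a → Y′ ≅ D b → X ⊗ᵀ Y ≅ X′ ⊗ᵀ Y′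
⊗-isomorphic {X} {Y} {X′} {Y′} a b x y x′ y′ i j i′ j′ =
  ≅-trans (⊗-represent {X} {Y} a b x y i j) (≅-sym (⊗-represent {X′} {Y′} a b x′ y′ i′ j′))

-- Stated for an arbitrary operation, so that checking the laws does not unfold ⊗ᵀ.
module FramedMonoid
  (_⊙_ : Triple → Triple → Triple) (U : Triple)
  (⊙-framed : ∀ X Y → IsFramed X → IsFramed Y → IsFramed (X ⊙ Y)) (U-framed : IsFramed U)
  (⊙-cong : ∀ X X′ Y Y′ → IsFramed X → IsFramed X′ → IsFramed Y → IsFramed Y′ →
            X ≅ X′ → Y ≅ Y′ → X ⊙ Y ≅ X′ ⊙ Y′)
  (⊙-assoc : ∀ X Y Z → IsFramed X → IsFramed Y → IsFramed Z → (X ⊙ Y) ⊙ Z ≅ X ⊙ (Y ⊙ Z))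
  (⊙-comm : ∀ X Y → IsFramed X → IsFramed Y → X ⊙ Y ≅ Y ⊙ X)
  (⊙-identityˡ : ∀ X → IsFramed X → U ⊙ X ≅ X) where

  isCommutativeMonoid : IsCommutativeMonoid {A = FramedDivisor}
    (λ X Y → proj₁ X ≅ proj₁ Y)
    (λ X Y → proj₁ X ⊙ proj₁ Y , ⊙-framed (proj₁ X) (proj₁ Y) (proj₂ X) (proj₂ Y))
    (U , U-framed)
  isCommutativeMonoid = record
    { isMonoid = record
      { isSemigroup = record
        { isMagma = record
          { isEquivalence = record
              { refl  = λ { {X , _} → ≅-refl {X} }
              ; sym   = λ { {X , _} {Y , _} → ≅-sym {X} {Y} }
              ; trans = λ { {X , _} {Y , _} {Z , _} → ≅-trans {X} {Y} {Z} }
              }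
          ; ∙-cong = λ { {X , x} {X′ , x′} {Y , y} {Y′ , y′} → ⊙-cong X X′ Y Y′ x x′ y y′ }
          }
        ; assoc = λ { (X , x) (Y , y) (Z , z) → ⊙-assoc X Y Z x y z }
        }
      ; identity = (λ { (X , x) → ⊙-identityˡ X x })
                 , (λ { (X , x) → ≅-trans {X ⊙ U} {U ⊙ X} {X}
                     (⊙-comm X U x U-framed) (⊙-identityˡ X x) })
      }
    ; comm = λ { (X , x) (Y , y) → ⊙-comm X Y x y }
    }

  isMonoidIsomorphism : ∀ (M : RawMonoid 0ℓ 0ℓ) (F : RawMonoid.Carrier M → Triple)
    (F-framed : ∀ a → IsFramed (F a)) →
    (∀ a b → RawMonoid._≈_ M a b → F a ≅ F b) → (∀ a b → F a ≅ F b → RawMonoid._≈_ M a b) →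
    (∀ a b → F (RawMonoid._∙_ M a b) ≅ F a ⊙ F b) → F (RawMonoid.ε M) ≅ U →
    (∀ X → IsFramed X → ∃[ a ] (∀ {z} → RawMonoid._≈_ M z a → F z ≅ X)) →
    MonoidMorphisms.IsMonoidIsomorphism M
      (record
        { Carrier = FramedDivisor
        ; _≈_     = λ X Y → proj₁ X ≅ proj₁ Y
        ; _∙_     = λ X Y → proj₁ X ⊙ proj₁ Y , ⊙-framed (proj₁ X) (proj₁ Y) (proj₂ X) (proj₂ Y)
        ; ε       = U , U-framed
        })
      (λ a → F a , F-framed a)
  isMonoidIsomorphism M F F-framed F-cong F-injective F-homo F-unit F-surjective = record
    { isMonoidMonomorphism = record
      { isMonoidHomomorphism = record
        { isMagmaHomomorphism = record
          { isRelHomomorphism = record { cong = λ {a} {b} → F-cong a b }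
          ; homo              = F-homo
          }
        ; ε-homo = F-unit
        }
      ; injective = λ {a} {b} → F-injective a b
      }
    ; surjective = λ { (X , x) → F-surjective X x }
    }

-- The Picard monoid

module PicardMonoid (excludedMiddle : ExcludedMiddle 0ℓ) where

  private
    cyclic = framed⇒locallyCyclic

    rep : ∀ X → IsFramed X → ∃[ c ] X ≅ D c
    rep = representative excludedMiddle

  -- Every framed divisor is some D_a, so X ⊗ Y is some D_c, and those are framed. In particular the
  -- generating condition on the tensor product never has to be checked on tensors.
  ⊗-framed : ∀ X Y → IsFramed X → IsFramed Y → IsFramed (X ⊗ᵀ Y)
  ⊗-framed X Y x y = go (rep X x) (rep Y y)
    where
    go : ∃[ a ] X ≅ D a → ∃[ b ] Y ≅ D b → IsFramed (X ⊗ᵀ Y)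
    go (a , i) (b , j) = transport (product a b)
      where
      transport : ∃[ c ] c ≡ a 𝔸ᴿ.* b → IsFramed (X ⊗ᵀ Y)
      transport (c , eq) = ≅-framed
        (≅-sym (⊗-represent-≡ {X} {Y} a b c eq (cyclic X x) (cyclic Y y) i j))
        (D-framed excludedMiddle c)

  ⊗-cong-≅ : ∀ X X′ Y Y′ → IsFramed X → IsFramed X′ → IsFramed Y → IsFramed Y′ →
             X ≅ X′ → Y ≅ Y′ → X ⊗ᵀ Y ≅ X′ ⊗ᵀ Y′
  ⊗-cong-≅ X X′ Y Y′ x x′ y y′ X≅X′ Y≅Y′ = go (rep X x) (rep Y y)
    where
    go : ∃[ a ] X ≅ D a → ∃[ b ] Y ≅ D b → X ⊗ᵀ Y ≅ X′ ⊗ᵀ Y′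
    go (a , i) (b , j) = ⊗-isomorphic {X} {Y} {X′} {Y′} a b
      (cyclic X x) (cyclic Y y) (cyclic X′ x′) (cyclic Y′ y′)
      i j (≅-trans (≅-sym X≅X′) i) (≅-trans (≅-sym Y≅Y′) j)

  -- The two bracketings are represented by (ab)c and a(bc), which lie in one orbit by associativity
  -- in 𝔸. Commutativity and the unit law are pulled back from 𝔸 in the same way.
  ⊗-assoc : ∀ X Y Z → IsFramed X → IsFramed Y → IsFramed Z → (X ⊗ᵀ Y) ⊗ᵀ Z ≅ X ⊗ᵀ (Y ⊗ᵀ Z)
  ⊗-assoc X Y Z x y z = go (rep X x) (rep Y y) (rep Z z)
    where
    go : ∃[ a ] X ≅ D a → ∃[ b ] Y ≅ D b → ∃[ c ] Z ≅ D c → (X ⊗ᵀ Y) ⊗ᵀ Z ≅ X ⊗ᵀ (Y ⊗ᵀ Z)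
    go (a , i) (b , j) (c , k) = inner (product a b) (product b c)
      where
      inner : ∃[ ab ] ab ≡ a 𝔸ᴿ.* b → ∃[ bc ] bc ≡ b 𝔸ᴿ.* c → (X ⊗ᵀ Y) ⊗ᵀ Z ≅ X ⊗ᵀ (Y ⊗ᵀ Z)
      inner (ab , ab≡) (bc , bc≡) = outer (product ab c) (product a bc)
        where
        XY≅ : X ⊗ᵀ Y ≅ D ab
        XY≅ = ⊗-represent-≡ {X} {Y} a b ab ab≡ (cyclic X x) (cyclic Y y) i j
        YZ≅ : Y ⊗ᵀ Z ≅ D bc
        YZ≅ = ⊗-represent-≡ {Y} {Z} b c bc bc≡ (cyclic Y y) (cyclic Z z) j k
        outer : ∃[ l ] l ≡ ab 𝔸ᴿ.* c → ∃[ r ] r ≡ a 𝔸ᴿ.* bc → (X ⊗ᵀ Y) ⊗ᵀ Z ≅ X ⊗ᵀ (Y ⊗ᵀ Z)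
        outer (l , l≡) (r , r≡) =
          ≅-trans (⊗-represent-≡ {X ⊗ᵀ Y} {Z} ab c l l≡
                    (cyclic (X ⊗ᵀ Y) (⊗-framed X Y x y)) (cyclic Z z) XY≅ k)
          (≅-trans (D-cong l r (assoc-orbit a b c ab bc l r ab≡ bc≡ l≡ r≡))
                   (≅-sym (⊗-represent-≡ {X} {Y ⊗ᵀ Z} a bc r r≡
                     (cyclic X x) (cyclic (Y ⊗ᵀ Z) (⊗-framed Y Z y z)) i YZ≅)))

  ⊗-comm : ∀ X Y → IsFramed X → IsFramed Y → X ⊗ᵀ Y ≅ Y ⊗ᵀ X
  ⊗-comm X Y x y = go (rep X x) (rep Y y)
    where
    go : ∃[ a ] X ≅ D a → ∃[ b ] Y ≅ D b → X ⊗ᵀ Y ≅ Y ⊗ᵀ X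
    go (a , i) (b , j) = outer (product a b) (product b a)
      where
      outer : ∃[ l ] l ≡ a 𝔸ᴿ.* b → ∃[ r ] r ≡ b 𝔸ᴿ.* a → X ⊗ᵀ Y ≅ Y ⊗ᵀ X
      outer (l , l≡) (r , r≡) =
        ≅-trans (⊗-represent-≡ {X} {Y} a b l l≡ (cyclic X x) (cyclic Y y) i j)
        (≅-trans (D-cong l r (comm-orbit a b l r l≡ r≡))
                 (≅-sym (⊗-represent-≡ {Y} {X} b a r r≡ (cyclic Y y) (cyclic X x) j i)))

  ⊗-identityˡ : ∀ X → IsFramed X → 𝟙 ⊗ᵀ X ≅ X
  ⊗-identityˡ X x = go (rep X x) unit
    where
    unit : ∃[ u ] u ≡ (1ᶠ , fromℚʳ 1ℚ)
    unit = (1ᶠ , fromℚʳ 1ℚ) , refl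
    go : ∃[ a ] X ≅ D a → ∃[ u ] u ≡ (1ᶠ , fromℚʳ 1ℚ) → 𝟙 ⊗ᵀ X ≅ X
    go (a , i) (u , u≡) = outer (product u a)
      where
      outer : ∃[ l ] l ≡ u 𝔸ᴿ.* a → 𝟙 ⊗ᵀ X ≅ X
      outer (l , l≡) =
        ≅-trans (⊗-represent-≡ {𝟙} {X} u a l l≡ (cyclic 𝟙 𝟙-framed) (cyclic X x)
                  (≅-sym (D-1 excludedMiddle u u≡)) i)
        (≅-trans (D-cong l a (identity-orbit a u l u≡ l≡)) (≅-sym i))

  D-surjective : ∀ X → IsFramed X → ∃[ a ] (∀ {z} → z Yℚ.≈ a → D z ≅ X)
  D-surjective X x = go (rep X x)
    where
    go : ∃[ a ] X ≅ D a → ∃[ a ] (∀ {z} → z Yℚ.≈ a → D z ≅ X)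
    go (a , X≅Da) = a , λ {z} z∼a → ≅-trans (D-cong z a z∼a) (≅-sym X≅Da)

  Pic-laws : SatisfiesCommutativeMonoidLaws (Pic ⊗-framed 𝟙-framed)
  Pic-laws = FramedMonoid.isCommutativeMonoid _⊗ᵀ_ 𝟙 ⊗-framed 𝟙-framed
    ⊗-cong-≅ ⊗-assoc ⊗-comm ⊗-identityˡ

  D-isIsomorphism : MonoidMorphisms.IsMonoidIsomorphism Yℚ (Pic ⊗-framed 𝟙-framed)
                      (λ a → D a , D-framed excludedMiddle a)
  D-isIsomorphism = FramedMonoid.isMonoidIsomorphism _⊗ᵀ_ 𝟙 ⊗-framed 𝟙-framed
    ⊗-cong-≅ ⊗-assoc ⊗-comm ⊗-identityˡ Yℚ D (D-framed excludedMiddle)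
    D-cong D-injective′ (λ a b → D-⊗ a b (RawMonoid._∙_ Yℚ a b) refl)
    (D-1 excludedMiddle (RawMonoid.ε Yℚ) refl) D-surjective

-- Local cyclicity of L_a is available constructively from its embedding in ℚ, which places this
-- statement outside `PicardMonoid`.
D-*-≅ : ∀ a b → D (a 𝔸ᴿ.* b) ≅ D a ⊗ᵀ D b
D-*-≅ a b = ≅-sym (⊗-represent {D a} {D b} a b
  (multipliers-locallyCyclic (proj₁ a)) (multipliers-locallyCyclic (proj₁ b))
  (≅-refl {D a}) (≅-refl {D b}))

theorem8p6 : (∀ (a b : 𝔸) → D (a 𝔸ᴿ.* b) ≅ D a ⊗ᵀ D b) ×
    SatisfiesCommutativeMonoidLaws Yℚ ×
    (ExcludedMiddle 0ℓ →
    Σ[ D-framed ∈ (∀ (a : 𝔸) → IsFramed (D a)) ]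
    Σ[ ⊗-framed ∈ (∀ (X Y : Triple) → IsFramed X → IsFramed Y → IsFramed (X ⊗ᵀ Y)) ]
    Σ[ 𝟙-framed ∈ IsFramed 𝟙 ]
    SatisfiesCommutativeMonoidLaws (Pic ⊗-framed 𝟙-framed) ×
    MonoidMorphisms.IsMonoidIsomorphism Yℚ (Pic ⊗-framed 𝟙-framed)
    (λ a → D a , D-framed a))
theorem8p6 = D-*-≅ , Yℚ-laws , λ excludedMiddle →
    D-framed excludedMiddle
  , PicardMonoid.⊗-framed excludedMiddle
  , 𝟙-framed
  , PicardMonoid.Pic-laws excludedMiddle
  , PicardMonoid.D-isIsomorphism excludedMiddle
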